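{- For any $n\ge1$, writing $\epsilon_{\mathrm{odd}}(F)$ for the expression equal to $0$ if $n$ is even and $F$ if $n$ is odd, and $\epsilon_{\mathrm{even}}(F)$ for $F$ if $n$ is even and $0$ if $n$ is odd: (i) $\sum_{\pi\in\mathfrak{S}_n(132)}(-1)^{\mathsf{des}\,\pi}q^{(2\text{ - }31)\pi}=\sum_{\pi\in\mathfrak{S}_n(132)}(-1)^{\mathsf{des}\,\pi}q^{(2\text{ - }13)\pi}=\epsilon_{\mathrm{odd}}\big((-q)^{(n-1)/2}C_{(n-1)/2}(q^2)\big)$; (ii) $\sum_{\pi\in\mathfrak{S}_n(213)}(-1)^{\mathsf{des}\,\pi}q^{(31\text{ - }2)\pi}=\sum_{\pi\in\mathfrak{S}_n(213)}(-1)^{\mathsf{des}\,\pi}q^{(13\text{ - }2)\pi}=\epsilon_{\mathrm{odd}}\big((-q)^{(n-1)/2}C_{(n-1)/2}(q^2)\big)$; (iii) $\sum_{\pi\in\mathfrak{S}_n(312)}(-1)^{\mathsf{des}\,\pi}q^{(2\text{ - }31)\pi}=\sum_{\pi\in\mathfrak{S}_n(312)}(-1)^{\mathsf{des}\,\pi}q^{(2\text{ - }13)\pi}=\epsilon_{\mathrm{odd}}\big((-q)^{(n-1)/2}C_{(n-1)/2}(q^2)\big)$; (iv) $\sum_{\pi\in\mathfrak{D}^*_n(132)}(-1)^{\mathsf{des}\,\pi}q^{(2\text{ - }31)\pi}=\epsilon_{\mathrm{even}}\big((-1)^{n/2}\widehat{C}_{n/2}(q)\big)$; (v) $\sum_{\pi\in\mathfrak{D}^*_n(132)}(-q)^{\mathsf{des}\,\pi}q^{(31\text{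 - }2)\pi}=\epsilon_{\mathrm{even}}\big((-q)^{n/2}\overline{C}_{n/2}(q)\big)$; (vi) $\sum_{\pi\in\mathfrak{D}^*_n(213)}(-1)^{\mathsf{des}\,\pi}q^{(13\text{ - }2)\pi}=\epsilon_{\mathrm{even}}\big((-1)^{n/2}q^{(n-2)/2}C_{(n-2)/2}(q^2)\big)$; (vii) $\sum_{\pi\in\mathfrak{D}^*_n(213)}(-q)^{\mathsf{des}\,\pi}q^{(31\text{ - }2)\pi}=\epsilon_{\mathrm{even}}\big((-1)^{n/2}q^{(3n-4)/2}C_{(n-2)/2}(q^2)\big)$; where $\widehat{C}_m(q):=\sum_{\pi\in\mathfrak{A}_{2m}(231)}q^{(13\text{ - }2)\pi}$ and $\overline{C}_m(q):=\sum_{\pi\in\mathfrak{A}_{2m}(231)}q^{(2\text{ - }13)\pi}$.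
   Context: $C_n(q):=C_n(q,q^2)$, where $C_n(t,q)$ is defined by $\sum_{n\ge0}C_n(t,q)z^n=1/(1-c_1z/(1-c_2z/(1-c_3z/\cdots)))$ with $c_{2k-1}=q^{k-1}$, $c_{2k}=tq^{k-1}$. $\mathfrak{S}_n(\tau)$: permutations of $[n]$ avoiding classical pattern $\tau$. For $\pi\in\mathfrak{S}_n$ set $\pi(n+1)=n+1$; $\pi(i)$ is a foremaximum if $\pi(i)<\pi(i+1)$ and $\pi(i)=\max\{\pi(1),\dots,\pi(i)\}$; a coderangement has no foremaximum; $\mathfrak{D}^*_n(\tau)$ is the set of coderangements in $\mathfrak{S}_n(\tau)$. $\mathfrak{A}_n(\tau)$ is the set of alternating (up-down) permutations $\pi(1)<\pi(2)>\pi(3)<\cdots$ in $\mathfrak{S}_n(\tau)$. $\mathsf{des}\,\pi=\#\{i\in[n-1]:\pi(i)>\pi(i+1)\}$; $(31\text{ - }2)\pi=\#\{(i,j):i+1<j\le n,\pi(i+1)<\pi(j)<\pi(i)\}$, $(2\text{ - }31)\pi=\#\{(i,j):j<i<n,\pi(i+1)<\pi(j)<\pi(i)\}$, $(2\text{ - }13)\pi=\#\{(i,j):j<i<n,\pi(i)<\pi(j)<\pi(i+1)\}$, $(13\text{ - }2)\pi=\#\{(i,j):i+1<j\le n,\pi(i)<\pi(j)<\pi(i+1)\}$. -}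

module Defs where

open import Algebra.Bundles using (CommutativeRing; RawRing)
open import Algebra.Morphism.Structures using (IsRingMonomorphism)
import Algebra.Morphism.RingMonomorphism as RingMonomorphism
import Algebra.Properties.AbelianGroup as AbelianGroupProperties
import Algebra.Properties.CommutativeSemigroup as CommutativeSemigroupProperties
import Algebra.Properties.Ring as RingProperties
import Algebra.Properties.Semiring.Exp as Exp
open import Data.Fin as Fin using (Fin; toℕ; inject₁; fromℕ)
import Data.Fin.Properties as Fin
import Data.Integer.Properties as ℤ
open import Data.List using (List; []; _∷_; map; foldr; filter; length; allFin; cartesianProduct; cartesianProductWith)
open import Data.Nat as ℕ using (ℕ; zero; suc; ⌊_/2⌋; parity; z≤n; s≤s)
import Data.Nat.Properties as ℕ
open import Data.Parity using (0ℙ; 1ℙ)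
import Data.Parity.Properties as ℙ
open import Data.Product using (∃; _×_; _,_)
open import Data.Vec as Vec using (Vec; []; _∷_; lookup; _∷ʳ_)
open import Data.Vec.Relation.Unary.AllPairs using (allPairs?)
open import Data.Vec.Relation.Unary.Unique.Propositional using (Unique)
open import Function using (_∘_)
open import Level using (0ℓ)
open import Relation.Binary.PropositionalEquality using (_≡_)
import Relation.Binary.Reasoning.Setoid as SetoidReasoning
open import Relation.Nullary using (¬_; Dec; ¬?; _×-dec_; _→-dec_)

------------------------------------------------------------------------
-- Formal power series over a commutative ring, as coefficient sequences

module PowerSeries {c ℓ} (R : CommutativeRing c ℓ) where

  open CommutativeRing R
  open SetoidReasoning setoid
  open CommutativeSemigroupProperties +-commutativeSemigroup using (interchange)

  Series : Set c
  Series = ℕ → Carrier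

  infix  4 _≋_
  infixl 7 _⊛_
  infixl 6 _⊕_
  infix  8 ⊝_

  _≋_ : Series → Series → Set ℓ
  f ≋ g = ∀ n → f n ≈ g n

  _⊕_ : Series → Series → Series
  (f ⊕ g) n = f n + g n

  ⊝_ : Series → Series
  (⊝ f) n = - f n

  𝟘 : Series
  𝟘 _ = 0#

  𝟙 : Series
  𝟙 zero    = 1#
  𝟙 (suc _) = 0#

  -- The Cauchy product: (f ⊛ g) n = f 0 * g n + f 1 * g (n - 1) + ⋯ + f n * g 0.
  _⊛_ : Series → Series → Series
  (f ⊛ g) zero    = f 0 * g 0
  (f ⊛ g) (suc n) = f 0 * g (suc n) + ((f ∘ suc) ⊛ g) n

  -- Congruence of the product, with the truncation order made explicit.
  ⊛-cong≤ : ∀ f f′ g g′ n → (∀ k → k ℕ.≤ n → f k ≈ f′ k) →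
            (∀ k → k ℕ.≤ n → g k ≈ g′ k) → (f ⊛ g) n ≈ (f′ ⊛ g′) n
  ⊛-cong≤ f f′ g g′ zero    p r = *-cong (p 0 z≤n) (r 0 z≤n)
  ⊛-cong≤ f f′ g g′ (suc n) p r =
    +-cong (*-cong (p 0 z≤n) (r (suc n) ℕ.≤-refl))
           (⊛-cong≤ (f ∘ suc) (f′ ∘ suc) g g′ n
             (λ k k≤n → p (suc k) (s≤s k≤n)) (λ k k≤n → r k (ℕ.m≤n⇒m≤1+n k≤n)))

  ⊛-cong : ∀ {f f′ g g′} → f ≋ f′ → g ≋ g′ → f ⊛ g ≋ f′ ⊛ g′
  ⊛-cong {f} {f′} {g} {g′} p r n = ⊛-cong≤ f f′ g g′ n (λ k _ → p k) (λ k _ → r k)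

  ⊛-zeroˡ : ∀ g → 𝟘 ⊛ g ≋ 𝟘
  ⊛-zeroˡ g zero    = zeroˡ (g 0)
  ⊛-zeroˡ g (suc n) = trans (+-cong (zeroˡ _) (⊛-zeroˡ g n)) (+-identityˡ 0#)

  ⊛-identityˡ : ∀ g → 𝟙 ⊛ g ≋ g
  ⊛-identityˡ g zero    = *-identityˡ (g 0)
  ⊛-identityˡ g (suc n) = trans (+-cong (*-identityˡ _) (⊛-zeroˡ g n)) (+-identityʳ _)

  ⊛-suc : ∀ f g n → (f ⊛ g) (suc n) ≈ f (suc n) * g 0 + (f ⊛ (g ∘ suc)) n
  ⊛-suc f g zero    = +-comm _ _
  ⊛-suc f g (suc n) = begin
    f 0 * g (suc (suc n)) + ((f ∘ suc) ⊛ g) (suc n)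
      ≈⟨ +-congˡ (⊛-suc (f ∘ suc) g n) ⟩
    f 0 * g (suc (suc n)) + (f (suc (suc n)) * g 0 + ((f ∘ suc) ⊛ (g ∘ suc)) n)
      ≈⟨ +-assoc _ _ _ ⟨
    f 0 * g (suc (suc n)) + f (suc (suc n)) * g 0 + ((f ∘ suc) ⊛ (g ∘ suc)) n
      ≈⟨ +-congʳ (+-comm _ _) ⟩
    f (suc (suc n)) * g 0 + f 0 * g (suc (suc n)) + ((f ∘ suc) ⊛ (g ∘ suc)) n
      ≈⟨ +-assoc _ _ _ ⟩
    f (suc (suc n)) * g 0 + (f ⊛ (g ∘ suc)) (suc n) ∎

  ⊛-comm : ∀ f g → f ⊛ g ≋ g ⊛ f
  ⊛-comm f g zero    = *-comm _ _
  ⊛-comm f g (suc n) = trans (+-cong (*-comm _ _) (⊛-comm (f ∘ suc) g n)) (sym (⊛-suc g f n))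

  ⊛-distribʳ : ∀ h f g → (f ⊕ g) ⊛ h ≋ (f ⊛ h) ⊕ (g ⊛ h)
  ⊛-distribʳ h f g zero    = distribʳ _ _ _
  ⊛-distribʳ h f g (suc n) =
    trans (+-cong (distribʳ _ _ _) (⊛-distribʳ h (f ∘ suc) (g ∘ suc) n)) (interchange _ _ _ _)

  ⊛-scale : ∀ a f g n → ((λ k → a * f k) ⊛ g) n ≈ a * (f ⊛ g) n
  ⊛-scale a f g zero    = *-assoc _ _ _
  ⊛-scale a f g (suc n) =
    trans (+-cong (*-assoc _ _ _) (⊛-scale a (f ∘ suc) g n)) (sym (distribˡ _ _ _))

  ⊛-assoc : ∀ f g h → (f ⊛ g) ⊛ h ≋ f ⊛ (g ⊛ h)
  ⊛-assoc f g h zero    = *-assoc _ _ _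
  ⊛-assoc f g h (suc n) = begin
    f 0 * g 0 * h (suc n) + (((λ k → f 0 * g (suc k)) ⊕ ((f ∘ suc) ⊛ g)) ⊛ h) n
      ≈⟨ +-cong (*-assoc _ _ _) (⊛-distribʳ h (λ k → f 0 * g (suc k)) ((f ∘ suc) ⊛ g) n) ⟩
    f 0 * (g 0 * h (suc n)) + (((λ k → f 0 * g (suc k)) ⊛ h) n + (((f ∘ suc) ⊛ g) ⊛ h) n)
      ≈⟨ +-congˡ (+-cong (⊛-scale (f 0) (g ∘ suc) h n) (⊛-assoc (f ∘ suc) g h n)) ⟩
    f 0 * (g 0 * h (suc n)) + (f 0 * ((g ∘ suc) ⊛ h) n + ((f ∘ suc) ⊛ (g ⊛ h)) n)
      ≈⟨ +-assoc _ _ _ ⟨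
    f 0 * (g 0 * h (suc n)) + f 0 * ((g ∘ suc) ⊛ h) n + ((f ∘ suc) ⊛ (g ⊛ h)) n
      ≈⟨ +-congʳ (distribˡ _ _ _) ⟨
    f 0 * (g ⊛ h) (suc n) + ((f ∘ suc) ⊛ (g ⊛ h)) n ∎

  commutativeRing : CommutativeRing c ℓ
  commutativeRing = record
    { Carrier = Series ; _≈_ = _≋_ ; _+_ = _⊕_ ; _*_ = _⊛_ ; -_ = ⊝_ ; 0# = 𝟘 ; 1# = 𝟙
    ; isCommutativeRing = record
      { isRing = record
        { +-isAbelianGroup = record
          { isGroup = record
            { isMonoid = record
              { isSemigroup = record
                { isMagma = record
                  { isEquivalence = record
                    { refl  = λ _ → refl
                    ; sym   = λ p n → sym (p n)
                    ; trans = λ p r n → trans (p n) (r n)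
                    }
                  ; ∙-cong = λ p r n → +-cong (p n) (r n)
                  }
                ; assoc = λ f g h n → +-assoc (f n) (g n) (h n)
                }
              ; identity = (λ f n → +-identityˡ (f n)) , (λ f n → +-identityʳ (f n))
              }
            ; inverse = (λ f n → -‿inverseˡ (f n)) , (λ f n → -‿inverseʳ (f n))
            ; ⁻¹-cong = λ p n → -‿cong (p n)
            }
          ; comm = λ f g n → +-comm (f n) (g n)
          }
        ; *-cong     = λ {f} {f′} {g} {g′} → ⊛-cong {f} {f′} {g} {g′}
        ; *-assoc    = ⊛-assoc
        ; *-identity = ⊛-identityˡ , (λ f n → trans (⊛-comm f 𝟙 n) (⊛-identityˡ f n))
        ; distrib    = (λ h f g n → trans (⊛-comm h (f ⊕ g) n)
                                   (trans (⊛-distribʳ h f g n)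
                                          (+-cong (⊛-comm f h n) (⊛-comm g h n))))
                     , ⊛-distribʳ
        }
      ; *-comm = ⊛-comm
      }
    }

  -- Partial sums 1 + h + ⋯ + hᴺ of the geometric series, in Horner form.
  geometric : Series → ℕ → Series
  geometric h zero    = 𝟙
  geometric h (suc N) = 𝟙 ⊕ (h ⊛ geometric h N)

  -- The series 1/(1 - h), for h with zero constant term: the coefficient of
  -- zⁿ in the geometric series is already that of its n-th partial sum.
  1/1-_ : Series → Series
  (1/1- h) n = geometric h n n

  _z·_ : Carrier → Series → Series
  (a z· f) zero    = 0#
  (a z· f) (suc n) = a * f n

  -- Truncations of the continued fraction
  --   1/(1 - c₁z/(1 - c₂z/(1 - c₃z/⋯)));
  -- the value c 0 is not used.
  convergent : ℕ → (ℕ → Carrier) → Series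
  convergent zero    c = 𝟙
  convergent (suc d) c = 1/1- (c 1 z· convergent d (c ∘ suc))

  -- The z-adic limit of the convergents: the d-th convergent is correct
  -- up to and including the coefficient of z^d (convergent-stable below).
  continuedFraction : (ℕ → Carrier) → Series
  continuedFraction c n = convergent n c n

  -- The remainder of this module justifies the last two limits.

  ⊛-cong< : ∀ h f g n → h 0 ≈ 0# → (∀ k → k ℕ.< n → f k ≈ g k) → (h ⊛ f) n ≈ (h ⊛ g) n
  ⊛-cong< h f g zero    h₀ p = trans (trans (*-congʳ h₀) (zeroˡ _)) (sym (trans (*-congʳ h₀) (zeroˡ _)))
  ⊛-cong< h f g (suc n) h₀ p =
    +-cong (trans (trans (*-congʳ h₀) (zeroˡ _)) (sym (trans (*-congʳ h₀) (zeroˡ _))))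
           (⊛-cong≤ (h ∘ suc) (h ∘ suc) f g n (λ _ _ → refl) (λ k k≤n → p k (s≤s k≤n)))

  geometric-stable : ∀ h → h 0 ≈ 0# → ∀ M N n → n ℕ.≤ M → n ℕ.≤ N → geometric h M n ≈ geometric h N n
  geometric-stable h h₀ zero    zero    n p r = refl
  geometric-stable h h₀ zero    (suc N) zero p r =
    sym (trans (+-congˡ (trans (*-congʳ h₀) (zeroˡ _))) (+-identityʳ _))
  geometric-stable h h₀ (suc M) zero    zero p r =
    trans (+-congˡ (trans (*-congʳ h₀) (zeroˡ _))) (+-identityʳ _)
  geometric-stable h h₀ (suc M) (suc N) n p r =
    +-congˡ (⊛-cong< h (geometric h M) (geometric h N) n h₀ λ k k<n →
      geometric-stable h h₀ M N k (ℕ.≤-pred (ℕ.≤-trans k<n p)) (ℕ.≤-pred (ℕ.≤-trans k<n r)))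

  1/1-‿unfold : ∀ h → h 0 ≈ 0# → 1/1- h ≋ 𝟙 ⊕ (h ⊛ (1/1- h))
  1/1-‿unfold h h₀ n = trans (geometric-stable h h₀ n (suc n) n ℕ.≤-refl (ℕ.n≤1+n n))
    (+-congˡ (⊛-cong< h (geometric h n) (1/1- h) n h₀ λ k k<n →
      geometric-stable h h₀ n k k (ℕ.<⇒≤ k<n) ℕ.≤-refl))

  1/1-‿inverse : ∀ h → h 0 ≈ 0# → (𝟙 ⊕ (⊝ h)) ⊛ (1/1- h) ≋ 𝟙
  1/1-‿inverse h h₀ n = begin
    ((𝟙 ⊕ (⊝ h)) ⊛ G) n                  ≈⟨ ⊛-distribʳ G 𝟙 (⊝ h) n ⟩
    (𝟙 ⊛ G) n + ((⊝ h) ⊛ G) n            ≈⟨ +-cong (⊛-identityˡ G n) (sym (S.-‿distribˡ-* h G n)) ⟩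
    G n - (h ⊛ G) n                      ≈⟨ +-congʳ (1/1-‿unfold h h₀ n) ⟩
    𝟙 n + (h ⊛ G) n - (h ⊛ G) n          ≈⟨ +-assoc _ _ _ ⟩
    𝟙 n + ((h ⊛ G) n - (h ⊛ G) n)        ≈⟨ +-congˡ (-‿inverseʳ _) ⟩
    𝟙 n + 0#                             ≈⟨ +-identityʳ _ ⟩
    𝟙 n ∎
    where
    G : Series
    G = 1/1- h
    module S = RingProperties (CommutativeRing.ring commutativeRing)

  geometric-cong≤ : ∀ h h′ N n → (∀ k → k ℕ.≤ n → h k ≈ h′ k) → geometric h N n ≈ geometric h′ N n
  geometric-cong≤ h h′ zero    n p = refl
  geometric-cong≤ h h′ (suc N) n p =
    +-congˡ (⊛-cong≤ h h′ (geometric h N) (geometric h′ N) n p λ k k≤n →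
      geometric-cong≤ h h′ N k (λ j j≤k → p j (ℕ.≤-trans j≤k k≤n)))

  1/1-z·-cong< : ∀ a f g n → (∀ k → k ℕ.< n → f k ≈ g k) → (1/1- (a z· f)) n ≈ (1/1- (a z· g)) n
  1/1-z·-cong< a f g n p = geometric-cong≤ (a z· f) (a z· g) n n
    λ { zero _ → refl ; (suc k) k<n → *-congˡ (p k k<n) }

  convergent-stable : ∀ c d e n → n ℕ.≤ d → n ℕ.≤ e → convergent d c n ≈ convergent e c n
  convergent-stable c zero    zero    n    p r = refl
  convergent-stable c zero    (suc e) zero p r = refl
  convergent-stable c (suc d) zero    zero p r = refl
  convergent-stable c (suc d) (suc e) n    p r =
    1/1-z·-cong< (c 1) (convergent d (c ∘ suc)) (convergent e (c ∘ suc)) n λ k k<n →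
      convergent-stable (c ∘ suc) d e k (ℕ.≤-pred (ℕ.≤-trans k<n p)) (ℕ.≤-pred (ℕ.≤-trans k<n r))

  continuedFraction-unfold : ∀ c → continuedFraction c ≋ 1/1- (c 1 z· continuedFraction (c ∘ suc))
  continuedFraction-unfold c n =
    trans (convergent-stable c n (suc n) n ℕ.≤-refl (ℕ.n≤1+n n))
      (1/1-z·-cong< (c 1) (convergent n (c ∘ suc)) (continuedFraction (c ∘ suc)) n λ k k<n →
        convergent-stable (c ∘ suc) n k k (ℕ.<⇒≤ k<n) ℕ.≤-refl)

------------------------------------------------------------------------
-- The (t,q)-Catalan numbers C_n(t,q), for t and q in a commutative ring

module Catalan {c ℓ} (R : CommutativeRing c ℓ) where

  open CommutativeRing R using (Carrier; _*_; semiring)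
  open Exp semiring using (_^_)
  open PowerSeries R using (continuedFraction)

  -- c_{2k-1} = q^{k-1} and c_{2k} = t q^{k-1}.
  catalanCoeff : Carrier → Carrier → ℕ → Carrier
  catalanCoeff t q j with parity j
  ... | 1ℙ = q ^ ⌊ j ℕ.∸ 1 /2⌋
  ... | 0ℙ = t * q ^ (⌊ j /2⌋ ℕ.∸ 1)

  Cₜ : ℕ → Carrier → Carrier → Carrier
  Cₜ n t q = continuedFraction (catalanCoeff t q) n

  C : ℕ → Carrier → Carrier
  C n q = Cₜ n q (q ^ 2)

------------------------------------------------------------------------
-- Polynomials over a commutative ring, as lists of coefficients starting
-- with the constant one; trailing zeros are immaterial for _≈ₚ_

module Polynomial {c ℓ} (R : CommutativeRing c ℓ) where

  open CommutativeRing R hiding (rawRing)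
  open PowerSeries R using (Series; _≋_; _⊛_; 𝟙; ⊛-zeroˡ)
  open AbelianGroupProperties +-abelianGroup using (ε⁻¹≈ε)

  Poly : Set c
  Poly = List Carrier

  coeff : Poly → Series
  coeff []      n       = 0#
  coeff (a ∷ p) zero    = a
  coeff (a ∷ p) (suc n) = coeff p n

  _≈ₚ_ : Poly → Poly → Set ℓ
  p ≈ₚ r = coeff p ≋ coeff r

  _+ₚ_ : Poly → Poly → Poly
  []      +ₚ r       = r
  (a ∷ p) +ₚ []      = a ∷ p
  (a ∷ p) +ₚ (b ∷ r) = (a + b) ∷ (p +ₚ r)

  _*ₚ_ : Poly → Poly → Poly
  []      *ₚ r = []
  (a ∷ p) *ₚ r = map (a *_) r +ₚ (0# ∷ (p *ₚ r))

  rawRing : RawRing c ℓ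
  rawRing = record
    { Carrier = Poly ; _≈_ = _≈ₚ_ ; _+_ = _+ₚ_ ; _*_ = _*ₚ_
    ; -_ = map (-_) ; 0# = [] ; 1# = 1# ∷ []
    }

  X : Poly
  X = 0# ∷ 1# ∷ []

  coeff-+ : ∀ p r n → coeff (p +ₚ r) n ≈ coeff p n + coeff r n
  coeff-+ []      r       n       = sym (+-identityˡ _)
  coeff-+ (a ∷ p) []      n       = sym (+-identityʳ _)
  coeff-+ (a ∷ p) (b ∷ r) zero    = refl
  coeff-+ (a ∷ p) (b ∷ r) (suc n) = coeff-+ p r n

  coeff-scale : ∀ a p n → coeff (map (a *_) p) n ≈ a * coeff p n
  coeff-scale a []      n       = sym (zeroʳ a)
  coeff-scale a (b ∷ p) zero    = refl
  coeff-scale a (b ∷ p) (suc n) = coeff-scale a p n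

  coeff-neg : ∀ p n → coeff (map (-_) p) n ≈ - coeff p n
  coeff-neg []      n       = sym ε⁻¹≈ε
  coeff-neg (b ∷ p) zero    = refl
  coeff-neg (b ∷ p) (suc n) = coeff-neg p n

  coeff-* : ∀ p r → coeff (p *ₚ r) ≋ coeff p ⊛ coeff r
  coeff-* []      r n       = sym (⊛-zeroˡ (coeff r) n)
  coeff-* (a ∷ p) r zero    =
    trans (coeff-+ (map (a *_) r) (0# ∷ (p *ₚ r)) 0) (trans (+-identityʳ _) (coeff-scale a r 0))
  coeff-* (a ∷ p) r (suc n) =
    trans (coeff-+ (map (a *_) r) (0# ∷ (p *ₚ r)) (suc n))
          (+-cong (coeff-scale a r (suc n)) (coeff-* p r n))

  coeff-1 : coeff (1# ∷ []) ≋ 𝟙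
  coeff-1 zero    = refl
  coeff-1 (suc n) = refl

  coeff-isRingMonomorphism :
    IsRingMonomorphism rawRing (CommutativeRing.rawRing (PowerSeries.commutativeRing R)) coeff
  coeff-isRingMonomorphism = record
    { isRingHomomorphism = record
      { isSemiringHomomorphism = record
        { isNearSemiringHomomorphism = record
          { +-isMonoidHomomorphism = record
            { isMagmaHomomorphism = record
              { isRelHomomorphism = record { cong = λ p → p }
              ; homo = coeff-+
              }
            ; ε-homo = λ _ → refl
            }
          ; *-homo = coeff-*
          }
        ; 1#-homo = coeff-1
        }
      ; -‿homo = coeff-neg
      }
    ; injective = λ p → p
    }

  commutativeRing : CommutativeRing c ℓ
  commutativeRing = record
    { RawRing rawRing
    ; isCommutativeRing = RingMonomorphism.isCommutativeRing coeff-isRingMonomorphism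
        (CommutativeRing.isCommutativeRing (PowerSeries.commutativeRing R))
    }

ℤ[q] : CommutativeRing 0ℓ 0ℓ
ℤ[q] = Polynomial.commutativeRing ℤ.+-*-commutativeRing

open CommutativeRing ℤ[q] public using (_≈_; _+_; _*_; -_; 0#; 1#)
open Exp (CommutativeRing.semiring ℤ[q]) public using (_^_)
open Catalan ℤ[q] public using (Cₜ; C)

q : CommutativeRing.Carrier ℤ[q]
q = Polynomial.X ℤ.+-*-commutativeRing

infix 5 ∑

∑ : {A : Set} → List A → (A → CommutativeRing.Carrier ℤ[q]) → CommutativeRing.Carrier ℤ[q]
∑ xs f = foldr _+_ 0# (map f xs)

syntax ∑ xs (λ x → e) = ∑[ x ∈ xs ] e

ε-odd ε-even : ℕ → CommutativeRing.Carrier ℤ[q] → CommutativeRing.Carrier ℤ[q]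
ε-odd n F with parity n
... | 0ℙ = 0#
... | 1ℙ = F
ε-even n F with parity n
... | 0ℙ = F
... | 1ℙ = 0#

------------------------------------------------------------------------
-- Permutations in one-line notation.  Positions and values are shifted
-- down by one, from {1,…,n} to Fin n.

Word : ℕ → Set
Word n = Vec (Fin n) n

words : (n k : ℕ) → List (Vec (Fin n) k)
words n zero    = [] ∷ []
words n (suc k) = cartesianProductWith _∷_ (allFin n) (words n k)

unique? : ∀ {n k} (w : Vec (Fin n) k) → Dec (Unique w)
unique? = allPairs? (λ x y → ¬? (x Fin.≟ y))

permutations : (n : ℕ) → List (Word n)
permutations n = filter unique? (words n n)

module _ {n : ℕ} where

  infix 4 _⋖_ _⋖?_

  _⋖_ : Fin n → Fin n → Set
  i ⋖ i⁺ = suc (toℕ i) ≡ toℕ i⁺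

  _⋖?_ : (i i⁺ : Fin n) → Dec (i ⋖ i⁺)
  i ⋖? i⁺ = suc (toℕ i) ℕ.≟ toℕ i⁺

  OrderIsomorphic : Vec ℕ 3 → Vec (Fin n) 3 → Set
  OrderIsomorphic τ w = ∀ a b →
    (lookup τ a ℕ.< lookup τ b → lookup w a Fin.< lookup w b) ×
    (lookup w a Fin.< lookup w b → lookup τ a ℕ.< lookup τ b)

  orderIsomorphic? : ∀ τ w → Dec (OrderIsomorphic τ w)
  orderIsomorphic? τ w = Fin.all? λ a → Fin.all? λ b →
    ((lookup τ a ℕ.<? lookup τ b) →-dec (lookup w a Fin.<? lookup w b)) ×-dec
    ((lookup w a Fin.<? lookup w b) →-dec (lookup τ a ℕ.<? lookup τ b))

  Contains : Vec ℕ 3 → Word n → Set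
  Contains τ π = ∃ λ i → ∃ λ j → ∃ λ k → i Fin.< j × j Fin.< k ×
    OrderIsomorphic τ (lookup π i ∷ lookup π j ∷ lookup π k ∷ [])

  contains? : ∀ τ π → Dec (Contains τ π)
  contains? τ π = Fin.any? λ i → Fin.any? λ j → Fin.any? λ k →
    (i Fin.<? j) ×-dec (j Fin.<? k) ×-dec
    orderIsomorphic? τ (lookup π i ∷ lookup π j ∷ lookup π k ∷ [])

  -- π followed by the conventional value π(n+1) = n+1.
  extend : Word n → Word (suc n)
  extend π = Vec.map inject₁ π ∷ʳ fromℕ n

  Foremaximum : Word n → Fin n → Set
  Foremaximum π i =
    lookup (extend π) (inject₁ i) Fin.< lookup (extend π) (Fin.suc i) ×
    (∀ j → j Fin.≤ i → lookup π j Fin.≤ lookup π i)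

  foremaximum? : ∀ π i → Dec (Foremaximum π i)
  foremaximum? π i =
    (lookup (extend π) (inject₁ i) Fin.<? lookup (extend π) (Fin.suc i)) ×-dec
    (Fin.all? λ j → (j Fin.≤? i) →-dec (lookup π j Fin.≤? lookup π i))

  Coderangement : Word n → Set
  Coderangement π = ¬ (∃ λ i → Foremaximum π i)

  coderangement? : ∀ π → Dec (Coderangement π)
  coderangement? π = ¬? (Fin.any? (foremaximum? π))

  -- Ascents start at the odd positions, which are the even elements of Fin n.
  Alternating : Word n → Set
  Alternating π = ∀ i i⁺ → i ⋖ i⁺ →
    (parity (toℕ i) ≡ 0ℙ → lookup π i Fin.< lookup π i⁺) ×
    (parity (toℕ i) ≡ 1ℙ → lookup π i Fin.> lookup π i⁺)

  alternating? : ∀ π → Dec (Alternating π)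
  alternating? π = Fin.all? λ i → Fin.all? λ i⁺ → (i ⋖? i⁺) →-dec
    (((parity (toℕ i) ℙ.≟ 0ℙ) →-dec (lookup π i Fin.<? lookup π i⁺)) ×-dec
     ((parity (toℕ i) ℙ.≟ 1ℙ) →-dec (lookup π i⁺ Fin.<? lookup π i)))

  des : Word n → ℕ
  des π = length (filter
    (λ { (i , i⁺) → (i ⋖? i⁺) ×-dec (lookup π i⁺ Fin.<? lookup π i) })
    (cartesianProduct (allFin n) (allFin n)))

  -- The vincular statistics count pairs (i , j); here they are counted as
  -- triples (i , i⁺ , j), the second entry being determined by the first.
  positions : List (Fin n × Fin n × Fin n)
  positions = cartesianProduct (allFin n) (cartesianProduct (allFin n) (allFin n))

  ⟨31-2⟩ ⟨2-31⟩ ⟨2-13⟩ ⟨13-2⟩ : Word n → ℕ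
  ⟨31-2⟩ π = length (filter
    (λ { (i , i⁺ , j) → (i ⋖? i⁺) ×-dec (i⁺ Fin.<? j) ×-dec
         (lookup π i⁺ Fin.<? lookup π j) ×-dec (lookup π j Fin.<? lookup π i) })
    positions)
  ⟨2-31⟩ π = length (filter
    (λ { (i , i⁺ , j) → (i ⋖? i⁺) ×-dec (j Fin.<? i) ×-dec
         (lookup π i⁺ Fin.<? lookup π j) ×-dec (lookup π j Fin.<? lookup π i) })
    positions)
  ⟨2-13⟩ π = length (filter
    (λ { (i , i⁺ , j) → (i ⋖? i⁺) ×-dec (j Fin.<? i) ×-dec
         (lookup π i Fin.<? lookup π j) ×-dec (lookup π j Fin.<? lookup π i⁺) })
    positions)
  ⟨13-2⟩ π = length (filter
    (λ { (i , i⁺ , j) → (i ⋖? i⁺) ×-dec (i⁺ Fin.<? j) ×-dec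
         (lookup π i Fin.<? lookup π j) ×-dec (lookup π j Fin.<? lookup π i⁺) })
    positions)

𝔖 𝔇* 𝔄 : (n : ℕ) → Vec ℕ 3 → List (Word n)
𝔖  n τ = filter (λ π → ¬? (contains? τ π)) (permutations n)
𝔇* n τ = filter coderangement? (𝔖 n τ)
𝔄  n τ = filter alternating? (𝔖 n τ)

p132 p213 p231 p312 : Vec ℕ 3
p132 = 1 ∷ 3 ∷ 2 ∷ []
p213 = 2 ∷ 1 ∷ 3 ∷ []
p231 = 2 ∷ 3 ∷ 1 ∷ []
p312 = 3 ∷ 1 ∷ 2 ∷ []

Ĉ C̄ : ℕ → CommutativeRing.Carrier ℤ[q]
Ĉ m = ∑[ π ∈ 𝔄 (2 ℕ.* m) p231 ] q ^ ⟨13-2⟩ π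
C̄ m = ∑[ π ∈ 𝔄 (2 ℕ.* m) p231 ] q ^ ⟨2-13⟩ π

{-# OPTIONS --safe #-}

-- Complement, reversal and reverse-complement carry all four pattern classes
-- to the class of 132-avoiders, so that only this class has to be enumerated.
-- A nonempty 132-avoider is A m B with m the maximum and A > B, and for each
-- statistic its value on A m B is determined by A and B.  This gives functional
-- equations for the signed generating functions.  Writing fₙ for the signed sum
-- of q^(2-31), f(z) = z - z f(qz) f(z), whose solution is z κ(-qz²) for the
-- continued fraction κ of Cₘ(q²); the series of q^(2-13) satisfies the same
-- equation after eliminating the auxiliary series of q^((2-31) + des).  The
-- series of coderangements and of alternating permutations solve the same
-- equations up to the substitution fₙ ↦ b^⌊n/2⌋ fₙ.  Under reverse-complement,
-- the coderangements avoiding 213 become the 132-avoiders ending in 1.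

module Submission where

open import Defs using
  ( module PowerSeries; module Catalan; Word; words; unique?; permutations; _⋖_; OrderIsomorphic; Contains
  ; contains?; extend; Foremaximum; Coderangement; coderangement?; Alternating; alternating?; positions
  ; des; ⟨31-2⟩; ⟨2-31⟩; ⟨2-13⟩; ⟨13-2⟩; 𝔖; 𝔇*; 𝔄; p132; p213; p231; p312)
open import Algebra.Bundles using (CommutativeRing)
import Algebra.Properties.CommutativeMonoid.Sum as CommutativeMonoidSum
import Algebra.Properties.CommutativeSemigroup as CommutativeSemigroupProperties
import Algebra.Properties.CommutativeSemiring.Exp as CommutativeSemiringExp
import Algebra.Properties.Ring as RingProperties
import Algebra.Solver.Ring.NaturalCoefficients.Default as SemiringSolver
open import Data.Bool using (Bool; true; false; not; _∧_; T)
import Data.Bool.Properties as Bool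
open import Data.Empty using (⊥-elim)
open import Data.Fin as Fin using (Fin; zero; suc; toℕ; opposite; inject₁; fromℕ; fromℕ<)
import Data.Fin.Permutation as Permutation
import Data.Fin.Properties as Fin
open import Data.List as List using (List; []; _∷_; _++_; _∷ʳ_; map; foldr; filter; length; null; upTo; allFin; cartesianProduct)
open import Data.List.Membership.Propositional using (_∈_; _∉_)
import Data.List.Membership.Propositional.Properties as ∈
open import Data.List.Membership.Propositional.Properties.WithK using (unique∧set⇒bag)
import Data.List.Properties as List
open import Data.List.Relation.Binary.BagAndSetEquality using (∼bag⇒↭)
open import Data.List.Relation.Binary.Disjoint.Propositional using (Disjoint)
open import Data.List.Relation.Binary.Permutation.Propositional using (_↭_; ↭-sym)
open import Data.List.Relation.Binary.Permutation.Propositional.Properties using (∈-resp-↭)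
open import Data.List.Relation.Binary.Subset.Propositional using (_⊆_)
open import Data.List.Relation.Unary.All as All using (All; []; _∷_)
import Data.List.Relation.Unary.All.Properties as All
open import Data.List.Relation.Unary.AllPairs as AllPairs using (AllPairs; []; _∷_)
import Data.List.Relation.Unary.AllPairs.Properties as AllPairs
open import Data.List.Relation.Unary.Any using (here; there)
open import Data.List.Relation.Unary.Unique.Propositional using (Unique)
import Data.List.Relation.Unary.Unique.Propositional.Properties as Unique
open import Data.Nat as ℕ using (ℕ; zero; suc; _∸_; ⌊_/2⌋; parity; z≤n; s≤s)
open import Data.List.Membership.DecPropositional ℕ._≟_ using (_∈?_)
import Data.Nat.Properties as ℕ
open import Data.Nat.Solver using (module +-*-Solver)
open import Data.Parity as ℙ using (0ℙ; 1ℙ)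
open import Data.Product using (∃; ∃₂; _×_; _,_; proj₁; proj₂; uncurry)
open import Data.Sum using (_⊎_; inj₁; inj₂; [_,_]′)
open import Data.Vec as Vec using (Vec; []; _∷_; lookup)
import Data.Vec.Properties as Vec
open import Data.Vec.Relation.Unary.Unique.Propositional using () renaming (Unique to Uniqueⱽ)
import Data.Vec.Relation.Unary.Unique.Propositional.Properties as VecUnique
open import Function using (_∘_; id; mk⇔)
open import Relation.Binary.Definitions using (tri<; tri≈; tri>)
open import Relation.Binary.PropositionalEquality as ≡ using (_≡_; _≢_)
import Relation.Binary.Reasoning.Setoid as SetoidReasoning
open import Relation.Nullary using (¬_; ¬?; Dec; does; yes; no; contradiction)

-- Letters are counted from 0, so B is a permutation of 0, ..., |B|-1 and A is a shifted one;
-- statistics live on lists of naturals because the two blocks have varying lengths. Each vincular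
-- statistic counts crossings of the level of a letter x by steps of the word. For x in A, the
-- letters of B lie below x and m above, so the step out of m is one more downward crossing: 2-31
-- gains q^|A|, the substitution z ↦ qz. Two statistics are not closed under the decomposition. The
-- 2-13 of A m equals (2-31) + des of A, which forces the auxiliary weight (-q)^des. The 31-2 of m B
-- involves the letter in front of B, so a larger letter is prefixed once and for all; then a
-- nonempty A gives a factor q, a nonempty B a factor t, and t = -q yields u = z(1 + qu)(1 - qu),
-- whose linear terms cancel. The choice t = -1 makes linear terms cancel in the other sums. For
-- C_m(q²) the coefficients of the continued fraction are the powers of q², so its tail is the
-- fraction itself with z ↦ q²z; this is the source of the functional equation.

-- Recursions for power series and their unique solutions

module SeriesEquations {c ℓ} (R : CommutativeRing c ℓ) where

  open CommutativeRing R
  open PowerSeries R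
  open CommutativeSemiringExp commutativeSemiring
  open CommutativeSemigroupProperties *-commutativeSemigroup using (interchange)
  open SetoidReasoning setoid

  infixr 5 _∷ˢ_
  infixr 7 _·_

  _∷ˢ_ : Carrier → Series → Series
  (a ∷ˢ f) zero    = a
  (a ∷ˢ f) (suc n) = f n

  _·_ : Carrier → Series → Series
  (a · f) n = a * f n

  -- The substitution z ↦ pz.
  dilate : Carrier → Series → Series
  dilate p f n = p ^ n * f n

  -- Coefficient n of the image depends only on coefficients up to n of the argument; with the
  -- factor z that `_∷ˢ_` adds, f ↦ a + z Ψ(f) is a contraction in the z-adic sense.
  Causal : (Series → Series) → Set _
  Causal Ψ = ∀ f g n → (∀ k → k ℕ.≤ n → f k ≈ g k) → Ψ f n ≈ Ψ g n

  recursion-unique : ∀ {a Ψ f g} → Causal Ψ → f ≋ a ∷ˢ Ψ f → g ≋ a ∷ˢ Ψ g → f ≋ g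
  recursion-unique {a} {Ψ} {f} {g} causal f-eq g-eq n = agree n n ℕ.≤-refl
    where
    -- The bound `n` encodes strong induction: coefficient k + 1 needs all coefficients up to k at
    -- once.
    agree : ∀ n k → k ℕ.≤ n → f k ≈ g k
    agree n       zero    _         = trans (f-eq 0) (sym (g-eq 0))
    agree (suc n) (suc k) (s≤s k≤n) =
      trans (f-eq (suc k))
        (trans (causal f g k (λ j j≤k → agree n j (ℕ.≤-trans j≤k k≤n))) (sym (g-eq (suc k))))

  dilate-causal : ∀ p → Causal (dilate p)
  dilate-causal p f g n f≈g = *-congˡ (f≈g n ℕ.≤-refl)

  ⊛-causal : ∀ {Φ Ψ} → Causal Φ → Causal Ψ → Causal (λ f → Φ f ⊛ Ψ f)
  ⊛-causal {Φ} {Ψ} Φ-causal Ψ-causal f g n f≈g = ⊛-cong≤ (Φ f) (Φ g) (Ψ f) (Ψ g) n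
    (λ k k≤n → Φ-causal f g k (λ j j≤k → f≈g j (ℕ.≤-trans j≤k k≤n)))
    (λ k k≤n → Ψ-causal f g k (λ j j≤k → f≈g j (ℕ.≤-trans j≤k k≤n)))

  id-causal : Causal (λ f → f)
  id-causal f g n f≈g = f≈g n ℕ.≤-refl

  const-causal : ∀ h → Causal (λ _ → h)
  const-causal h f g n _ = refl

  affine-causal : ∀ {Ψ} h a → Causal Ψ → Causal (λ f → h ⊕ a · Ψ f)
  affine-causal h a Ψ-causal f g n f≈g = +-congˡ (*-congˡ (Ψ-causal f g n f≈g))

  -- Keeping the constraint i + j = n allows the factor `a` to depend on n, as it does for
  -- substitutions and for `twist`.
  ⊛-cong-terms : ∀ a f g f′ g′ n → (∀ i j → i ℕ.+ j ≡ n → f i * g j ≈ a * (f′ i * g′ j)) →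
                 (f ⊛ g) n ≈ a * (f′ ⊛ g′) n
  ⊛-cong-terms a f g f′ g′ zero    eq = eq 0 0 ≡.refl
  ⊛-cong-terms a f g f′ g′ (suc n) eq = trans
    (+-cong (eq 0 (suc n) ≡.refl)
            (⊛-cong-terms a (f ∘ suc) g (f′ ∘ suc) g′ n λ i j i+j≡n → eq (suc i) j (≡.cong suc i+j≡n)))
    (sym (distribˡ a _ _))

  dilate-⊛ : ∀ p f g → dilate p f ⊛ dilate p g ≋ dilate p (f ⊛ g)
  dilate-⊛ p f g n = ⊛-cong-terms (p ^ n) _ _ f g n λ i j i+j≡n →
    trans (interchange (p ^ i) (f i) (p ^ j) (g j))
          (*-congʳ (trans (sym (^-homo-* p i j)) (^-congʳ p i+j≡n)))

  twist : Carrier → Series → Series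
  twist b f n = b ^ ⌊ n /2⌋ * f n

  OddSupported : Series → Set ℓ
  OddSupported f = ∀ n → parity n ≡ 0ℙ → f n ≈ 0#

  ⌊i+j+1/2⌋ : ∀ i j → parity j ≡ 1ℙ → ⌊ suc (i ℕ.+ j) /2⌋ ≡ suc (⌊ i /2⌋ ℕ.+ ⌊ j /2⌋)
  ⌊i+j+1/2⌋ zero          (suc zero)    _   = ≡.refl
  ⌊i+j+1/2⌋ zero          (suc (suc j)) odd = ≡.cong suc (⌊i+j+1/2⌋ 0 j odd)
  ⌊i+j+1/2⌋ (suc zero)    (suc zero)    _   = ≡.refl
  ⌊i+j+1/2⌋ (suc zero)    (suc (suc j)) odd = ≡.cong suc (⌊i+j+1/2⌋ 1 j odd)
  ⌊i+j+1/2⌋ (suc (suc i)) j             odd = ≡.cong suc (⌊i+j+1/2⌋ i j odd)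

  -- `twist b` is not multiplicative, because ⌊i/2⌋ + ⌊j/2⌋ falls short of a half-integer bound by
  -- an amount depending on parities. If j is odd, it is exactly one less than ⌊(n+1)/2⌋ whatever
  -- the parity of i; the terms with j even vanish.
  twist-⊛ : ∀ b f g → OddSupported g → ∀ n → b * (twist b f ⊛ twist b g) n ≈ b ^ ⌊ suc n /2⌋ * (f ⊛ g) n
  twist-⊛ b f g g-odd n = trans (sym (⊛-scale b (twist b f) (twist b g) n))
    (⊛-cong-terms (b ^ ⌊ suc n /2⌋) _ _ f g n term)
    where
    term : ∀ i j → i ℕ.+ j ≡ n →
           b * (b ^ ⌊ i /2⌋ * f i) * (b ^ ⌊ j /2⌋ * g j) ≈ b ^ ⌊ suc n /2⌋ * (f i * g j)
    term i j i+j≡n with parity j in eq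
    ... | 0ℙ = trans
      (trans (*-congˡ (trans (*-congˡ (g-odd j eq)) (zeroʳ _))) (zeroʳ _))
      (sym (trans (*-congˡ (trans (*-congˡ (g-odd j eq)) (zeroʳ _))) (zeroʳ _)))
    ... | 1ℙ = begin
      b * (b ^ ⌊ i /2⌋ * f i) * (b ^ ⌊ j /2⌋ * g j)   ≈⟨ *-congʳ (*-assoc _ _ _) ⟨
      b * b ^ ⌊ i /2⌋ * f i * (b ^ ⌊ j /2⌋ * g j)     ≈⟨ interchange _ _ _ _ ⟩
      b * b ^ ⌊ i /2⌋ * b ^ ⌊ j /2⌋ * (f i * g j)     ≈⟨ *-congʳ (^-homo-* b (suc ⌊ i /2⌋) ⌊ j /2⌋) ⟨
      b ^ suc (⌊ i /2⌋ ℕ.+ ⌊ j /2⌋) * (f i * g j)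
        ≈⟨ *-congʳ (^-congʳ b (≡.trans (≡.sym (⌊i+j+1/2⌋ i j eq)) (≡.cong (λ k → ⌊ suc k /2⌋) i+j≡n))) ⟩
      b ^ ⌊ suc n /2⌋ * (f i * g j) ∎

  dilate-twist : ∀ p b f → dilate p (twist b f) ≋ twist b (dilate p f)
  dilate-twist p b f n = x∙yz≈y∙xz _ _ _
    where open CommutativeSemigroupProperties *-commutativeSemigroup using (x∙yz≈y∙xz)

  -- In the applications `o` counts up-down words of odd length, `e` down-up words of even length,
  -- `f` signed nonempty words and `d` signed coderangements. Each use of the recursion for `f` or
  -- `d` carries one more factor b than its unsigned counterpart, and `twist-⊛` says that this
  -- factor is what ⌊n/2⌋ accumulates.
  module _ (p a b : Carrier) {o e f d : Series}
    (o-odd : OddSupported o)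
    (o-eq : o ≋ 0# ∷ˢ 𝟙 ⊕ a · (dilate p o ⊛ o))
    (e-eq : e ≋ 1# ∷ˢ dilate p e ⊛ o)
    (f-eq : f ≋ 0# ∷ˢ 𝟙 ⊕ (a * b) · (dilate p f ⊛ f))
    (d-eq : d ≋ 1# ∷ˢ b · (dilate p d ⊛ f))
    where

    twist-dilate-⊛ : ∀ g n → b ^ ⌊ suc n /2⌋ * (dilate p g ⊛ o) n ≈ b * (dilate p (twist b g) ⊛ twist b o) n
    twist-dilate-⊛ g n = begin
      b ^ ⌊ suc n /2⌋ * (dilate p g ⊛ o) n         ≈⟨ twist-⊛ b (dilate p g) o o-odd n ⟨
      b * (twist b (dilate p g) ⊛ twist b o) n
        ≈⟨ *-congˡ (⊛-cong≤ _ _ _ _ n (λ k _ → dilate-twist p b g k) (λ _ _ → refl)) ⟨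
      b * (dilate p (twist b g) ⊛ twist b o) n     ∎

    twist-o : twist b o ≋ f
    twist-o = recursion-unique
      (affine-causal 𝟙 (a * b) (⊛-causal (dilate-causal p) id-causal)) eq f-eq
      where
      𝟙-twist : ∀ n → b ^ ⌊ suc n /2⌋ * 𝟙 n ≈ 𝟙 n
      𝟙-twist zero    = *-identityˡ 1#
      𝟙-twist (suc n) = zeroʳ _
      eq : twist b o ≋ 0# ∷ˢ 𝟙 ⊕ (a * b) · (dilate p (twist b o) ⊛ twist b o)
      eq zero    = trans (*-congˡ (o-eq 0)) (zeroʳ _)
      eq (suc n) = begin
        b ^ ⌊ suc n /2⌋ * o (suc n)                             ≈⟨ *-congˡ (o-eq (suc n)) ⟩
        b ^ ⌊ suc n /2⌋ * (𝟙 n + a * (dilate p o ⊛ o) n)        ≈⟨ distribˡ _ _ _ ⟩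
        b ^ ⌊ suc n /2⌋ * 𝟙 n + b ^ ⌊ suc n /2⌋ * (a * (dilate p o ⊛ o) n)
          ≈⟨ +-cong (𝟙-twist n) (x∙yz≈y∙xz _ _ _) ⟩
        𝟙 n + a * (b ^ ⌊ suc n /2⌋ * (dilate p o ⊛ o) n)        ≈⟨ +-congˡ (*-congˡ (twist-dilate-⊛ o n)) ⟩
        𝟙 n + a * (b * (dilate p (twist b o) ⊛ twist b o) n)    ≈⟨ +-congˡ (*-assoc _ _ _) ⟨
        𝟙 n + a * b * (dilate p (twist b o) ⊛ twist b o) n      ∎
        where open CommutativeSemigroupProperties *-commutativeSemigroup using (x∙yz≈y∙xz)

    twist-e : twist b e ≋ d
    twist-e = recursion-unique Ψ-causal eq d-eq
      where
      Ψ-causal : Causal (λ g → b · (dilate p g ⊛ f))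
      Ψ-causal g h n g≈h = *-congˡ (⊛-causal (dilate-causal p) (const-causal f) g h n g≈h)
      eq : twist b e ≋ 1# ∷ˢ b · (dilate p (twist b e) ⊛ f)
      eq zero    = trans (*-identityˡ _) (e-eq 0)
      eq (suc n) = begin
        b ^ ⌊ suc n /2⌋ * e (suc n)                   ≈⟨ *-congˡ (e-eq (suc n)) ⟩
        b ^ ⌊ suc n /2⌋ * (dilate p e ⊛ o) n          ≈⟨ twist-dilate-⊛ e n ⟩
        b * (dilate p (twist b e) ⊛ twist b o) n
          ≈⟨ *-congˡ (⊛-cong≤ _ _ _ _ n (λ _ _ → refl) (λ k _ → twist-o k)) ⟩
        b * (dilate p (twist b e) ⊛ f) n              ∎

  -- The continued fraction of the q-Catalan numbers and the equation that it solves

  -- The substitution a(z) ↦ z a(z²).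
  odd : Series → Series
  odd a zero          = 0#
  odd a (suc zero)    = a 0
  odd a (suc (suc n)) = odd (a ∘ suc) n

  odd-cong : ∀ {a b} → a ≋ b → odd a ≋ odd b
  odd-cong a≋b zero          = refl
  odd-cong a≋b (suc zero)    = a≋b 0
  odd-cong a≋b (suc (suc n)) = odd-cong (a≋b ∘ suc) n

  odd-⊕ : ∀ a b → odd (a ⊕ b) ≋ odd a ⊕ odd b
  odd-⊕ a b zero          = sym (+-identityˡ 0#)
  odd-⊕ a b (suc zero)    = refl
  odd-⊕ a b (suc (suc n)) = odd-⊕ (a ∘ suc) (b ∘ suc) n

  odd-· : ∀ x a → odd (x · a) ≋ x · odd a
  odd-· x a zero          = sym (zeroʳ x)
  odd-· x a (suc zero)    = refl
  odd-· x a (suc (suc n)) = odd-· x (a ∘ suc) n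

  -- z a(z²) · z b(z²) = z · z(ab)(z²), hence the shift by one.
  odd-⊛ : ∀ a b n → (odd a ⊛ odd b) (suc n) ≈ odd (a ⊛ b) n
  odd-⊛ a b zero = trans (+-cong (zeroˡ _) (zeroʳ _)) (+-identityˡ 0#)
  odd-⊛ a b (suc zero) = trans (+-cong (zeroˡ _) (trans (+-congˡ (zeroˡ _)) (+-identityʳ _))) (+-identityˡ _)
  odd-⊛ a b (suc (suc n)) = begin
    0# * odd b (3 ℕ.+ n) + (a 0 * odd (b ∘ suc) n + (odd (a ∘ suc) ⊛ odd b) (suc n))
      ≈⟨ trans (+-congʳ (zeroˡ _)) (+-identityˡ _) ⟩
    a 0 * odd (b ∘ suc) n + (odd (a ∘ suc) ⊛ odd b) (suc n)
      ≈⟨ +-cong (sym (odd-· (a 0) (b ∘ suc) n)) (odd-⊛ (a ∘ suc) b n) ⟩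
    odd (a 0 · (b ∘ suc)) n + odd ((a ∘ suc) ⊛ b) n
      ≈⟨ odd-⊕ _ _ n ⟨
    odd ((a ⊛ b) ∘ suc) n ∎

  dilate-odd : ∀ p a → dilate p (odd a) ≋ p · odd (dilate (p ^ 2) a)
  dilate-odd p a zero          = trans (zeroʳ _) (sym (zeroʳ _))
  dilate-odd p a (suc zero)    = trans (*-congʳ (*-identityʳ p)) (*-congˡ (sym (*-identityˡ (a 0))))
  dilate-odd p a (suc (suc n)) = begin
    p * (p * p ^ n) * odd (a ∘ suc) n                          ≈⟨ *-congʳ (*-assoc _ _ _) ⟨
    p * p * p ^ n * odd (a ∘ suc) n                            ≈⟨ *-assoc _ _ _ ⟩
    p * p * (p ^ n * odd (a ∘ suc) n)                          ≈⟨ *-cong (*-congˡ (sym (*-identityʳ p))) (dilate-odd p (a ∘ suc) n) ⟩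
    p ^ 2 * (p * odd (dilate (p ^ 2) (a ∘ suc)) n)             ≈⟨ x∙yz≈y∙xz _ _ _ ⟩
    p * (p ^ 2 * odd (dilate (p ^ 2) (a ∘ suc)) n)             ≈⟨ *-congˡ (odd-· (p ^ 2) _ n) ⟨
    p * odd (p ^ 2 · dilate (p ^ 2) (a ∘ suc)) n               ≈⟨ *-congˡ (odd-cong (λ k → *-assoc _ _ _) n) ⟨
    p * odd (dilate (p ^ 2) a ∘ suc) n                         ∎
    where open CommutativeSemigroupProperties *-commutativeSemigroup using (x∙yz≈y∙xz)

  -- The fraction K = 1/(1 - c₁zK′) with tail K′ satisfies K = 1 + c₁ z K′ K.
  continuedFraction-suc : ∀ κ n → continuedFraction κ (suc n) ≈
    κ 1 * (continuedFraction (κ ∘ suc) ⊛ continuedFraction κ) n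
  continuedFraction-suc κ n = begin
    continuedFraction κ (suc n)                                     ≈⟨ continuedFraction-unfold κ (suc n) ⟩
    (1/1- h) (suc n)                                                ≈⟨ 1/1-‿unfold h refl (suc n) ⟩
    0# + (0# * (1/1- h) (suc n) + ((κ 1 · K′) ⊛ (1/1- h)) n)        ≈⟨ +-identityˡ _ ⟩
    0# * (1/1- h) (suc n) + ((κ 1 · K′) ⊛ (1/1- h)) n               ≈⟨ trans (+-congʳ (zeroˡ _)) (+-identityˡ _) ⟩
    ((κ 1 · K′) ⊛ (1/1- h)) n                                       ≈⟨ ⊛-scale (κ 1) K′ (1/1- h) n ⟩
    κ 1 * (K′ ⊛ (1/1- h)) n
      ≈⟨ *-congˡ (⊛-cong≤ K′ K′ _ _ n (λ _ _ → refl) (λ k _ → sym (continuedFraction-unfold κ k))) ⟩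
    κ 1 * (K′ ⊛ continuedFraction κ) n ∎
    where
    K′ h : Series
    K′ = continuedFraction (κ ∘ suc)
    h = κ 1 z· K′

  -- Every coefficient of the fraction is accompanied by exactly one z, so a common factor x can be
  -- moved into z. The inner induction ranges over all pairs of coefficient sequences because the
  -- recursion passes to their tails.
  continuedFraction-scale : ∀ x κ λ′ → (∀ j → κ (suc j) ≈ x * λ′ (suc j)) →
    continuedFraction κ ≋ dilate x (continuedFraction λ′)
  continuedFraction-scale x κ λ′ κ≈xλ n = agree n n ℕ.≤-refl κ λ′ κ≈xλ
    where
    agree : ∀ m k → k ℕ.≤ m → ∀ κ λ′ → (∀ j → κ (suc j) ≈ x * λ′ (suc j)) →
      continuedFraction κ k ≈ x ^ k * continuedFraction λ′ k
    agree m       zero    _         κ λ′ _  = sym (*-identityˡ 1#)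
    agree (suc m) (suc k) (s≤s k≤m) κ λ′ eq = begin
      continuedFraction κ (suc k)
        ≈⟨ continuedFraction-suc κ k ⟩
      κ 1 * (continuedFraction (κ ∘ suc) ⊛ continuedFraction κ) k
        ≈⟨ *-cong (eq 0) (⊛-cong≤ _ _ _ _ k
             (λ j j≤k → agree m j (ℕ.≤-trans j≤k k≤m) (κ ∘ suc) (λ′ ∘ suc) (eq ∘ suc))
             (λ j j≤k → agree m j (ℕ.≤-trans j≤k k≤m) κ λ′ eq)) ⟩
      x * λ′ 1 * (dilate x (continuedFraction (λ′ ∘ suc)) ⊛ dilate x (continuedFraction λ′)) k
        ≈⟨ *-congˡ (dilate-⊛ x _ _ k) ⟩
      x * λ′ 1 * (x ^ k * (continuedFraction (λ′ ∘ suc) ⊛ continuedFraction λ′) k)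
        ≈⟨ interchange _ _ _ _ ⟩
      x ^ suc k * (λ′ 1 * (continuedFraction (λ′ ∘ suc) ⊛ continuedFraction λ′) k)
        ≈⟨ *-congˡ (continuedFraction-suc λ′ k) ⟨
      x ^ suc k * continuedFraction λ′ (suc k) ∎

  open Catalan R using (catalanCoeff; C)

  -- At t = p and q = p² the odd and even coefficients interlace into one geometric sequence: c_j =
  -- p^(j-1).
  catalanCoeff-suc : ∀ p j → catalanCoeff p (p ^ 2) (suc (suc j)) ≈ p * catalanCoeff p (p ^ 2) (suc j)
  catalanCoeff-suc p j = trans (power (suc j)) (*-congˡ (sym (power j)))
    where
    power : ∀ j → catalanCoeff p (p ^ 2) (suc j) ≈ p ^ j
    power zero          = refl
    power (suc zero)    = refl
    power (suc (suc j)) = trans (step j) (trans (*-congˡ (power j)) (regroup _))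
      where
      regroup : ∀ x → p ^ 2 * x ≈ p * (p * x)
      regroup x = trans (*-congʳ (*-congˡ (*-identityʳ p))) (*-assoc p p x)
      step : ∀ j → catalanCoeff p (p ^ 2) (3 ℕ.+ j) ≈ p ^ 2 * catalanCoeff p (p ^ 2) (suc j)
      step zero    = refl
      step (suc j) with parity j
      ... | 1ℙ = refl
      ... | 0ℙ = x∙yz≈y∙xz _ _ _
        where open CommutativeSemigroupProperties *-commutativeSemigroup using (x∙yz≈y∙xz)

  -- The Carlitz-Riordan recurrence: the coefficients being geometric, the tail of the fraction is
  -- the whole fraction with z ↦ pz.
  C-suc : ∀ p n → C (suc n) p ≈ (dilate p (λ m → C m p) ⊛ (λ m → C m p)) n
  C-suc p n = begin
    C (suc n) p                       ≈⟨ continuedFraction-suc κ n ⟩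
    1# * (continuedFraction (κ ∘ suc) ⊛ continuedFraction κ) n
      ≈⟨ *-identityˡ _ ⟩
    (continuedFraction (κ ∘ suc) ⊛ continuedFraction κ) n
      ≈⟨ ⊛-cong≤ _ _ _ _ n (λ k _ → continuedFraction-scale p (κ ∘ suc) κ (catalanCoeff-suc p) k) (λ _ _ → refl) ⟩
    (dilate p (continuedFraction κ) ⊛ continuedFraction κ) n ∎
    where
    κ : ℕ → Carrier
    κ = catalanCoeff p (p ^ 2)

  open RingProperties ring using (-1*x≈-x)

  -- The unique solution of f(z) = z - z f(qz) f(z).
  catalanSolution : Carrier → Series
  catalanSolution q = odd (dilate (- q) (λ m → C m (q ^ 2)))

  -- For φ(z) = κ(-qz), the Carlitz-Riordan recurrence at q² gives φ(z) = 1 - q z φ(q²z) φ(z). In z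
  -- φ(z²) the factor q is absorbed by the substitution, since f(qz) = qz φ(q²z²).
  catalanSolution-eq : ∀ q → let x = catalanSolution q in x ≋ 0# ∷ˢ 𝟙 ⊕ (- 1#) · (dilate q x ⊛ x)
  catalanSolution-eq q zero = refl
  catalanSolution-eq q (suc zero) = trans (*-identityˡ 1#) (sym (trans (+-congˡ vanish) (+-identityʳ 1#)))
    where
    vanish : (- 1#) * (1# * 0# * 0#) ≈ 0#
    vanish = trans (*-congˡ (zeroʳ _)) (zeroʳ _)
  catalanSolution-eq q (suc (suc n)) = begin
    odd (φ ∘ suc) n                                            ≈⟨ odd-cong φ-suc n ⟩
    odd ((- q) · (dilate (q ^ 2) φ ⊛ φ)) n                     ≈⟨ odd-· (- q) _ n ⟩
    - q * odd (dilate (q ^ 2) φ ⊛ φ) n                         ≈⟨ *-congʳ (sym (-1*x≈-x q)) ⟩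
    - 1# * q * odd (dilate (q ^ 2) φ ⊛ φ) n                    ≈⟨ *-assoc _ _ _ ⟩
    - 1# * (q * odd (dilate (q ^ 2) φ ⊛ φ) n)                  ≈⟨ *-congˡ (*-congˡ (odd-⊛ _ φ n)) ⟨
    - 1# * (q * (odd (dilate (q ^ 2) φ) ⊛ odd φ) (suc n))      ≈⟨ *-congˡ (⊛-scale q (odd (dilate (q ^ 2) φ)) (odd φ) (suc n)) ⟨
    - 1# * ((q · odd (dilate (q ^ 2) φ)) ⊛ odd φ) (suc n)
      ≈⟨ *-congˡ (⊛-cong≤ _ _ _ _ (suc n) (λ k _ → dilate-odd q φ k) (λ _ _ → refl)) ⟨
    - 1# * (dilate q (odd φ) ⊛ odd φ) (suc n)                  ≈⟨ +-identityˡ _ ⟨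
    0# + - 1# * (dilate q (odd φ) ⊛ odd φ) (suc n)             ∎
    where
    open CommutativeSemigroupProperties *-commutativeSemigroup using (x∙yz≈y∙xz)
    κ φ : Series
    κ m = C m (q ^ 2)
    φ = dilate (- q) κ
    φ-suc : ∀ m → φ (suc m) ≈ ((- q) · (dilate (q ^ 2) φ ⊛ φ)) m
    φ-suc m = begin
      - q * (- q) ^ m * κ (suc m)                                        ≈⟨ *-assoc _ _ _ ⟩
      - q * ((- q) ^ m * κ (suc m))                                      ≈⟨ *-congˡ (*-congˡ (C-suc (q ^ 2) m)) ⟩
      - q * ((- q) ^ m * (dilate (q ^ 2) κ ⊛ κ) m)                       ≈⟨ *-congˡ (dilate-⊛ (- q) (dilate (q ^ 2) κ) κ m) ⟨
      - q * (dilate (- q) (dilate (q ^ 2) κ) ⊛ φ) m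
        ≈⟨ *-congˡ (⊛-cong≤ _ _ _ _ m (λ _ _ → x∙yz≈y∙xz _ _ _) (λ _ _ → refl)) ⟩
      - q * (dilate (q ^ 2) φ ⊛ φ) m ∎

  catalanSolution-unique : ∀ q {f} → f ≋ 0# ∷ˢ 𝟙 ⊕ (- 1#) · (dilate q f ⊛ f) → f ≋ catalanSolution q
  catalanSolution-unique q f-eq = recursion-unique
    (affine-causal 𝟙 (- 1#) (⊛-causal (dilate-causal q) id-causal)) f-eq (catalanSolution-eq q)

  -- Signed functional equations and elimination of the auxiliary series

  dilate-𝟙⊕ : ∀ p f → dilate p (𝟙 ⊕ f) ≋ 𝟙 ⊕ dilate p f
  dilate-𝟙⊕ p f n = trans (distribˡ _ _ _) (+-congʳ (fixes n))
    where
    fixes : ∀ n → p ^ n * 𝟙 n ≈ 𝟙 n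
    fixes zero    = *-identityˡ 1#
    fixes (suc n) = zeroʳ _

  -- f = z(1 + f) + t z (1 + f(qz)) f; at t = -1 the two linear terms cancel.
  signed-descent-eq : ∀ q {f} → f ≋ 0# ∷ˢ (𝟙 ⊕ f) ⊕ (- 1#) · (dilate q (𝟙 ⊕ f) ⊛ f) →
    f ≋ 0# ∷ˢ 𝟙 ⊕ (- 1#) · (dilate q f ⊛ f)
  signed-descent-eq q {f} eq zero    = eq 0
  signed-descent-eq q {f} eq (suc n) = begin
    f (suc n)                                                  ≈⟨ eq (suc n) ⟩
    𝟙 n + f n + - 1# * (dilate q (𝟙 ⊕ f) ⊛ f) n
      ≈⟨ +-congˡ (*-congˡ (trans (⊛-cong≤ _ _ f f n (λ k _ → dilate-𝟙⊕ q f k) (λ _ _ → refl))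
           (trans (⊛-distribʳ f 𝟙 (dilate q f) n) (+-congʳ (⊛-identityˡ f n))))) ⟩
    𝟙 n + f n + - 1# * (f n + (dilate q f ⊛ f) n)              ≈⟨ +-congˡ (distribˡ _ _ _) ⟩
    𝟙 n + f n + (- 1# * f n + - 1# * (dilate q f ⊛ f) n)       ≈⟨ +-assoc _ _ _ ⟩
    𝟙 n + (f n + (- 1# * f n + - 1# * (dilate q f ⊛ f) n))     ≈⟨ +-congˡ (+-assoc _ _ _) ⟨
    𝟙 n + (f n + - 1# * f n + - 1# * (dilate q f ⊛ f) n)
      ≈⟨ +-congˡ (trans (+-congʳ (trans (+-congˡ (-1*x≈-x (f n))) (-‿inverseʳ _))) (+-identityˡ _)) ⟩
    𝟙 n + - 1# * (dilate q f ⊛ f) n                            ∎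

  -- In the application `h` is the series of (-q)^des q^(2-31) and `g` that of (-1)^des q^(2-13),
  -- both over nonempty words.
  module _ (q : Carrier) {h g : Series}
    (h-eq : h ≋ 0# ∷ˢ (𝟙 ⊕ h) ⊕ (- q) · (dilate q (𝟙 ⊕ h) ⊛ h))
    (g-eq : g ≋ 0# ∷ˢ (𝟙 ⊕ h) ⊛ (𝟙 ⊕ (- 1#) · g))
    where

    open CommutativeSemigroupProperties (CommutativeRing.*-commutativeSemigroup commutativeRing)
      using () renaming (x∙yz≈y∙xz to ⊛-x∙yz≈y∙xz; xy∙z≈xz∙y to ⊛-xy∙z≈xz∙y)

    -- w = 1/(1 + z(1 + h))
    H w : Series
    H = 𝟙 ⊕ h
    w = 𝟙 ⊕ (- 1#) · g

    0∷-⊛ : ∀ a b → (0# ∷ˢ a) ⊛ b ≋ 0# ∷ˢ a ⊛ b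
    0∷-⊛ a b zero    = zeroˡ _
    0∷-⊛ a b (suc n) = trans (+-congʳ (zeroˡ _)) (+-identityˡ _)

    ⊛-0∷ : ∀ a b → a ⊛ (0# ∷ˢ b) ≋ 0# ∷ˢ a ⊛ b
    ⊛-0∷ a b zero    = zeroʳ _
    ⊛-0∷ a b (suc n) = trans (⊛-suc a (0# ∷ˢ b) n) (trans (+-congʳ (zeroʳ _)) (+-identityˡ _))

    ⊛-scaleʳ : ∀ x a b → a ⊛ (x · b) ≋ x · (a ⊛ b)
    ⊛-scaleʳ x a b n = trans (⊛-comm a (x · b) n) (trans (⊛-scale x b a n) (*-congˡ (⊛-comm b a n)))

    ⊛-𝟙⊕ : ∀ a b → a ⊛ (𝟙 ⊕ b) ≋ a ⊕ a ⊛ b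
    ⊛-𝟙⊕ a b n = trans (⊛-comm a (𝟙 ⊕ b) n)
      (trans (⊛-distribʳ a 𝟙 b n) (+-cong (⊛-identityˡ a n) (⊛-comm b a n)))

    g≋H⊛zw : g ≋ H ⊛ (0# ∷ˢ w)
    g≋H⊛zw n = trans (eq n) (sym (⊛-0∷ H w n))
      where
      eq : g ≋ 0# ∷ˢ H ⊛ w
      eq = g-eq

    dilate-0∷ : ∀ p a → dilate p (0# ∷ˢ a) ≋ p · (0# ∷ˢ dilate p a)
    dilate-0∷ p a zero    = trans (zeroʳ _) (sym (zeroʳ _))
    dilate-0∷ p a (suc n) = *-assoc _ _ _

    w-eq : w ≋ 𝟙 ⊕ (- 1#) · (H ⊛ (0# ∷ˢ w))
    w-eq n = +-congˡ (*-congˡ (g≋H⊛zw n))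

    dilate-w-eq : dilate q w ≋ 𝟙 ⊕ (- q) · (dilate q H ⊛ (0# ∷ˢ dilate q w))
    dilate-w-eq n = begin
      dilate q w n                                                 ≈⟨ dilate-𝟙⊕ q ((- 1#) · g) n ⟩
      𝟙 n + q ^ n * (- 1# * g n)                                   ≈⟨ +-congˡ (x∙yz≈y∙xz _ _ _) ⟩
      𝟙 n + - 1# * (q ^ n * g n)                                   ≈⟨ +-congˡ (*-congˡ (*-congˡ (g≋H⊛zw n))) ⟩
      𝟙 n + - 1# * (q ^ n * (H ⊛ (0# ∷ˢ w)) n)                     ≈⟨ +-congˡ (*-congˡ (dilate-⊛ q H (0# ∷ˢ w) n)) ⟨
      𝟙 n + - 1# * (dilate q H ⊛ dilate q (0# ∷ˢ w)) n
        ≈⟨ +-congˡ (*-congˡ (⊛-cong≤ _ _ _ _ n (λ _ _ → refl) (λ k _ → dilate-0∷ q w k))) ⟩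
      𝟙 n + - 1# * (dilate q H ⊛ (q · (0# ∷ˢ dilate q w))) n
        ≈⟨ +-congˡ (*-congˡ (⊛-scaleʳ q (dilate q H) (0# ∷ˢ dilate q w) n)) ⟩
      𝟙 n + - 1# * (q * (dilate q H ⊛ (0# ∷ˢ dilate q w)) n)       ≈⟨ +-congˡ (*-assoc _ _ _) ⟨
      𝟙 n + - 1# * q * (dilate q H ⊛ (0# ∷ˢ dilate q w)) n         ≈⟨ +-congˡ (*-congʳ (-1*x≈-x q)) ⟩
      𝟙 n + - q * (dilate q H ⊛ (0# ∷ˢ dilate q w)) n              ∎
      where open CommutativeSemigroupProperties *-commutativeSemigroup using (x∙yz≈y∙xz)

    -- That is, h = zH/(1 + qzH(qz)): the equation for h is read as linear, with H and H(qz)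
    -- regarded as given. Both sides solve this linear recursion.
    h≋zH⊛w : h ≋ 0# ∷ˢ H ⊛ dilate q w
    h≋zH⊛w = recursion-unique (affine-causal H (- q) (⊛-causal (const-causal (dilate q H)) id-causal)) h-eq λ
      { zero    → refl
      ; (suc n) → begin
          (H ⊛ dilate q w) n
            ≈⟨ ⊛-cong≤ _ _ _ _ n (λ _ _ → refl) (λ k _ → dilate-w-eq k) ⟩
          (H ⊛ (𝟙 ⊕ (- q) · X)) n                                          ≈⟨ ⊛-𝟙⊕ H ((- q) · X) n ⟩
          H n + (H ⊛ ((- q) · X)) n                                        ≈⟨ +-congˡ (⊛-scaleʳ (- q) H X n) ⟩
          H n + - q * (H ⊛ X) n
            ≈⟨ +-congˡ (*-congˡ (⊛-x∙yz≈y∙xz H (dilate q H) (0# ∷ˢ dilate q w) n)) ⟩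
          H n + - q * (dilate q H ⊛ (H ⊛ (0# ∷ˢ dilate q w))) n
            ≈⟨ +-congˡ (*-congˡ (⊛-cong≤ _ _ _ _ n (λ _ _ → refl) (λ k _ → ⊛-0∷ H (dilate q w) k))) ⟩
          H n + - q * (dilate q H ⊛ (0# ∷ˢ H ⊛ dilate q w)) n              ∎
      }
      where
      X : Series
      X = dilate q H ⊛ (0# ∷ˢ dilate q w)

    -- Since g = zHw and h = zH w(qz), the product hw equals g w(qz) = g(1 - g(qz)). Substituted in
    -- g = z(1 + h)w = z(1 - g + hw), this cancels the linear terms and leaves no h.
    ascending-eq : g ≋ 0# ∷ˢ 𝟙 ⊕ (- 1#) · (dilate q g ⊛ g)
    ascending-eq zero    = g-eq 0
    ascending-eq (suc n) = begin
      g (suc n)                                          ≈⟨ g-eq (suc n) ⟩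
      (H ⊛ w) n                                          ≈⟨ ⊛-distribʳ w 𝟙 h n ⟩
      (𝟙 ⊛ w) n + (h ⊛ w) n                              ≈⟨ +-cong (⊛-identityˡ w n) (h⊛w n) ⟩
      𝟙 n + - 1# * g n + (g n + - 1# * (dilate q g ⊛ g) n)
        ≈⟨ trans (+-assoc _ _ _) (+-congˡ (sym (+-assoc _ _ _))) ⟩
      𝟙 n + (- 1# * g n + g n + - 1# * (dilate q g ⊛ g) n)
        ≈⟨ +-congˡ (trans (+-congʳ (trans (+-congʳ (-1*x≈-x (g n))) (-‿inverseˡ _))) (+-identityˡ _)) ⟩
      𝟙 n + - 1# * (dilate q g ⊛ g) n                    ∎
      where
      open CommutativeSemigroupProperties *-commutativeSemigroup using (x∙yz≈y∙xz)
      h⊛w : ∀ n → (h ⊛ w) n ≈ g n + - 1# * (dilate q g ⊛ g) n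
      h⊛w n = begin
        (h ⊛ w) n                                        ≈⟨ ⊛-cong≤ _ _ w w n (λ k _ → h≋zH⊛w k) (λ _ _ → refl) ⟩
        ((0# ∷ˢ H ⊛ dilate q w) ⊛ w) n                   ≈⟨ 0∷-⊛ (H ⊛ dilate q w) w n ⟩
        (0# ∷ˢ H ⊛ dilate q w ⊛ w) n                     ≈⟨ swap n ⟩
        (0# ∷ˢ H ⊛ w ⊛ dilate q w) n                     ≈⟨ 0∷-⊛ (H ⊛ w) (dilate q w) n ⟨
        ((0# ∷ˢ H ⊛ w) ⊛ dilate q w) n
          ≈⟨ ⊛-cong≤ _ _ _ _ n (λ k _ → sym (g-eq k)) (λ k _ → dilate-𝟙⊕ q ((- 1#) · g) k) ⟩
        (g ⊛ (𝟙 ⊕ dilate q ((- 1#) · g))) n              ≈⟨ ⊛-𝟙⊕ g (dilate q ((- 1#) · g)) n ⟩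
        g n + (g ⊛ dilate q ((- 1#) · g)) n
          ≈⟨ +-congˡ (⊛-cong≤ g g _ _ n (λ _ _ → refl) (λ _ _ → x∙yz≈y∙xz _ _ _)) ⟩
        g n + (g ⊛ ((- 1#) · dilate q g)) n              ≈⟨ +-congˡ (⊛-scaleʳ (- 1#) g (dilate q g) n) ⟩
        g n + - 1# * (g ⊛ dilate q g) n                  ≈⟨ +-congˡ (*-congˡ (⊛-comm g (dilate q g) n)) ⟩
        g n + - 1# * (dilate q g ⊛ g) n                  ∎
        where
        swap : (0# ∷ˢ H ⊛ dilate q w ⊛ w) ≋ (0# ∷ˢ H ⊛ w ⊛ dilate q w)
        swap zero    = refl
        swap (suc n) = ⊛-xy∙z≈xz∙y H (dilate q w) w n

    -- Here y counts words that end in their least letter: y = z/(1 + zH) = zw, which ties these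
    -- words to `g` through w = 1 - g. The companion `final-min-dilate-eq` does the same with w(qz).
    final-min-eq : ∀ {y} → y ≋ 0# ∷ˢ 𝟙 ⊕ (- 1#) · (H ⊛ y) → y ≋ 0# ∷ˢ w
    final-min-eq y-eq = recursion-unique (affine-causal 𝟙 (- 1#) (⊛-causal (const-causal H) id-causal)) y-eq
      λ { zero → refl ; (suc n) → w-eq n }

    final-min-dilate-eq : ∀ {y} → y ≋ 0# ∷ˢ 𝟙 ⊕ (- q) · (dilate q H ⊛ y) → y ≋ 0# ∷ˢ dilate q w
    final-min-dilate-eq y-eq = recursion-unique
      (affine-causal 𝟙 (- q) (⊛-causal (const-causal (dilate q H)) id-causal)) y-eq
      λ { zero → refl ; (suc n) → dilate-w-eq n }

-- Statistics on lists of letters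

module Words where

  open import Data.Nat using (_+_; _<_; _≤_; _<ᵇ_; _≤ᵇ_; _≡ᵇ_; _⊔_)
  open import Relation.Binary.PropositionalEquality using (refl; sym; trans; cong; cong₂; subst; subst₂; module ≡-Reasoning)
  open CommutativeMonoidSum ℕ.+-0-commutativeMonoid
    using (sum; sum-cong-≗; ∑-distrib-+; ∑-comm; sum-permute; sum-replicate-zero)

  <⇒<ᵇ≡true : ∀ {m n} → m < n → (m <ᵇ n) ≡ true
  <⇒<ᵇ≡true {zero}  {suc n} _         = refl
  <⇒<ᵇ≡true {suc m} {suc n} (s≤s m<n) = <⇒<ᵇ≡true m<n

  ≥⇒<ᵇ≡false : ∀ {m n} → n ≤ m → (m <ᵇ n) ≡ false
  ≥⇒<ᵇ≡false {m}     {zero}  _         = refl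
  ≥⇒<ᵇ≡false {suc m} {suc n} (s≤s n≤m) = ≥⇒<ᵇ≡false n≤m

  ≤⇒≤ᵇ≡true : ∀ {m n} → m ≤ n → (m ≤ᵇ n) ≡ true
  ≤⇒≤ᵇ≡true {zero}  _   = refl
  ≤⇒≤ᵇ≡true {suc m} m<n = <⇒<ᵇ≡true m<n

  >⇒≤ᵇ≡false : ∀ {m n} → n < m → (m ≤ᵇ n) ≡ false
  >⇒≤ᵇ≡false (s≤s n≤m) = ≥⇒<ᵇ≡false n≤m

  <ᵇ-shift : ∀ k m n → (k + m <ᵇ k + n) ≡ (m <ᵇ n)
  <ᵇ-shift zero    m n = refl
  <ᵇ-shift (suc k) m n = <ᵇ-shift k m n

  ≤ᵇ-shift : ∀ k m n → (k + m ≤ᵇ k + n) ≡ (m ≤ᵇ n)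
  ≤ᵇ-shift zero    m n       = refl
  ≤ᵇ-shift (suc k) m n = trans (suc-≤ᵇ (k + m) (k + n)) (≤ᵇ-shift k m n)
    where
    suc-≤ᵇ : ∀ m n → (suc m ≤ᵇ suc n) ≡ (m ≤ᵇ n)
    suc-≤ᵇ zero    n = refl
    suc-≤ᵇ (suc m) n = refl

  ⟦_⟧ : Bool → ℕ
  ⟦ false ⟧ = 0
  ⟦ true  ⟧ = 1

  nonempty : List ℕ → Bool
  nonempty = not ∘ null

  -- Statistics of words

  adj : (ℕ → ℕ → Bool) → List ℕ → ℕ
  adj p []          = 0
  adj p (x ∷ [])    = 0
  adj p (x ∷ y ∷ w) = ⟦ p x y ⟧ + adj p (y ∷ w)

  count : (ℕ → Bool) → List ℕ → ℕ
  count p []      = 0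
  count p (x ∷ w) = ⟦ p x ⟧ + count p w

  -- In r a b x the letters a and b are adjacent, and x is an earlier letter for
  -- pre and a later one for post.
  pre post : (ℕ → ℕ → ℕ → Bool) → List ℕ → ℕ
  pre r []      = 0
  pre r (x ∷ w) = adj (λ a b → r a b x) w + pre r w
  post r []          = 0
  post r (x ∷ [])    = 0
  post r (x ∷ y ∷ w) = count (r x y) w + post r (y ∷ w)

  descent ascent : ℕ → ℕ → Bool
  descent a b = b <ᵇ a
  ascent  a b = a <ᵇ b

  down up : ℕ → ℕ → ℕ → Bool
  down a b x = (b <ᵇ x) ∧ (x <ᵇ a)
  up   a b x = (a <ᵇ x) ∧ (x <ᵇ b)

  desᴸ 2-31ᴸ 2-13ᴸ 31-2ᴸ : List ℕ → ℕ
  desᴸ  = adj descent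
  2-31ᴸ = pre down
  2-13ᴸ = pre up
  31-2ᴸ = post down

  -- `h` is the largest letter read so far, so `h ≤ᵇ x` tests for a left-to-right maximum. A last
  -- letter counts as followed by an ascent, in accordance with π(n+1) = n+1.
  coderAbove : ℕ → List ℕ → Bool
  coderAbove h []          = true
  coderAbove h (x ∷ [])    = not (h ≤ᵇ x)
  coderAbove h (x ∷ y ∷ w) = not ((x <ᵇ y) ∧ (h ≤ᵇ x)) ∧ coderAbove (h ⊔ x) (y ∷ w)

  -- The bound starts at the first letter itself, which is always a left-to-right maximum.
  coderangementᴸ : List ℕ → Bool
  coderangementᴸ []      = true
  coderangementᴸ (x ∷ w) = coderAbove x (x ∷ w)

  -- Words x₁ > x₂ < x₃ > ⋯ of even length, and x₁ < x₂ > x₃ < ⋯ of odd length.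
  downUp upDown : List ℕ → Bool
  downUp []          = true
  downUp (x ∷ [])    = false
  downUp (x ∷ y ∷ w) = (y <ᵇ x) ∧ upDown (y ∷ w)
  upDown []          = false
  upDown (x ∷ [])    = true
  upDown (x ∷ y ∷ w) = (x <ᵇ y) ∧ downUp (y ∷ w)

  endsInZero : List ℕ → Bool
  endsInZero []          = false
  endsInZero (x ∷ [])    = x ≡ᵇ 0
  endsInZero (x ∷ y ∷ w) = endsInZero (y ∷ w)

  -- Invariance under shifting all letters

  adj-cong-map : ∀ {p p′} f → (∀ x y → p (f x) (f y) ≡ p′ x y) → ∀ w → adj p (map f w) ≡ adj p′ w
  adj-cong-map f eq []          = refl
  adj-cong-map f eq (x ∷ [])    = refl
  adj-cong-map f eq (x ∷ y ∷ w) = cong₂ _+_ (cong ⟦_⟧ (eq x y)) (adj-cong-map f eq (y ∷ w))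

  count-cong-map : ∀ {p p′} f → (∀ x → p (f x) ≡ p′ x) → ∀ w → count p (map f w) ≡ count p′ w
  count-cong-map f eq []      = refl
  count-cong-map f eq (x ∷ w) = cong₂ _+_ (cong ⟦_⟧ (eq x)) (count-cong-map f eq w)

  pre-map : ∀ {r} f → (∀ a b x → r (f a) (f b) (f x) ≡ r a b x) → ∀ w → pre r (map f w) ≡ pre r w
  pre-map f eq []      = refl
  pre-map f eq (x ∷ w) = cong₂ _+_ (adj-cong-map f (λ a b → eq a b x) w) (pre-map f eq w)

  post-map : ∀ {r} f → (∀ a b x → r (f a) (f b) (f x) ≡ r a b x) → ∀ w → post r (map f w) ≡ post r w
  post-map f eq []          = refl
  post-map f eq (x ∷ [])    = refl
  post-map f eq (x ∷ y ∷ w) = cong₂ _+_ (count-cong-map f (eq x y) w) (post-map f eq (y ∷ w))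

  down-shift : ∀ k a b x → down (k + a) (k + b) (k + x) ≡ down a b x
  down-shift k a b x = cong₂ _∧_ (<ᵇ-shift k b x) (<ᵇ-shift k x a)

  desᴸ-shift : ∀ k w → desᴸ (map (k +_) w) ≡ desᴸ w
  desᴸ-shift k = adj-cong-map (k +_) (λ x y → <ᵇ-shift k y x)

  2-31ᴸ-shift : ∀ k w → 2-31ᴸ (map (k +_) w) ≡ 2-31ᴸ w
  2-31ᴸ-shift k = pre-map (k +_) (down-shift k)

  31-2ᴸ-shift : ∀ k w → 31-2ᴸ (map (k +_) w) ≡ 31-2ᴸ w
  31-2ᴸ-shift k = post-map (k +_) (down-shift k)

  coderAbove-shift : ∀ k h w → coderAbove (k + h) (map (k +_) w) ≡ coderAbove h w
  coderAbove-shift k h []          = refl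
  coderAbove-shift k h (x ∷ [])    = cong not (≤ᵇ-shift k h x)
  coderAbove-shift k h (x ∷ y ∷ w) = cong₂ _∧_
    (cong not (cong₂ _∧_ (<ᵇ-shift k x y) (≤ᵇ-shift k h x)))
    (trans (cong (λ m → coderAbove m (map (k +_) (y ∷ w))) (sym (ℕ.+-distribˡ-⊔ k h x)))
           (coderAbove-shift k (h ⊔ x) (y ∷ w)))

  coderangementᴸ-shift : ∀ k w → coderangementᴸ (map (k +_) w) ≡ coderangementᴸ w
  coderangementᴸ-shift k []      = refl
  coderangementᴸ-shift k (x ∷ w) = coderAbove-shift k x (x ∷ w)

  downUp-shift : ∀ k w → downUp (map (k +_) w) ≡ downUp w
  upDown-shift : ∀ k w → upDown (map (k +_) w) ≡ upDown w
  downUp-shift k []          = refl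
  downUp-shift k (x ∷ [])    = refl
  downUp-shift k (x ∷ y ∷ w) = cong₂ _∧_ (<ᵇ-shift k y x) (upDown-shift k (y ∷ w))
  upDown-shift k []          = refl
  upDown-shift k (x ∷ [])    = refl
  upDown-shift k (x ∷ y ∷ w) = cong₂ _∧_ (<ᵇ-shift k x y) (downUp-shift k (y ∷ w))

  -- Statistics of a word X m Y with X > Y and m the maximum

  -- The step into m is an ascent and the step out of m a descent; the latter exists only if Y is
  -- nonempty.
  desᴸ-++ : ∀ m X Y → All (_< m) X → All (_< m) Y →
    desᴸ (X ++ m ∷ Y) ≡ desᴸ X + (desᴸ Y + ⟦ nonempty Y ⟧)
  desᴸ-++ m []          []      _           _ = refl
  desᴸ-++ m []          (y ∷ Y) _           (y<m ∷ _) rewrite <⇒<ᵇ≡true y<m = ℕ.+-comm 1 _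
  desᴸ-++ m (x ∷ [])    Y       (x<m ∷ _)   Y<m rewrite ≥⇒<ᵇ≡false (ℕ.<⇒≤ x<m) = desᴸ-++ m [] Y [] Y<m
  desᴸ-++ m (x ∷ x′ ∷ X) Y      (_ ∷ X<m)   Y<m =
    trans (cong (⟦ x′ <ᵇ x ⟧ +_) (desᴸ-++ m (x′ ∷ X) Y X<m Y<m)) (sym (ℕ.+-assoc ⟦ x′ <ᵇ x ⟧ _ _))

  adj-down-low : ∀ x Y → All (_< x) Y → adj (λ a b → down a b x) Y ≡ 0
  adj-down-low x []           _              = refl
  adj-down-low x (y ∷ [])     _              = refl
  adj-down-low x (y ∷ y′ ∷ Y) (y<x ∷ Y<x)
    rewrite ≥⇒<ᵇ≡false (ℕ.<⇒≤ y<x) | Bool.∧-zeroʳ (y′ <ᵇ x) = adj-down-low x (y′ ∷ Y) Y<x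

  adj-up-low : ∀ x Y → All (_< x) Y → adj (λ a b → up a b x) Y ≡ 0
  adj-up-low x []           _                    = refl
  adj-up-low x (y ∷ [])     _                    = refl
  adj-up-low x (y ∷ y′ ∷ Y) (y<x ∷ Y<x) = cong₂ _+_
    (cong ⟦_⟧ (trans (cong ((y <ᵇ x) ∧_) (≥⇒<ᵇ≡false (ℕ.<⇒≤ (All.head Y<x)))) (Bool.∧-zeroʳ (y <ᵇ x))))
    (adj-up-low x (y′ ∷ Y) Y<x)

  -- Downward crossings of the level x occur inside X and on the step out of m: the step into m goes
  -- up, and Y stays below x.
  adj-down-++ : ∀ x m X Y → x < m → All (_< m) X → All (_< x) Y →
    adj (λ a b → down a b x) (X ++ m ∷ Y) ≡ adj (λ a b → down a b x) X + ⟦ nonempty Y ⟧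
  adj-down-++ x m []           []      x<m _ _ = refl
  adj-down-++ x m []           (y ∷ Y) x<m _ Y<x@(y<x ∷ _)
    rewrite <⇒<ᵇ≡true y<x | <⇒<ᵇ≡true x<m = cong suc (adj-down-low x (y ∷ Y) Y<x)
  adj-down-++ x m (a ∷ [])     Y       x<m _ Y<x
    rewrite ≥⇒<ᵇ≡false (ℕ.<⇒≤ x<m) = adj-down-++ x m [] Y x<m [] Y<x
  adj-down-++ x m (a ∷ b ∷ X)  Y       x<m (_ ∷ X<m) Y<x =
    trans (cong (⟦ down a b x ⟧ +_) (adj-down-++ x m (b ∷ X) Y x<m X<m Y<x)) (sym (ℕ.+-assoc ⟦ down a b x ⟧ _ _))

  adj-up-++ : ∀ x m X Y → x < m → All (_< x) Y →
    adj (λ a b → up a b x) (X ++ m ∷ Y) ≡ adj (λ a b → up a b x) (X ∷ʳ m)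
  adj-up-++ x m []           []      x<m _ = refl
  adj-up-++ x m []           (y ∷ Y) x<m Y<x
    rewrite ≥⇒<ᵇ≡false (ℕ.<⇒≤ x<m) = adj-up-low x (y ∷ Y) Y<x
  adj-up-++ x m (a ∷ [])     Y       x<m Y<x = cong (⟦ up a m x ⟧ +_) (adj-up-++ x m [] Y x<m Y<x)
  adj-up-++ x m (a ∷ b ∷ X)  Y       x<m Y<x = cong (⟦ up a b x ⟧ +_) (adj-up-++ x m (b ∷ X) Y x<m Y<x)

  -- Every letter of X lies between m and the first letter of Y, so the descent out of m gains one
  -- occurrence per letter of X. This is the origin of the factor q^|A|.
  2-31ᴸ-++ : ∀ m X Y → All (_< m) X → All (_< m) Y → All (λ x → All (_< x) Y) X →
    2-31ᴸ (X ++ m ∷ Y) ≡ 2-31ᴸ X + (2-31ᴸ Y + length X ℕ.* ⟦ nonempty Y ⟧)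
  2-31ᴸ-++ m []      Y _           Y<m _           =
    trans (cong (_+ 2-31ᴸ Y) (adj-down-low m Y Y<m)) (sym (ℕ.+-identityʳ _))
  2-31ᴸ-++ m (x ∷ X) Y (x<m ∷ X<m) Y<m (Y<x ∷ Y<X) =
    trans (cong₂ _+_ (adj-down-++ x m X Y x<m X<m Y<x) (2-31ᴸ-++ m X Y X<m Y<m Y<X))
      (solve 5 (λ a b c d e → (a :+ b) :+ (c :+ (d :+ e)) := (a :+ c) :+ (d :+ (b :+ e))) refl
        (adj (λ a b → down a b x) X) ⟦ nonempty Y ⟧ (2-31ᴸ X) (2-31ᴸ Y) (length X ℕ.* ⟦ nonempty Y ⟧))
    where open +-*-Solver using (solve; con; _:=_; _:+_)

  -- After m the word stays below every letter of X and below m, so no letter of X m is crossed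
  -- upwards any more.
  2-13ᴸ-++ : ∀ m X Y → All (_< m) X → All (_< m) Y → All (λ x → All (_< x) Y) X →
    2-13ᴸ (X ++ m ∷ Y) ≡ 2-13ᴸ (X ∷ʳ m) + 2-13ᴸ Y
  2-13ᴸ-++ m []      Y _           Y<m _           = cong (_+ 2-13ᴸ Y) (adj-up-low m Y Y<m)
  2-13ᴸ-++ m (x ∷ X) Y (x<m ∷ X<m) Y<m (Y<x ∷ Y<X) =
    trans (cong₂ _+_ (adj-up-++ x m X Y x<m Y<x) (2-13ᴸ-++ m X Y X<m Y<m Y<X)) (sym (ℕ.+-assoc (adj _ (X ∷ʳ m)) _ _))

  headBelow : ℕ → List ℕ → Bool
  headBelow x []      = false
  headBelow x (y ∷ _) = y <ᵇ x

  -- Followed by a large letter, w crosses the level x upwards once more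
  -- often than downwards if it starts below x, and equally often otherwise.
  adj-up-∷ʳ : ∀ x m w → x < m → All (_≢_ x) w →
    adj (λ a b → up a b x) (w ∷ʳ m) ≡ adj (λ a b → down a b x) w + ⟦ headBelow x w ⟧
  adj-up-∷ʳ x m []          x<m _ = refl
  adj-up-∷ʳ x m (a ∷ [])    x<m _ rewrite <⇒<ᵇ≡true x<m | Bool.∧-identityʳ (a <ᵇ x) = ℕ.+-identityʳ _
  adj-up-∷ʳ x m (a ∷ b ∷ w) x<m (x≢a ∷ x≢w@(x≢b ∷ _)) =
    trans (cong (⟦ up a b x ⟧ +_) (adj-up-∷ʳ x m (b ∷ w) x<m x≢w))
      (trans (x∙yz≈y∙xz ⟦ up a b x ⟧ (adj _ (b ∷ w)) _)
        (trans (cong (adj (λ a b → down a b x) (b ∷ w) +_) crossing)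
          (trans (x∙yz≈y∙xz (adj _ (b ∷ w)) ⟦ down a b x ⟧ _)
                 (sym (ℕ.+-assoc ⟦ down a b x ⟧ (adj _ (b ∷ w)) _)))))
    where
    open CommutativeSemigroupProperties ℕ.+-commutativeSemigroup using (x∙yz≈y∙xz)
    -- Both sides are 1 if at least one of a and b lies below x, and 0 otherwise.
    crossing : ⟦ up a b x ⟧ + ⟦ b <ᵇ x ⟧ ≡ ⟦ down a b x ⟧ + ⟦ a <ᵇ x ⟧
    crossing with ℕ.<-cmp a x | ℕ.<-cmp b x
    ... | tri≈ _ a≡x _ | _            = ⊥-elim (x≢a (sym a≡x))
    ... | _            | tri≈ _ b≡x _ = ⊥-elim (x≢b (sym b≡x))
    ... | tri< a<x _ _ | tri< b<x _ _
      rewrite <⇒<ᵇ≡true a<x | <⇒<ᵇ≡true b<x | ≥⇒<ᵇ≡false (ℕ.<⇒≤ a<x) | ≥⇒<ᵇ≡false (ℕ.<⇒≤ b<x) = refl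
    ... | tri< a<x _ _ | tri> _ _ x<b
      rewrite <⇒<ᵇ≡true a<x | <⇒<ᵇ≡true x<b | ≥⇒<ᵇ≡false (ℕ.<⇒≤ a<x) | ≥⇒<ᵇ≡false (ℕ.<⇒≤ x<b) = refl
    ... | tri> _ _ x<a | tri< b<x _ _
      rewrite <⇒<ᵇ≡true x<a | <⇒<ᵇ≡true b<x | ≥⇒<ᵇ≡false (ℕ.<⇒≤ x<a) = refl
    ... | tri> _ _ x<a | tri> _ _ x<b
      rewrite <⇒<ᵇ≡true x<a | <⇒<ᵇ≡true x<b | ≥⇒<ᵇ≡false (ℕ.<⇒≤ x<a) | ≥⇒<ᵇ≡false (ℕ.<⇒≤ x<b) = refl

  -- The surplus of upward crossings at the level of a letter x is 1 exactly when the letter after x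
  -- is smaller. Summed over x, the downward crossings give 2-31 and the surpluses give the
  -- descents.
  2-13ᴸ-∷ʳ : ∀ m w → All (_< m) w → Unique w → 2-13ᴸ (w ∷ʳ m) ≡ 2-31ᴸ w + desᴸ w
  2-13ᴸ-∷ʳ m []      _           _         = refl
  2-13ᴸ-∷ʳ m (x ∷ w) (x<m ∷ w<m) (x∉w ∷ u) =
    trans (cong₂ _+_ (adj-up-∷ʳ x m w x<m x∉w) (2-13ᴸ-∷ʳ m w w<m u))
      (trans (interchange (adj _ w) _ _ _) (cong (adj (λ a b → down a b x) w + 2-31ᴸ w +_) (des-head x w)))
    where
    open CommutativeSemigroupProperties ℕ.+-commutativeSemigroup using (interchange)
    des-head : ∀ x w → ⟦ headBelow x w ⟧ + desᴸ w ≡ desᴸ (x ∷ w)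
    des-head x []      = refl
    des-head x (y ∷ w) = refl

  count-down-low : ∀ a b Y → All (_< b) Y → count (down a b) Y ≡ 0
  count-down-low a b []      _           = refl
  count-down-low a b (y ∷ Y) (y<b ∷ Y<b) rewrite ≥⇒<ᵇ≡false (ℕ.<⇒≤ y<b) = count-down-low a b Y Y<b

  count-++ : ∀ p X Y → count p (X ++ Y) ≡ count p X + count p Y
  count-++ p []      Y = refl
  count-++ p (x ∷ X) Y = trans (cong (⟦ p x ⟧ +_) (count-++ p X Y)) (sym (ℕ.+-assoc ⟦ p x ⟧ _ _))

  -- Two neighbours in X span an interval that contains neither m nor a letter of Y, and the step
  -- from X into m is an ascent; so X and m Y do not interact.
  31-2ᴸ-++ : ∀ m X Y → All (_< m) X → All (_< m) Y → All (λ x → All (_< x) Y) X →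
    31-2ᴸ (X ++ m ∷ Y) ≡ 31-2ᴸ X + 31-2ᴸ (m ∷ Y)
  31-2ᴸ-++ m []           Y _           Y<m _ = refl
  31-2ᴸ-++ m (x ∷ [])     Y (x<m ∷ _)   Y<m _ = cong (_+ 31-2ᴸ (m ∷ Y)) (count-down-low x m Y Y<m)
  31-2ᴸ-++ m (x ∷ x′ ∷ X) Y (x<m ∷ X<m) Y<m (_ ∷ Y<X@(Y<x′ ∷ _)) =
    trans (cong₂ _+_ inner (31-2ᴸ-++ m (x′ ∷ X) Y X<m Y<m Y<X)) (sym (ℕ.+-assoc (count (down x x′) X) _ _))
    where
    inner : count (down x x′) (X ++ m ∷ Y) ≡ count (down x x′) X
    inner rewrite count-++ (down x x′) X (m ∷ Y) | ≥⇒<ᵇ≡false (ℕ.<⇒≤ x<m) | Bool.∧-zeroʳ (x′ <ᵇ m)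
      | count-down-low x x′ Y Y<x′ = ℕ.+-identityʳ _

  -- The leading letter enters only through comparisons that it wins in either form.
  31-2ᴸ-max : ∀ m m′ Y → All (_< m) Y → All (_< m′) Y → 31-2ᴸ (m ∷ Y) ≡ 31-2ᴸ (m′ ∷ Y)
  31-2ᴸ-max m m′ []      _         _           = refl
  31-2ᴸ-max m m′ (y ∷ Y) (_ ∷ Y<m) (_ ∷ Y<m′) = cong (_+ 31-2ᴸ (y ∷ Y)) (same Y Y<m Y<m′)
    where
    same : ∀ Y → All (_< m) Y → All (_< m′) Y → count (down m y) Y ≡ count (down m′ y) Y
    same []      _           _             = refl
    same (z ∷ Y) (z<m ∷ Y<m) (z<m′ ∷ Y<m′) =
      cong₂ _+_ (cong (λ b → ⟦ (y <ᵇ z) ∧ b ⟧) (trans (<⇒<ᵇ≡true z<m) (sym (<⇒<ᵇ≡true z<m′)))) (same Y Y<m Y<m′)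

  -- The step from M to the first letter of X is a descent across m, one occurrence that `M ∷ X`
  -- alone does not have. If X is empty, M is followed by m itself, and all of Y lies below.
  31-2ᴸ-∷-++ : ∀ M m X Y → m < M → All (_< m) X → All (_< m) Y → All (λ x → All (_< x) Y) X →
    31-2ᴸ (M ∷ X ++ m ∷ Y) ≡ 31-2ᴸ (M ∷ X) + (⟦ nonempty X ⟧ + 31-2ᴸ (m ∷ Y))
  31-2ᴸ-∷-++ M m []      Y m<M _ Y<m _ = cong (_+ 31-2ᴸ (m ∷ Y)) (count-down-low M m Y Y<m)
  31-2ᴸ-∷-++ M m (x ∷ X) Y m<M X<m@(x<m ∷ _) Y<m Y<X@(Y<x ∷ _) =
    trans (cong₂ _+_ inner (31-2ᴸ-++ m (x ∷ X) Y X<m Y<m Y<X))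
      (solve 3 (λ a b c → (a :+ con 1) :+ (b :+ c) := (a :+ b) :+ (con 1 :+ c)) refl
        (count (down M x) X) (31-2ᴸ (x ∷ X)) (31-2ᴸ (m ∷ Y)))
    where
    open +-*-Solver using (solve; con; _:=_; _:+_)
    inner : count (down M x) (X ++ m ∷ Y) ≡ count (down M x) X + 1
    inner rewrite count-++ (down M x) X (m ∷ Y) | <⇒<ᵇ≡true x<m | <⇒<ᵇ≡true m<M | count-down-low M x Y Y<x = refl

  coderAbove-low : ∀ h Y → All (_< h) Y → coderAbove h Y ≡ true
  coderAbove-low h []           _                       = refl
  coderAbove-low h (y ∷ [])     (y<h ∷ _)               rewrite >⇒≤ᵇ≡false y<h = refl
  coderAbove-low (suc h) (y ∷ y′ ∷ Y) (s≤s y≤h ∷ Y<h)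
    rewrite ≥⇒<ᵇ≡false y≤h | Bool.∧-zeroʳ (y <ᵇ y′) | ℕ.m≥n⇒m⊔n≡m (ℕ.m≤n⇒m≤1+n y≤h) = coderAbove-low (suc h) (y′ ∷ Y) Y<h

  -- For the last letter of X, the next letter m plays the part of the conventional value π(n+1).
  -- The letter m is a foremaximum only in last position, and after it no left-to-right maximum
  -- occurs.
  coderAbove-++ : ∀ h m X Y → h ≤ m → All (_< m) X → All (_< m) Y →
    coderAbove h (X ++ m ∷ Y) ≡ coderAbove h X ∧ nonempty Y
  coderAbove-++ h m []           []      h≤m _ _ = cong not (≤⇒≤ᵇ≡true h≤m)
  coderAbove-++ h m []           (y ∷ Y) h≤m _ Y<m@(y<m ∷ _)
    rewrite ≥⇒<ᵇ≡false (ℕ.<⇒≤ y<m) | ℕ.m≤n⇒m⊔n≡n h≤m = coderAbove-low m (y ∷ Y) Y<m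
  coderAbove-++ h m (x ∷ [])     Y       h≤m (x<m ∷ _) Y<m
    rewrite <⇒<ᵇ≡true x<m | coderAbove-++ (h ⊔ x) m [] Y (ℕ.⊔-lub h≤m (ℕ.<⇒≤ x<m)) [] Y<m = refl
  coderAbove-++ h m (x ∷ x′ ∷ X) Y       h≤m (x<m ∷ X<m) Y<m
    rewrite coderAbove-++ (h ⊔ x) m (x′ ∷ X) Y (ℕ.⊔-lub h≤m (ℕ.<⇒≤ x<m)) X<m Y<m =
      sym (Bool.∧-assoc (not ((x <ᵇ x′) ∧ (h ≤ᵇ x))) _ _)

  coderangementᴸ-++ : ∀ m X Y → All (_< m) X → All (_< m) Y →
    coderangementᴸ (X ++ m ∷ Y) ≡ coderangementᴸ X ∧ nonempty Y
  coderangementᴸ-++ m []      Y X<m           Y<m = coderAbove-++ m m [] Y ℕ.≤-refl X<m Y<m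
  coderangementᴸ-++ m (x ∷ X) Y X<m@(x<m ∷ _) Y<m = coderAbove-++ x m (x ∷ X) Y (ℕ.<⇒≤ x<m) X<m Y<m

  -- The maximum can only stand at a peak. In a down-up word the peaks are at odd positions, which
  -- makes X even; in an up-down word they are at even positions, unless the word is the single
  -- letter m. In both cases Y is an up-down word of odd length.
  downUp-++ : ∀ m X Y → All (_< m) X → All (_< m) Y → downUp (X ++ m ∷ Y) ≡ downUp X ∧ upDown Y
  upDown-++ : ∀ m x X Y → All (_< m) (x ∷ X) → All (_< m) Y →
    upDown (x ∷ X ++ m ∷ Y) ≡ upDown (x ∷ X) ∧ upDown Y
  downUp-++ m []           []      _ _ = refl
  downUp-++ m []           (y ∷ Y) _ (y<m ∷ _) rewrite <⇒<ᵇ≡true y<m = refl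
  downUp-++ m (x ∷ [])     Y       (x<m ∷ _) Y<m rewrite ≥⇒<ᵇ≡false (ℕ.<⇒≤ x<m) = refl
  downUp-++ m (x ∷ x′ ∷ X) Y       (_ ∷ X<m) Y<m =
    trans (cong ((x′ <ᵇ x) ∧_) (upDown-++ m x′ X Y X<m Y<m)) (sym (Bool.∧-assoc (x′ <ᵇ x) _ _))
  upDown-++ m x []       Y (x<m ∷ _) Y<m rewrite <⇒<ᵇ≡true x<m = downUp-++ m [] Y [] Y<m
  upDown-++ m x (x′ ∷ X) Y (_ ∷ X<m) Y<m =
    trans (cong ((x <ᵇ x′) ∧_) (downUp-++ m (x′ ∷ X) Y X<m Y<m)) (sym (Bool.∧-assoc (x <ᵇ x′) _ _))

  upDown-max∷ : ∀ m Y → All (_< m) Y → upDown (m ∷ Y) ≡ null Y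
  upDown-max∷ m []      _         = refl
  upDown-max∷ m (y ∷ Y) (y<m ∷ _) rewrite ≥⇒<ᵇ≡false (ℕ.<⇒≤ y<m) = refl

  endsInZero-++ : ∀ m y X Y → endsInZero (X ++ m ∷ y ∷ Y) ≡ endsInZero (y ∷ Y)
  endsInZero-++ m y []           Y = refl
  endsInZero-++ m y (x ∷ [])     Y = refl
  endsInZero-++ m y (x ∷ x′ ∷ X) Y = endsInZero-++ m y (x′ ∷ X) Y

  endsInZero-∷ʳ : ∀ m X → endsInZero (X ∷ʳ m) ≡ (m ≡ᵇ 0)
  endsInZero-∷ʳ m []           = refl
  endsInZero-∷ʳ m (x ∷ [])     = refl
  endsInZero-∷ʳ m (x ∷ x′ ∷ X) = endsInZero-∷ʳ m (x′ ∷ X)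

  parity-suc : ∀ n → parity (suc n) ≡ parity n ℙ.⁻¹
  parity-suc zero          = refl
  parity-suc (suc zero)    = refl
  parity-suc (suc (suc n)) = parity-suc n

  downUp⇒even : ∀ w → downUp w ≡ true → parity (length w) ≡ 0ℙ
  upDown⇒odd : ∀ w → upDown w ≡ true → parity (length w) ≡ 1ℙ
  downUp⇒even []          _  = refl
  downUp⇒even (x ∷ y ∷ w) eq =
    trans (parity-suc (suc (length w))) (cong ℙ._⁻¹ (upDown⇒odd (y ∷ w) (Bool.∧-conicalʳ (y <ᵇ x) _ eq)))
  upDown⇒odd (x ∷ [])    _  = refl
  upDown⇒odd (x ∷ y ∷ w) eq =
    trans (parity-suc (suc (length w))) (cong ℙ._⁻¹ (downUp⇒even (y ∷ w) (Bool.∧-conicalʳ (x <ᵇ y) _ eq)))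

  -- Decomposition of 132-avoiding permutations at the maximum

  AllPairs-++⁻ : ∀ {A : Set} {R : A → A → Set} xs {ys} → AllPairs R (xs ++ ys) →
    AllPairs R xs × AllPairs R ys × All (λ x → All (R x) ys) xs
  AllPairs-++⁻ []       ps       = [] , ps , []
  AllPairs-++⁻ (x ∷ xs) (p ∷ ps) =
    let xs-R , ys-R , xs-ys = AllPairs-++⁻ xs ps in
    All.++⁻ˡ xs p ∷ xs-R , ys-R , All.++⁻ʳ xs p ∷ xs-ys

  Unique∧⊆⇒length≤ : ∀ {A : Set} {xs ys : List A} → Unique xs → xs ⊆ ys → length xs ≤ length ys
  Unique∧⊆⇒length≤ {xs = []}     _         _     = z≤n
  Unique∧⊆⇒length≤ {xs = x ∷ xs} (x∉xs ∷ u) xs⊆ys with ∈.∈-∃++ (xs⊆ys (here refl))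
  ... | as , bs , refl = ℕ.≤-trans (s≤s (Unique∧⊆⇒length≤ u xs⊆as++bs)) (ℕ.≤-reflexive (sym (List.length-++-sucʳ as x bs)))
    where
    xs⊆as++bs : xs ⊆ as ++ bs
    xs⊆as++bs y∈xs with ∈.∈-++⁻ as (xs⊆ys (there y∈xs))
    ... | inj₁ y∈as            = ∈.∈-++⁺ˡ y∈as
    ... | inj₂ (here y≡x)      = contradiction (sym y≡x) (All.lookup x∉xs y∈xs)
    ... | inj₂ (there y∈bs)    = ∈.∈-++⁺ʳ as y∈bs

  -- Pigeonhole: with a missing value v, the list `v ∷ w` would be free of repetitions, of length n
  -- + 1, and contained in 0, ..., n - 1.
  Unique⇒covers : ∀ {n w} → length w ≡ n → All (_< n) w → Unique w → ∀ {v} → v < n → v ∈ w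
  Unique⇒covers {n} {w} len w<n u {v} v<n with v ∈? w
  ... | yes v∈w = v∈w
  ... | no  v∉w = contradiction (ℕ.≤-trans (Unique∧⊆⇒length≤ (All.¬Any⇒All¬ w v∉w ∷ u) v∷w⊆) (ℕ.≤-reflexive (trans (List.length-upTo n) (sym len)))) ℕ.1+n≰n
    where
    v∷w⊆ : v ∷ w ⊆ upTo n
    v∷w⊆ (here refl)  = ∈.∈-upTo⁺ v<n
    v∷w⊆ (there x∈w)  = ∈.∈-upTo⁺ (All.lookup w<n x∈w)

  -- The letter peeled off plays the 1; in the pair condition `y` precedes `z`, so they play the 3
  -- and the 2.
  data Avoids132 : List ℕ → Set where
    []  : Avoids132 []
    _∷_ : ∀ {x w} → AllPairs (λ y z → ¬ (x < z × z < y)) w → Avoids132 w → Avoids132 (x ∷ w)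

  record Perm132 (n : ℕ) (w : List ℕ) : Set where
    constructor perm132
    field
      length≡ : length w ≡ n
      bounded : All (_< n) w
      unique  : Unique w
      avoids  : Avoids132 w

  open Perm132 public

  -- For permutations of 0, ..., i-1 and of 0, ..., j-1, shifting the first by j places it above the
  -- second, and i + j is the new maximum.
  glue : List ℕ → List ℕ → List ℕ
  glue α β = map (length β +_) α ++ (length α + length β) ∷ β

  record Skew (m : ℕ) (X Y : List ℕ) : Set where
    constructor skew
    field
      X<m : All (_< m) X
      Y<m : All (_< m) Y
      Y<X : All (λ x → All (_< x) Y) X

  -- If the 1 of an occurrence lay in X, its 2 could not be in Y, whose letters are smaller, nor be
  -- m, which no letter exceeds; the occurrence would stay inside X. The letter m cannot play the 1.
  Avoids132-++⁺ : ∀ {m X Y} → Skew m X Y → Avoids132 X → Avoids132 Y → Avoids132 (X ++ m ∷ Y)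
  Avoids132-++⁺ {m} {[]} {Y} (skew _ Y<m _) _ av = pairs Y Y<m ∷ av
    where
    pairs : ∀ Y → All (_< m) Y → AllPairs (λ y z → ¬ (m < z × z < y)) Y
    pairs []      _           = []
    pairs (y ∷ Y) (y<m ∷ Y<m) = All.map (λ z<m (m<z , _) → ℕ.<-asym z<m m<z) Y<m ∷ pairs Y Y<m
  Avoids132-++⁺ {m} {x ∷ X} {Y} (skew (x<m ∷ X<m) Y<m (Y<x ∷ Y<X)) (p ∷ avX) avY =
    AllPairs.++⁺ p (low Y<x ∷ pairs Y Y<x)
      (All.map (λ y<m → (λ (_ , m<y) → ℕ.<-asym y<m m<y) ∷ low Y<x) X<m)
    ∷ Avoids132-++⁺ (skew X<m Y<m Y<X) avX avY
    where
    low : ∀ {y Y} → All (_< x) Y → All (λ z → ¬ (x < z × z < y)) Y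
    low = All.map (λ z<x (x<z , _) → ℕ.<-asym z<x x<z)
    pairs : ∀ Y → All (_< x) Y → AllPairs (λ y z → ¬ (x < z × z < y)) Y
    pairs []      _           = []
    pairs (y ∷ Y) (_ ∷ Y<x) = low Y<x ∷ pairs Y Y<x

  Avoids132-++⁻ : ∀ X {Y} → Avoids132 (X ++ Y) →
    Avoids132 X × Avoids132 Y × All (λ x → AllPairs (λ y z → ¬ (x < z × z < y)) Y) X
  Avoids132-++⁻ []      av       = [] , av , []
  Avoids132-++⁻ (x ∷ X) (p ∷ av) =
    let avX , avY , cross = Avoids132-++⁻ X av
        pX , pY , _       = AllPairs-++⁻ X p
    in  pX ∷ avX , avY , pY ∷ cross

  Avoids132-shift⁺ : ∀ k {w} → Avoids132 w → Avoids132 (map (k +_) w)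
  Avoids132-shift⁺ k []       = []
  Avoids132-shift⁺ k (p ∷ av) =
    AllPairs.map⁺ (AllPairs.map (λ ¬yz (x<z , z<y) → ¬yz (ℕ.+-cancelˡ-< k _ _ x<z , ℕ.+-cancelˡ-< k _ _ z<y)) p)
    ∷ Avoids132-shift⁺ k av

  Avoids132-shift⁻ : ∀ k w → Avoids132 (map (k +_) w) → Avoids132 w
  Avoids132-shift⁻ k []      _        = []
  Avoids132-shift⁻ k (x ∷ w) (p ∷ av) =
    AllPairs.map (λ ¬yz (x<z , z<y) → ¬yz (ℕ.+-monoʳ-< k x<z , ℕ.+-monoʳ-< k z<y)) (AllPairs.map⁻ p)
    ∷ Avoids132-shift⁻ k w av

  glue-skew : ∀ {i j α β} → Perm132 i α → Perm132 j β → Skew (length α + length β) (map (length β +_) α) β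
  glue-skew {α = α} {β} (perm132 refl α<i _ _) (perm132 refl β<j _ _) = skew
    (All.map⁺ (All.map (λ {a} a<i → subst (_< length α + length β) (ℕ.+-comm a _) (ℕ.+-monoˡ-< (length β) a<i)) α<i))
    (All.map (λ b<j → ℕ.<-≤-trans b<j (ℕ.m≤n+m (length β) (length α))) β<j)
    (All.map⁺ (All.map (λ _ → All.map (λ b<j → ℕ.<-≤-trans b<j (ℕ.m≤m+n _ _)) β<j) α<i))

  glue-perm132 : ∀ {i j α β} → Perm132 i α → Perm132 j β → Perm132 (suc (i + j)) (glue α β)
  glue-perm132 {α = α} {β} pα@(perm132 refl α<i uα avα) pβ@(perm132 refl β<j uβ avβ) = perm132
    (trans (List.length-++-sucʳ X m β) (cong suc (trans (List.length-++ X) (cong (_+ length β) (List.length-map _ α)))))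
    (All.++⁺ (All.map ℕ.m<n⇒m<1+n X<m) (ℕ.n<1+n m ∷ All.map ℕ.m<n⇒m<1+n Y<m))
    (AllPairs.++⁺ (Unique.map⁺ (ℕ.+-cancelˡ-≡ (length β) _ _) uα)
      (All.map (λ b<m → ℕ.<⇒≢ b<m ∘ sym) Y<m ∷ uβ)
      (All.zipWith (λ (x<m , Y<x) → ℕ.<⇒≢ x<m ∷ All.map (λ y<x → ℕ.<⇒≢ y<x ∘ sym) Y<x) (X<m , Y<X)))
    (Avoids132-++⁺ sk (Avoids132-shift⁺ (length β) avα) avβ)
    where
    sk = glue-skew pα pβ
    open Skew sk
    m = length α + length β
    X = map (length β +_) α

  record Glued (n : ℕ) (w : List ℕ) : Set where
    constructor glued
    field
      {i j}  : ℕ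
      {α β}  : List ℕ
      i+j≡n  : i + j ≡ n
      permα  : Perm132 i α
      permβ  : Perm132 j β
      w≡glue : w ≡ glue α β

  -- Splitting at the maximum n, avoidance of 132 forces every letter on its
  -- left to exceed every letter on its right.
  perm132⇒glued : ∀ {n w} → Perm132 (suc n) w → Glued n w
  perm132⇒glued {n} {w} (perm132 len w<1+n u av)
    with ∈.∈-∃++ (Unique⇒covers len w<1+n u (ℕ.n<1+n n))
  ... | A , B , refl = glued i+j≡n (perm132 refl α<i (Unique.map⁻ (subst Unique A≡ uA)) (Avoids132-shift⁻ j α (subst Avoids132 A≡ avA)))
      (perm132 refl (All.tabulate b<j) uB avB)
      (cong₂ (λ X m → X ++ m ∷ B) A≡ (sym i+j≡n))
    where
    split  = AllPairs-++⁻ A u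
    uA     = proj₁ split
    n∉B    = AllPairs.head (proj₁ (proj₂ split))
    uB     = AllPairs.tail (proj₁ (proj₂ split))
    A≢nB   = proj₂ (proj₂ split)
    avsplit = Avoids132-++⁻ A av
    avA    = proj₁ avsplit
    avB : Avoids132 B
    avB with proj₁ (proj₂ avsplit)
    ... | _ ∷ avB = avB
    j = length B
    A<n : All (_< n) A
    A<n = All.zipWith (λ (a<1+n , a≢) → ℕ.≤∧≢⇒< (ℕ.≤-pred a<1+n) (All.head a≢)) (All.++⁻ˡ A w<1+n , A≢nB)
    B<n : All (_< n) B
    B<n = All.zipWith (λ (b<1+n , n≢b) → ℕ.≤∧≢⇒< (ℕ.≤-pred b<1+n) (n≢b ∘ sym)) (All.tail (All.++⁻ʳ A w<1+n) , n∉B)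
    -- Otherwise a, n, b would be an occurrence of 132.
    B<A : ∀ {a b} → a ∈ A → b ∈ B → b < a
    B<A a∈A b∈B = ℕ.≤∧≢⇒<
      (ℕ.≮⇒≥ λ a<b → All.lookup (AllPairs.head (All.lookup (proj₂ (proj₂ avsplit)) a∈A)) b∈B (a<b , All.lookup B<n b∈B))
      (All.lookup (All.tail (All.lookup A≢nB a∈A)) b∈B ∘ sym)
    -- B consists of distinct values below a, so there are at most a of them.
    j≤A : All (j ≤_) A
    j≤A = All.tabulate λ {a} a∈A → ℕ.≤-trans
      (Unique∧⊆⇒length≤ uB (λ b∈B → ∈.∈-upTo⁺ (B<A a∈A b∈B))) (ℕ.≤-reflexive (List.length-upTo a))
    -- Every value v ≤ b occurs in the word, but not in A, which lies above b, and it is not n;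
    -- hence B contains the b + 1 values 0, ..., b.
    b<j : ∀ {b} → b ∈ B → b < j
    b<j {b} b∈B = ℕ.≤-trans (ℕ.≤-reflexive (sym (List.length-upTo (suc b))))
      (Unique∧⊆⇒length≤ (Unique.upTo⁺ (suc b)) (inB ∘ ∈.∈-upTo⁻))
      where
      inB : ∀ {v} → v < suc b → v ∈ B
      inB v≤b with ∈.∈-++⁻ A (Unique⇒covers len w<1+n u (ℕ.<-trans (ℕ.≤-<-trans (ℕ.≤-pred v≤b) (All.lookup B<n b∈B)) (ℕ.n<1+n n)))
      ... | inj₁ v∈A         = contradiction (ℕ.≤-trans (B<A v∈A b∈B) (ℕ.≤-pred v≤b)) ℕ.1+n≰n
      ... | inj₂ (here refl) = contradiction (ℕ.≤-trans (All.lookup B<n b∈B) (ℕ.≤-pred v≤b)) ℕ.1+n≰n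
      ... | inj₂ (there v∈B) = v∈B
    α = map (_∸ j) A
    A≡ : A ≡ map (j +_) α
    A≡ = sym (trans (sym (List.map-∘ A)) (List.map-id-local (All.map ℕ.m+[n∸m]≡n j≤A)))
    i+j≡n : length α + j ≡ n
    i+j≡n = ℕ.suc-injective (trans (sym (trans (List.length-++-sucʳ A n B) (cong suc (trans (List.length-++ A) (cong (_+ j) (sym (List.length-map _ A))))))) len)
    α<i : All (_< length α) α
    α<i = All.map⁺ (All.zipWith (λ (j≤a , a<n) → ℕ.+-cancelʳ-< j _ _
      (subst (_< length α + j) (sym (ℕ.m∸n+n≡m j≤a)) (subst (_ <_) (sym i+j≡n) a<n))) (j≤A , A<n))

  ++∷-injective : ∀ {m : ℕ} X X′ {Y Y′} → m ∉ X → m ∉ X′ → X ++ m ∷ Y ≡ X′ ++ m ∷ Y′ → X ≡ X′ × Y ≡ Y′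
  ++∷-injective []      []        _   _    refl = refl , refl
  ++∷-injective []      (x ∷ X′)  _   m∉X′ refl = contradiction (here refl) m∉X′
  ++∷-injective (x ∷ X) []        m∉X _    refl = contradiction (here refl) m∉X
  ++∷-injective (x ∷ X) (x′ ∷ X′) m∉X m∉X′ eq with List.∷-injective eq
  ... | refl , eq′ with ++∷-injective X X′ (m∉X ∘ there) (m∉X′ ∘ there) eq′
  ... | refl , refl = refl , refl

  -- Both words have maximum n, which occurs in neither shifted left block; so the place of the cut
  -- is determined, then β, then the amount of the shift.
  glue-injective : ∀ {n i j i′ j′ α β α′ β′} → i + j ≡ n → i′ + j′ ≡ n → Perm132 i α → Perm132 j β → Perm132 i′ α′ → Perm132 j′ β′ →
    glue α β ≡ glue α′ β′ → α ≡ α′ × β ≡ β′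
  glue-injective {α = α} {β} {α′} {β′} refl s pα@(perm132 refl _ _ _) pβ@(perm132 refl _ _ _) pα′@(perm132 refl _ _ _) pβ′@(perm132 refl _ _ _) eq
    with ++∷-injective (map (length β +_) α) (map (length β′ +_) α′)
           (λ m∈ → ℕ.<-irrefl refl (All.lookup (Skew.X<m (glue-skew pα pβ)) m∈))
           (λ m∈ → ℕ.<-irrefl (sym s) (All.lookup (Skew.X<m (glue-skew pα′ pβ′)) m∈))
           (trans eq (cong (λ m → map (length β′ +_) α′ ++ m ∷ β′) s))
  ... | X≡X′ , refl = List.map-injective (ℕ.+-cancelˡ-≡ (length β) _ _) X≡X′ , refl

  -- Statistics of glued words

  bounded-by-length : ∀ {n w} → Perm132 n w → All (_< length w) w
  bounded-by-length (perm132 refl w<n _ _) = w<n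

  nonempty-map : ∀ (f : ℕ → ℕ) w → nonempty (map f w) ≡ nonempty w
  nonempty-map f []      = refl
  nonempty-map f (_ ∷ _) = refl

  nonempty-glue : ∀ α β → nonempty (glue α β) ≡ true
  nonempty-glue []      β = refl
  nonempty-glue (_ ∷ _) β = refl

  -- On a permutation of 0, …, n - 1 the new first letter exceeds all others.
  31-2⁺ : List ℕ → ℕ
  31-2⁺ w = 31-2ᴸ (length w ∷ w)

  module _ {i j α β} (pα : Perm132 i α) (pβ : Perm132 j β) where

    private
      k m : ℕ
      k = length β
      m = length α + length β
      X : List ℕ
      X = map (k +_) α
      open Skew (glue-skew pα pβ)

    desᴸ-glue : desᴸ (glue α β) ≡ desᴸ α + (desᴸ β + ⟦ nonempty β ⟧)
    desᴸ-glue = trans (desᴸ-++ m X β X<m Y<m) (cong (_+ (desᴸ β + ⟦ nonempty β ⟧)) (desᴸ-shift k α))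

    2-31ᴸ-glue : 2-31ᴸ (glue α β) ≡ 2-31ᴸ α + (2-31ᴸ β + length α ℕ.* ⟦ nonempty β ⟧)
    2-31ᴸ-glue = trans (2-31ᴸ-++ m X β X<m Y<m Y<X)
      (cong₂ (λ s l → s + (2-31ᴸ β + l ℕ.* ⟦ nonempty β ⟧)) (2-31ᴸ-shift k α) (List.length-map _ α))

    2-13ᴸ-glue : 2-13ᴸ (glue α β) ≡ 2-31ᴸ α + desᴸ α + 2-13ᴸ β
    2-13ᴸ-glue = trans (2-13ᴸ-++ m X β X<m Y<m Y<X) (cong (_+ 2-13ᴸ β)
      (trans (2-13ᴸ-∷ʳ m X X<m (Unique.map⁺ (ℕ.+-cancelˡ-≡ k _ _) (unique pα)))
             (cong₂ _+_ (2-31ᴸ-shift k α) (desᴸ-shift k α))))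

    31-2ᴸ-glue : 31-2ᴸ (glue α β) ≡ 31-2ᴸ α + 31-2⁺ β
    31-2ᴸ-glue = trans (31-2ᴸ-++ m X β X<m Y<m Y<X)
      (cong₂ _+_ (31-2ᴸ-shift k α) (31-2ᴸ-max m k β Y<m (bounded-by-length pβ)))

    31-2⁺-glue : 31-2⁺ (glue α β) ≡ 31-2⁺ α + (⟦ nonempty α ⟧ + 31-2⁺ β)
    31-2⁺-glue = trans
      (31-2ᴸ-∷-++ (length (glue α β)) m X β m<M X<m Y<m Y<X)
      (cong₂ _+_ prefix (cong₂ _+_ (cong ⟦_⟧ (nonempty-map _ α)) (31-2ᴸ-max m k β Y<m (bounded-by-length pβ))))
      where
      m<M : m < length (glue α β)
      m<M = ℕ.≤-reflexive (sym (trans (length≡ (glue-perm132 pα pβ)) (cong suc (cong₂ _+_ (sym (length≡ pα)) (sym (length≡ pβ))))))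
      -- Renaming the leading letter to `k + length α` turns the list into the shift by k of
      -- `length α ∷ α`.
      prefix : 31-2ᴸ (length (glue α β) ∷ X) ≡ 31-2⁺ α
      prefix = trans
        (31-2ᴸ-max _ (k + length α) X (All.map (λ x<m → ℕ.<-trans x<m m<M) X<m)
          (subst (λ l → All (_< l) X) (ℕ.+-comm (length α) k) X<m))
        (31-2ᴸ-shift k (length α ∷ α))

    coderangementᴸ-glue : coderangementᴸ (glue α β) ≡ coderangementᴸ α ∧ nonempty β
    coderangementᴸ-glue = trans (coderangementᴸ-++ m X β X<m Y<m) (cong (_∧ nonempty β) (coderangementᴸ-shift k α))

    downUp-glue : downUp (glue α β) ≡ downUp α ∧ upDown β
    downUp-glue = trans (downUp-++ m X β X<m Y<m) (cong (_∧ upDown β) (downUp-shift k α))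

  upDown-glue : ∀ {i j x α β} → Perm132 i (x ∷ α) → Perm132 j β → upDown (glue (x ∷ α) β) ≡ upDown (x ∷ α) ∧ upDown β
  upDown-glue {x = x} {α} {β} pα pβ = trans
    (upDown-++ _ (length β + x) (map (length β +_) α) β X<m Y<m) (cong (_∧ upDown β) (upDown-shift (length β) (x ∷ α)))
    where open Skew (glue-skew pα pβ)

  upDown-glue-[] : ∀ {j β} → Perm132 j β → upDown (glue [] β) ≡ null β
  upDown-glue-[] {β = β} pβ = upDown-max∷ (length β) β (Skew.Y<m (glue-skew (perm132 refl [] [] []) pβ))

  endsInZero-glue-[] : ∀ α → endsInZero (glue α []) ≡ null α
  endsInZero-glue-[] α = trans (endsInZero-∷ʳ (length α + 0) (map (0 +_) α)) (zero-length α)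
    where
    zero-length : ∀ α → (length α + 0 ℕ.≡ᵇ 0) ≡ null α
    zero-length []      = refl
    zero-length (_ ∷ _) = refl

  endsInZero-glue-∷ : ∀ α y β → endsInZero (glue α (y ∷ β)) ≡ endsInZero (y ∷ β)
  endsInZero-glue-∷ α y β = endsInZero-++ _ y (map (length (y ∷ β) +_) α) β

  -- Enumerations without repetition and their convolution

  -- Reduces every reindexing of a sum to a question of membership, independent of the order of
  -- enumeration.
  Unique∧⇔⇒↭ : ∀ {A : Set} {xs ys : List A} → Unique xs → Unique ys →
    (∀ {x} → x ∈ xs → x ∈ ys) → (∀ {x} → x ∈ ys → x ∈ xs) → xs ↭ ys
  Unique∧⇔⇒↭ u v to from = ∼bag⇒↭ (unique∧set⇒bag u v (mk⇔ to from))

  Unique-map⁺-local : ∀ {A B : Set} {f : A → B} {xs} → (∀ {x y} → x ∈ xs → y ∈ xs → f x ≡ f y → x ≡ y) →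
    Unique xs → Unique (map f xs)
  Unique-map⁺-local inj []       = []
  Unique-map⁺-local inj (x∉ ∷ u) =
    All.map⁺ (All.tabulate λ y∈xs fx≡fy → All.lookup x∉ y∈xs (inj (here ≡.refl) (there y∈xs) fx≡fy))
    ∷ Unique-map⁺-local (λ p r → inj (there p) (there r)) u

  -- The pairs are listed in the order of the terms of the Cauchy product.
  convolution : ∀ {A B : Set} → (ℕ → List A) → (ℕ → List B) → ℕ → List (A × B)
  convolution f g zero    = cartesianProduct (f 0) (g 0)
  convolution f g (suc n) = cartesianProduct (f 0) (g (suc n)) ++ convolution (f ∘ suc) g n

  module _ {A B : Set} where

    ∈-convolution⁺ : ∀ (f : ℕ → List A) (g : ℕ → List B) {x y} i j → x ∈ f i → y ∈ g j →
      (x , y) ∈ convolution f g (i ℕ.+ j)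
    ∈-convolution⁺ f g zero    zero    x∈ y∈ = ∈.∈-cartesianProduct⁺ x∈ y∈
    ∈-convolution⁺ f g zero    (suc j) x∈ y∈ = ∈.∈-++⁺ˡ (∈.∈-cartesianProduct⁺ x∈ y∈)
    ∈-convolution⁺ f g (suc i) j       x∈ y∈ = ∈.∈-++⁺ʳ _ (∈-convolution⁺ (f ∘ suc) g i j x∈ y∈)

    ∈-convolution⁻ : ∀ (f : ℕ → List A) (g : ℕ → List B) n {x y} → (x , y) ∈ convolution f g n →
      ∃₂ λ i j → i ℕ.+ j ≡ n × x ∈ f i × y ∈ g j
    ∈-convolution⁻ f g zero    p = 0 , 0 , ≡.refl , ∈.∈-cartesianProduct⁻ (f 0) (g 0) p
    ∈-convolution⁻ f g (suc n) p with ∈.∈-++⁻ (cartesianProduct (f 0) (g (suc n))) p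
    ... | inj₁ p′ = 0 , suc n , ≡.refl , ∈.∈-cartesianProduct⁻ (f 0) (g (suc n)) p′
    ... | inj₂ p′ =
      let i , j , i+j≡n , x∈ , y∈ = ∈-convolution⁻ (f ∘ suc) g n p′
      in  suc i , j , ≡.cong suc i+j≡n , x∈ , y∈

    -- The first component determines its index i, so the blocks for different i are disjoint.
    convolution-unique : ∀ (f : ℕ → List A) (g : ℕ → List B) →
      (∀ n → Unique (f n)) → (∀ n → Unique (g n)) → (∀ {x i j} → x ∈ f i → x ∈ f j → i ≡ j) →
      ∀ n → Unique (convolution f g n)
    convolution-unique f g f! g! f-graded zero    = Unique.cartesianProduct⁺ (f! 0) (g! 0)
    convolution-unique f g f! g! f-graded (suc n) = Unique.++⁺
      (Unique.cartesianProduct⁺ (f! 0) (g! (suc n)))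
      (convolution-unique (f ∘ suc) g (f! ∘ suc) g! (λ p r → ℕ.suc-injective (f-graded p r)) n)
      disjoint
      where
      disjoint : Disjoint (cartesianProduct (f 0) (g (suc n))) (convolution (f ∘ suc) g n)
      disjoint {x , y} (p , r) =
        let _ , _ , _ , x∈ , _ = ∈-convolution⁻ (f ∘ suc) g n r
        in  ℕ.0≢1+n (f-graded (proj₁ (∈.∈-cartesianProduct⁻ (f 0) (g (suc n)) p)) x∈)

  -- Counting statistics as sums over positions

  length-filter-map : ∀ {A B : Set} {P : B → Set} (P? : ∀ x → Dec (P x)) (g : A → B) xs →
    length (filter P? (map g xs)) ≡ length (filter (P? ∘ g) xs)
  length-filter-map P? g []       = refl
  length-filter-map P? g (x ∷ xs) with does (P? (g x))
  ... | true  = cong suc (length-filter-map P? g xs)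
  ... | false = length-filter-map P? g xs

  length-filter-tabulate : ∀ {A : Set} {P : A → Set} (P? : ∀ x → Dec (P x)) {n} (f : Fin n → A) →
    length (filter P? (List.tabulate f)) ≡ sum (λ i → ⟦ does (P? (f i)) ⟧)
  length-filter-tabulate P? {zero}  f = refl
  length-filter-tabulate P? {suc n} f with does (P? (f zero))
  ... | true  = cong suc (length-filter-tabulate P? (f ∘ suc))
  ... | false = length-filter-tabulate P? (f ∘ suc)

  length-filter-cartesianProduct : ∀ {A B : Set} {P : A × B → Set} (P? : ∀ x → Dec (P x)) {n} (f : Fin n → A) ys →
    length (filter P? (cartesianProduct (List.tabulate f) ys)) ≡ sum (λ i → length (filter (λ y → P? (f i , y)) ys))
  length-filter-cartesianProduct P? {zero}  f ys = refl
  length-filter-cartesianProduct P? {suc n} f ys = begin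
    length (filter P? (map (f zero ,_) ys ++ rest))
      ≡⟨ cong length (List.filter-++ P? (map (f zero ,_) ys) rest) ⟩
    length (filter P? (map (f zero ,_) ys) ++ filter P? rest)
      ≡⟨ List.length-++ (filter P? (map (f zero ,_) ys)) ⟩
    length (filter P? (map (f zero ,_) ys)) + length (filter P? rest)
      ≡⟨ cong₂ _+_ (length-filter-map P? (f zero ,_) ys) (length-filter-cartesianProduct P? (f ∘ suc) ys) ⟩
    length (filter (λ y → P? (f zero , y)) ys) + sum (λ i → length (filter (λ y → P? (f (suc i) , y)) ys)) ∎
    where
    open ≡-Reasoning
    rest = cartesianProduct (List.tabulate (f ∘ suc)) ys

  -- Sums over all positions stand between the counts that define the statistics and the recursive
  -- statistics on lists: in this form reversal of positions is a mere reindexing.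
  adjΣ : ∀ {n} → (ℕ → ℕ → Bool) → (Fin n → ℕ) → ℕ
  adjΣ p f = sum λ i → sum λ i⁺ → ⟦ (suc (toℕ i) ≡ᵇ toℕ i⁺) ∧ p (f i) (f i⁺) ⟧

  preΣ postΣ : ∀ {n} → (ℕ → ℕ → ℕ → Bool) → (Fin n → ℕ) → ℕ
  preΣ r f = sum λ i → sum λ i⁺ → sum λ j →
    ⟦ (suc (toℕ i) ≡ᵇ toℕ i⁺) ∧ ((toℕ j <ᵇ toℕ i) ∧ r (f i) (f i⁺) (f j)) ⟧
  postΣ r f = sum λ i → sum λ i⁺ → sum λ j →
    ⟦ (suc (toℕ i) ≡ᵇ toℕ i⁺) ∧ ((toℕ i⁺ <ᵇ toℕ j) ∧ r (f i) (f i⁺) (f j)) ⟧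

  values : ∀ {n} → Word n → Fin n → ℕ
  values π i = toℕ (lookup π i)

  module _ {n} (π : Word n) where

    length-filter-positions : ∀ {P : Fin n × Fin n × Fin n → Set} (P? : ∀ x → Dec (P x)) →
      length (filter P? positions) ≡ sum (λ i → sum (λ i⁺ → sum (λ j → ⟦ does (P? (i , i⁺ , j)) ⟧)))
    length-filter-positions P? = trans
      (length-filter-cartesianProduct P? id (cartesianProduct (allFin n) (allFin n)))
      (sum-cong-≗ λ i → trans (length-filter-cartesianProduct (λ y → P? (i , y)) id (allFin n))
        (sum-cong-≗ λ i⁺ → length-filter-tabulate (λ j → P? (i , i⁺ , j)) id))

    length-filter-pairs : ∀ {P : Fin n × Fin n → Set} (P? : ∀ x → Dec (P x)) →
      length (filter P? (cartesianProduct (allFin n) (allFin n))) ≡ sum (λ i → sum (λ i⁺ → ⟦ does (P? (i , i⁺)) ⟧))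
    length-filter-pairs P? = trans (length-filter-cartesianProduct P? id (allFin n))
      (sum-cong-≗ λ i → length-filter-tabulate (λ i⁺ → P? (i , i⁺)) id)

    -- The decision procedures compute to the very Boolean tests of `adjΣ`, so only the shape of the
    -- count changes. The same holds for the four statistics below.
    des≡adjΣ : des π ≡ adjΣ descent (values π)
    des≡adjΣ = length-filter-pairs _

    31-2≡postΣ : ⟨31-2⟩ π ≡ postΣ down (values π)
    31-2≡postΣ = length-filter-positions _

    2-31≡preΣ : ⟨2-31⟩ π ≡ preΣ down (values π)
    2-31≡preΣ = length-filter-positions _

    2-13≡preΣ : ⟨2-13⟩ π ≡ preΣ up (values π)
    2-13≡preΣ = length-filter-positions _

    13-2≡postΣ : ⟨13-2⟩ π ≡ postΣ up (values π)
    13-2≡postΣ = length-filter-positions _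

  sum-zero : ∀ {n} {f : Fin n → ℕ} → (∀ i → f i ≡ 0) → sum f ≡ 0
  sum-zero {n} eq = trans (sum-cong-≗ eq) (sum-replicate-zero n)

  adjΣ≡adj : ∀ {n} p (f : Fin n → ℕ) → adjΣ p f ≡ adj p (List.tabulate f)
  adjΣ≡adj {zero}        p f = refl
  adjΣ≡adj {suc zero}    p f = refl
  adjΣ≡adj {suc (suc n)} p f = cong₂ _+_
    (trans (cong (⟦ p (f zero) (f (suc zero)) ⟧ +_) (sum-zero {n} λ _ → refl)) (ℕ.+-identityʳ _))
    (adjΣ≡adj p (f ∘ suc))

  sum≡count : ∀ {n} p (f : Fin n → ℕ) → sum (λ i → ⟦ p (f i) ⟧) ≡ count p (List.tabulate f)
  sum≡count {zero}  p f = refl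
  sum≡count {suc n} p f = cong (⟦ p (f zero) ⟧ +_) (sum≡count p (f ∘ suc))

  sum-drop : ∀ {n} (f : Fin (suc n) → ℕ) → f zero ≡ 0 → sum f ≡ sum (f ∘ suc)
  sum-drop f eq = cong (_+ sum (f ∘ suc)) eq

  -- Position 0 is peeled off. As a left neighbour it is paired with position 1 and sees all later
  -- letters; it is never a right neighbour, nor does it come after one.
  postΣ≡post : ∀ {n} r (f : Fin n → ℕ) → postΣ r f ≡ post r (List.tabulate f)
  postΣ≡post {zero}        r f = refl
  postΣ≡post {suc zero}    r f = refl
  postΣ≡post {suc (suc n)} r f = cong₂ _+_
    (trans (cong₂ _+_ (sum-zero {n} λ _ → refl)
        (cong₂ _+_ (sum≡count (r (f zero) (f (suc zero))) (λ i → f (suc (suc i))))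
                   (sum-zero {n} λ i⁺ → sum-zero {suc (suc n)} λ _ → refl)))
      (ℕ.+-identityʳ _))
    (trans (sum-cong-≗ {suc n} λ i → trans
        (sum-drop (λ i⁺ → sum (term i i⁺)) (sum-zero {suc (suc n)} λ _ → refl))
        (sum-cong-≗ {suc n} λ i⁺ → sum-drop (term i (suc i⁺)) (cong ⟦_⟧ (Bool.∧-zeroʳ (suc (toℕ i) ≡ᵇ toℕ i⁺)))))
      (postΣ≡post r (f ∘ suc)))
    where
    term : Fin (suc n) → Fin (suc (suc n)) → Fin (suc (suc n)) → ℕ
    term i i⁺ j = ⟦ (suc (toℕ (suc i)) ≡ᵇ toℕ i⁺) ∧ ((toℕ i⁺ <ᵇ toℕ j) ∧ r (f (suc i)) (f i⁺) (f j)) ⟧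

  -- Position 0 precedes every other one, so it occurs only as the separate letter j; splitting off
  -- these terms leaves an adjacency count over the remaining word.
  preΣ≡pre : ∀ {n} r (f : Fin n → ℕ) → preΣ r f ≡ pre r (List.tabulate f)
  preΣ≡pre {zero}  r f = refl
  preΣ≡pre {suc n} r f = trans
    (cong₂ _+_ (sum-zero {suc n} λ i⁺ → sum-zero {suc n} λ j → cong ⟦_⟧ (Bool.∧-zeroʳ (1 ≡ᵇ toℕ i⁺)))
      (trans (sum-cong-≗ {n} λ i → trans
          (sum-drop (λ i⁺ → sum (term i i⁺)) (sum-zero {suc n} λ _ → refl))
          (∑-distrib-+ {n} (λ i⁺ → term i (suc i⁺) zero) (λ i⁺ → sum (term i (suc i⁺) ∘ suc))))
        (∑-distrib-+ {n} (λ i → sum (λ i⁺ → term i (suc i⁺) zero)) (λ i → sum (λ i⁺ → sum (term i (suc i⁺) ∘ suc))))))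
    (cong₂ _+_ (adjΣ≡adj (λ a b → r a b (f zero)) (f ∘ suc)) (preΣ≡pre r (f ∘ suc)))
    where
    term : Fin n → Fin (suc n) → Fin (suc n) → ℕ
    term i i⁺ j = ⟦ (suc (toℕ (suc i)) ≡ᵇ toℕ i⁺) ∧ ((toℕ j <ᵇ toℕ (suc i)) ∧ r (f (suc i)) (f i⁺) (f j)) ⟧

  -- Reversal of positions and complementation of values

  ≡true-⇔⇒≡ : ∀ {a b} → (a ≡ true → b ≡ true) → (b ≡ true → a ≡ true) → a ≡ b
  ≡true-⇔⇒≡ {true}  {b}     f g = sym (f refl)
  ≡true-⇔⇒≡ {false} {true}  f g = g refl
  ≡true-⇔⇒≡ {false} {false} f g = refl

  <ᵇ≡true⇒< : ∀ m n → (m <ᵇ n) ≡ true → m < n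
  <ᵇ≡true⇒< m n eq = ℕ.<ᵇ⇒< m n (subst T (sym eq) _)

  ≡ᵇ≡true⇒≡ : ∀ m n → (m ≡ᵇ n) ≡ true → m ≡ n
  ≡ᵇ≡true⇒≡ m n eq = ℕ.≡ᵇ⇒≡ m n (subst T (sym eq) _)

  ≡⇒≡ᵇ≡true : ∀ {m n} → m ≡ n → (m ≡ᵇ n) ≡ true
  ≡⇒≡ᵇ≡true {zero}  refl = refl
  ≡⇒≡ᵇ≡true {suc m} refl = ≡⇒≡ᵇ≡true {m} refl

  opposite-<⁺ : ∀ {n} {i j : Fin n} → toℕ i < toℕ j → toℕ (opposite j) < toℕ (opposite i)
  opposite-<⁺ {n} {i} {j} i<j = subst₂ _<_ (sym (Fin.opposite-prop j)) (sym (Fin.opposite-prop i))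
    (ℕ.∸-monoʳ-< (s≤s i<j) (Fin.toℕ<n j))

  opposite-<⁻ : ∀ {n} {i j : Fin n} → toℕ (opposite j) < toℕ (opposite i) → toℕ i < toℕ j
  opposite-<⁻ p = subst₂ (λ i j → toℕ i < toℕ j) (Fin.opposite-involutive _) (Fin.opposite-involutive _) (opposite-<⁺ p)

  opposite-⋖⁺ : ∀ {n} {i i⁺ : Fin n} → i ⋖ i⁺ → opposite i⁺ ⋖ opposite i
  opposite-⋖⁺ {n} {i} {i⁺} i⋖i⁺ = begin
    suc (toℕ (opposite i⁺))   ≡⟨ cong suc (Fin.opposite-prop i⁺) ⟩
    suc (n ∸ suc (toℕ i⁺))    ≡⟨ ℕ.+-∸-assoc 1 (Fin.toℕ<n i⁺) ⟨
    n ∸ toℕ i⁺                ≡⟨ cong (n ∸_) i⋖i⁺ ⟨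
    n ∸ suc (toℕ i)           ≡⟨ Fin.opposite-prop i ⟨
    toℕ (opposite i)          ∎
    where open ≡-Reasoning

  opposite-⋖⁻ : ∀ {n} {i i⁺ : Fin n} → opposite i⁺ ⋖ opposite i → i ⋖ i⁺
  opposite-⋖⁻ p = subst₂ _⋖_ (Fin.opposite-involutive _) (Fin.opposite-involutive _) (opposite-⋖⁺ p)

  opposite-<ᵇ : ∀ {n} (i j : Fin n) → (toℕ (opposite i) <ᵇ toℕ (opposite j)) ≡ (toℕ j <ᵇ toℕ i)
  opposite-<ᵇ i j = ≡true-⇔⇒≡
    (λ eq → <⇒<ᵇ≡true (opposite-<⁻ {i = j} (<ᵇ≡true⇒< _ _ eq)))
    (λ eq → <⇒<ᵇ≡true (opposite-<⁺ {i = j} (<ᵇ≡true⇒< _ _ eq)))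

  opposite-⋖ᵇ : ∀ {n} (i i⁺ : Fin n) → (suc (toℕ (opposite i⁺)) ≡ᵇ toℕ (opposite i)) ≡ (suc (toℕ i) ≡ᵇ toℕ i⁺)
  opposite-⋖ᵇ i i⁺ = ≡true-⇔⇒≡
    (λ eq → ≡⇒≡ᵇ≡true (opposite-⋖⁻ {i = i} (≡ᵇ≡true⇒≡ _ _ eq)))
    (λ eq → ≡⇒≡ᵇ≡true (opposite-⋖⁺ {i = i} (≡ᵇ≡true⇒≡ _ _ eq)))

  sum-opposite : ∀ {n} (f : Fin n → ℕ) → sum f ≡ sum (f ∘ opposite)
  sum-opposite f = sum-permute f Permutation.reverse

  adjΣ-cong : ∀ {n} p p′ (f g : Fin n → ℕ) → (∀ i j → p (f i) (f j) ≡ p′ (g i) (g j)) → adjΣ p f ≡ adjΣ p′ g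
  adjΣ-cong p p′ f g eq = sum-cong-≗ λ i → sum-cong-≗ λ i⁺ → cong (λ b → ⟦ (suc (toℕ i) ≡ᵇ toℕ i⁺) ∧ b ⟧) (eq i i⁺)

  preΣ-cong : ∀ {n} r r′ (f g : Fin n → ℕ) → (∀ i j k → r (f i) (f j) (f k) ≡ r′ (g i) (g j) (g k)) → preΣ r f ≡ preΣ r′ g
  preΣ-cong r r′ f g eq = sum-cong-≗ λ i → sum-cong-≗ λ i⁺ → sum-cong-≗ λ j →
    cong (λ b → ⟦ (suc (toℕ i) ≡ᵇ toℕ i⁺) ∧ ((toℕ j <ᵇ toℕ i) ∧ b) ⟧) (eq i i⁺ j)

  postΣ-cong : ∀ {n} r r′ (f g : Fin n → ℕ) → (∀ i j k → r (f i) (f j) (f k) ≡ r′ (g i) (g j) (g k)) → postΣ r f ≡ postΣ r′ g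
  postΣ-cong r r′ f g eq = sum-cong-≗ λ i → sum-cong-≗ λ i⁺ → sum-cong-≗ λ j →
    cong (λ b → ⟦ (suc (toℕ i) ≡ᵇ toℕ i⁺) ∧ ((toℕ i⁺ <ᵇ toℕ j) ∧ b) ⟧) (eq i i⁺ j)

  -- Reversal exchanges left and right neighbour, so the two summations are interchanged before each
  -- is reindexed; the relation p is transposed accordingly.
  adjΣ-opposite : ∀ {n} p (f : Fin n → ℕ) → adjΣ p f ≡ adjΣ (λ a b → p b a) (f ∘ opposite)
  adjΣ-opposite {n} p f = begin
    sum (λ i → sum (λ i⁺ → term i i⁺))                        ≡⟨ ∑-comm term ⟩
    sum (λ i⁺ → sum (λ i → term i i⁺))                        ≡⟨ sum-opposite (λ i⁺ → sum (λ i → term i i⁺)) ⟩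
    sum (λ i⁺ → sum (λ i → term i (opposite i⁺)))
      ≡⟨ sum-cong-≗ (λ i⁺ → sum-opposite (λ i → term i (opposite i⁺))) ⟩
    sum (λ i⁺ → sum (λ i → term (opposite i) (opposite i⁺)))
      ≡⟨ sum-cong-≗ (λ i⁺ → sum-cong-≗ λ i → cong (λ b → ⟦ b ∧ p (f (opposite i)) (f (opposite i⁺)) ⟧) (opposite-⋖ᵇ i⁺ i)) ⟩
    adjΣ (λ a b → p b a) (f ∘ opposite) ∎
    where
    open ≡-Reasoning
    term : Fin n → Fin n → ℕ
    term i i⁺ = ⟦ (suc (toℕ i) ≡ᵇ toℕ i⁺) ∧ p (f i) (f i⁺) ⟧

  triple-opposite : ∀ {n} (term : Fin n → Fin n → Fin n → ℕ) →
    sum (λ i → sum (λ i⁺ → sum (term i i⁺))) ≡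
    sum (λ i⁺ → sum (λ i → sum (λ j → term (opposite i) (opposite i⁺) (opposite j))))
  triple-opposite term = begin
    sum (λ i → sum (λ i⁺ → sum (term i i⁺)))                  ≡⟨ ∑-comm (λ i i⁺ → sum (term i i⁺)) ⟩
    sum (λ i⁺ → sum (λ i → sum (term i i⁺)))                  ≡⟨ sum-opposite (λ i⁺ → sum (λ i → sum (term i i⁺))) ⟩
    sum (λ i⁺ → sum (λ i → sum (term i (opposite i⁺))))
      ≡⟨ sum-cong-≗ (λ i⁺ → sum-opposite (λ i → sum (term i (opposite i⁺)))) ⟩
    sum (λ i⁺ → sum (λ i → sum (term (opposite i) (opposite i⁺))))
      ≡⟨ sum-cong-≗ (λ i⁺ → sum-cong-≗ λ i → sum-opposite (term (opposite i) (opposite i⁺))) ⟩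
    sum (λ i⁺ → sum (λ i → sum (λ j → term (opposite i) (opposite i⁺) (opposite j)))) ∎
    where open ≡-Reasoning

  preΣ-opposite : ∀ {n} r (f : Fin n → ℕ) → preΣ r f ≡ postΣ (λ a b x → r b a x) (f ∘ opposite)
  preΣ-opposite {n} r f = trans (triple-opposite term) (sum-cong-≗ λ i⁺ → sum-cong-≗ λ i → sum-cong-≗ λ j →
    cong₂ (λ b c → ⟦ b ∧ (c ∧ r (f (opposite i)) (f (opposite i⁺)) (f (opposite j))) ⟧)
      (opposite-⋖ᵇ i⁺ i) (opposite-<ᵇ j i))
    where
    term : Fin n → Fin n → Fin n → ℕ
    term i i⁺ j = ⟦ (suc (toℕ i) ≡ᵇ toℕ i⁺) ∧ ((toℕ j <ᵇ toℕ i) ∧ r (f i) (f i⁺) (f j)) ⟧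

  postΣ-opposite : ∀ {n} r (f : Fin n → ℕ) → postΣ r f ≡ preΣ (λ a b x → r b a x) (f ∘ opposite)
  postΣ-opposite {n} r f = trans (triple-opposite term) (sum-cong-≗ λ i⁺ → sum-cong-≗ λ i → sum-cong-≗ λ j →
    cong₂ (λ b c → ⟦ b ∧ (c ∧ r (f (opposite i)) (f (opposite i⁺)) (f (opposite j))) ⟧)
      (opposite-⋖ᵇ i⁺ i) (opposite-<ᵇ i⁺ j))
    where
    term : Fin n → Fin n → Fin n → ℕ
    term i i⁺ j = ⟦ (suc (toℕ i) ≡ᵇ toℕ i⁺) ∧ ((toℕ i⁺ <ᵇ toℕ j) ∧ r (f i) (f i⁺) (f j)) ⟧

  -- Pattern classes under the symmetries

  -- `lo`, `mi`, `hi` are the places of the smallest, middle and largest letter. Two strict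
  -- inequalities on each side fix all nine comparisons, by transitivity and irreflexivity.
  OrderIsomorphic⁺ : ∀ {n τ} {w : Vec (Fin n) 3} lo mi hi → (∀ a → a ≡ lo ⊎ a ≡ mi ⊎ a ≡ hi) →
    lookup τ lo < lookup τ mi → lookup τ mi < lookup τ hi →
    lookup w lo Fin.< lookup w mi → lookup w mi Fin.< lookup w hi → OrderIsomorphic τ w
  OrderIsomorphic⁺ lo mi hi cover τ₁ τ₂ w₁ w₂ a b with cover a | cover b
  ... | inj₁ refl        | inj₁ refl        = (⊥-elim ∘ ℕ.<-irrefl refl) , (⊥-elim ∘ ℕ.<-irrefl refl)
  ... | inj₁ refl        | inj₂ (inj₁ refl) = (λ _ → w₁) , (λ _ → τ₁)
  ... | inj₁ refl        | inj₂ (inj₂ refl) = (λ _ → ℕ.<-trans w₁ w₂) , (λ _ → ℕ.<-trans τ₁ τ₂)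
  ... | inj₂ (inj₁ refl) | inj₁ refl        = (⊥-elim ∘ ℕ.<-asym τ₁) , (⊥-elim ∘ ℕ.<-asym w₁)
  ... | inj₂ (inj₁ refl) | inj₂ (inj₁ refl) = (⊥-elim ∘ ℕ.<-irrefl refl) , (⊥-elim ∘ ℕ.<-irrefl refl)
  ... | inj₂ (inj₁ refl) | inj₂ (inj₂ refl) = (λ _ → w₂) , (λ _ → τ₂)
  ... | inj₂ (inj₂ refl) | inj₁ refl        = (⊥-elim ∘ ℕ.<-asym (ℕ.<-trans τ₁ τ₂)) , (⊥-elim ∘ ℕ.<-asym (ℕ.<-trans w₁ w₂))
  ... | inj₂ (inj₂ refl) | inj₂ (inj₁ refl) = (⊥-elim ∘ ℕ.<-asym τ₂) , (⊥-elim ∘ ℕ.<-asym w₂)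
  ... | inj₂ (inj₂ refl) | inj₂ (inj₂ refl) = (⊥-elim ∘ ℕ.<-irrefl refl) , (⊥-elim ∘ ℕ.<-irrefl refl)

  pattern 0F = zero
  pattern 1F = suc zero
  pattern 2F = suc (suc zero)

  1<2 : 1 < 2
  1<2 = s≤s (s≤s z≤n)

  2<3 : 2 < 3
  2<3 = s≤s 1<2

  Occurs : ∀ {n} → Word n → (Fin n → Fin n → Fin n → Set) → Set
  Occurs π Q = ∃ λ i → ∃ λ j → ∃ λ k → i Fin.< j × j Fin.< k × Q (lookup π i) (lookup π j) (lookup π k)

  -- Below, x < y < z are the letters of the occurrence.
  module _ {n} (π : Word n) where

    contains132⁻ : Contains p132 π → Occurs π (λ x z y → x Fin.< y × y Fin.< z)
    contains132⁻ (i , j , k , i<j , j<k , iso) =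
      i , j , k , i<j , j<k , proj₁ (iso 0F 2F) 1<2 , proj₁ (iso 2F 1F) 2<3

    contains132⁺ : Occurs π (λ x z y → x Fin.< y × y Fin.< z) → Contains p132 π
    contains132⁺ (i , j , k , i<j , j<k , x<y , y<z) = i , j , k , i<j , j<k ,
      OrderIsomorphic⁺ {τ = p132} {w = lookup π i ∷ lookup π j ∷ lookup π k ∷ []} 0F 2F 1F
        (λ { 0F → inj₁ refl ; 1F → inj₂ (inj₂ refl) ; 2F → inj₂ (inj₁ refl) }) 1<2 2<3 x<y y<z

    contains213⁻ : Contains p213 π → Occurs π (λ y x z → x Fin.< y × y Fin.< z)
    contains213⁻ (i , j , k , i<j , j<k , iso) =
      i , j , k , i<j , j<k , proj₁ (iso 1F 0F) 1<2 , proj₁ (iso 0F 2F) 2<3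

    contains213⁺ : Occurs π (λ y x z → x Fin.< y × y Fin.< z) → Contains p213 π
    contains213⁺ (i , j , k , i<j , j<k , x<y , y<z) = i , j , k , i<j , j<k ,
      OrderIsomorphic⁺ {τ = p213} {w = lookup π i ∷ lookup π j ∷ lookup π k ∷ []} 1F 0F 2F
        (λ { 0F → inj₂ (inj₁ refl) ; 1F → inj₁ refl ; 2F → inj₂ (inj₂ refl) }) 1<2 2<3 x<y y<z

    contains231⁻ : Contains p231 π → Occurs π (λ y z x → x Fin.< y × y Fin.< z)
    contains231⁻ (i , j , k , i<j , j<k , iso) =
      i , j , k , i<j , j<k , proj₁ (iso 2F 0F) 1<2 , proj₁ (iso 0F 1F) 2<3

    contains231⁺ : Occurs π (λ y z x → x Fin.< y × y Fin.< z) → Contains p231 π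
    contains231⁺ (i , j , k , i<j , j<k , x<y , y<z) = i , j , k , i<j , j<k ,
      OrderIsomorphic⁺ {τ = p231} {w = lookup π i ∷ lookup π j ∷ lookup π k ∷ []} 2F 0F 1F
        (λ { 0F → inj₂ (inj₁ refl) ; 1F → inj₂ (inj₂ refl) ; 2F → inj₁ refl }) 1<2 2<3 x<y y<z

    contains312⁻ : Contains p312 π → Occurs π (λ z x y → x Fin.< y × y Fin.< z)
    contains312⁻ (i , j , k , i<j , j<k , iso) =
      i , j , k , i<j , j<k , proj₁ (iso 1F 2F) 1<2 , proj₁ (iso 2F 0F) 2<3

    contains312⁺ : Occurs π (λ z x y → x Fin.< y × y Fin.< z) → Contains p312 π
    contains312⁺ (i , j , k , i<j , j<k , x<y , y<z) = i , j , k , i<j , j<k ,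
      OrderIsomorphic⁺ {τ = p312} {w = lookup π i ∷ lookup π j ∷ lookup π k ∷ []} 1F 2F 0F
        (λ { 0F → inj₂ (inj₂ refl) ; 1F → inj₁ refl ; 2F → inj₂ (inj₁ refl) }) 1<2 2<3 x<y y<z

  words-complete : ∀ n {k} (w : Vec (Fin n) k) → w ∈ words n k
  words-complete n []      = here refl
  words-complete n (x ∷ w) = ∈.∈-cartesianProductWith⁺ _∷_ (∈.∈-allFin x) (words-complete n w)

  words-unique : ∀ n k → Unique (words n k)
  words-unique n zero    = [] ∷ []
  words-unique n (suc k) = Unique.cartesianProductWith⁺ _∷_ Vec.∷-injective (Unique.allFin⁺ n) (words-unique n k)

  𝔖-unique : ∀ n τ → Unique (𝔖 n τ)
  𝔖-unique n τ = Unique.filter⁺ _ (Unique.filter⁺ unique? (words-unique n n))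

  ∈𝔖⁺ : ∀ n τ {π : Word n} → Uniqueⱽ π → ¬ Contains τ π → π ∈ 𝔖 n τ
  ∈𝔖⁺ n τ {π} u av = ∈.∈-filter⁺ (λ π → ¬? (contains? τ π)) (∈.∈-filter⁺ unique? (words-complete n π) u) av

  ∈𝔖⁻ : ∀ n τ {π : Word n} → π ∈ 𝔖 n τ → Uniqueⱽ π × ¬ Contains τ π
  ∈𝔖⁻ n τ p =
    let p′ , av = ∈.∈-filter⁻ (λ π → ¬? (contains? τ π)) {xs = permutations n} p
    in  proj₂ (∈.∈-filter⁻ unique? {xs = words n n} p′) , av

  𝔖-involution : ∀ {n} (φ : Word n → Word n) τ τ′ → (∀ π → φ (φ π) ≡ π) → (∀ {π} → Uniqueⱽ π → Uniqueⱽ (φ π)) →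
    (∀ {π} → Contains τ′ (φ π) → Contains τ π) → (∀ {π} → Contains τ (φ π) → Contains τ′ π) →
    𝔖 n τ′ ↭ map φ (𝔖 n τ)
  𝔖-involution {n} φ τ τ′ invol φ-unique τ′⇒τ τ⇒τ′ = Unique∧⇔⇒↭ {xs = 𝔖 n τ′} {ys = map φ (𝔖 n τ)} (𝔖-unique n τ′)
    (Unique.map⁺ (λ {x} {y} eq → trans (sym (invol x)) (trans (cong φ eq) (invol y))) {xs = 𝔖 n τ} (𝔖-unique n τ))
    to from
    where
    to : ∀ {π} → π ∈ 𝔖 n τ′ → π ∈ map φ (𝔖 n τ)
    to {π} p =
      let u , av = ∈𝔖⁻ n τ′ p
      in  subst (_∈ map φ (𝔖 n τ)) (invol π) (∈.∈-map⁺ φ {xs = 𝔖 n τ} (∈𝔖⁺ n τ (φ-unique u) (av ∘ τ⇒τ′)))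
    from : ∀ {π} → π ∈ map φ (𝔖 n τ) → π ∈ 𝔖 n τ′
    from p =
      let π , π∈ , eq = ∈.∈-map⁻ φ {xs = 𝔖 n τ} p
          u , av      = ∈𝔖⁻ n τ π∈
      in  subst (_∈ 𝔖 n τ′) (sym eq) (∈𝔖⁺ n τ′ (φ-unique u) (av ∘ τ′⇒τ))

  transform : ∀ {n} → (Fin n → Fin n) → (Fin n → Fin n) → Word n → Word n
  transform ρ ν π = Vec.tabulate (ν ∘ lookup π ∘ ρ)

  module _ {n} (ρ ν : Fin n → Fin n) where

    lookup-transform : ∀ π i → lookup (transform ρ ν π) i ≡ ν (lookup π (ρ i))
    lookup-transform π = Vec.lookup∘tabulate (ν ∘ lookup π ∘ ρ)

    module _ (ρ-invol : ∀ i → ρ (ρ i) ≡ i) (ν-invol : ∀ i → ν (ν i) ≡ i) where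

      transform-involutive : ∀ π → transform ρ ν (transform ρ ν π) ≡ π
      transform-involutive π = trans
        (Vec.tabulate-cong λ i → trans (cong ν (lookup-transform π (ρ i)))
          (trans (ν-invol _) (cong (lookup π) (ρ-invol i))))
        (Vec.tabulate∘lookup π)

      transform-unique : ∀ {π} → Uniqueⱽ π → Uniqueⱽ (transform ρ ν π)
      transform-unique u = VecUnique.tabulate⁺ λ {i} {j} eq →
        trans (sym (ρ-invol i)) (trans (cong ρ (VecUnique.lookup-injective u _ _
          (trans (sym (ν-invol _)) (trans (cong ν eq) (ν-invol _))))) (ρ-invol j))

  complement reversal reverseComplement : ∀ {n} → Word n → Word n
  complement        = transform id opposite
  reversal          = transform opposite id
  reverseComplement = transform opposite opposite

  module _ {n} (π : Word n) where

    complement-<⁻ : ∀ i j → lookup (complement π) i Fin.< lookup (complement π) j → lookup π j Fin.< lookup π i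
    complement-<⁻ i j p rewrite lookup-transform id opposite π i | lookup-transform id opposite π j = opposite-<⁻ p

    reversal-<⁻ : ∀ i j → lookup (reversal π) i Fin.< lookup (reversal π) j → lookup π (opposite i) Fin.< lookup π (opposite j)
    reversal-<⁻ i j p rewrite lookup-transform opposite id π i | lookup-transform opposite id π j = p

    reverseComplement-<⁻ : ∀ i j → lookup (reverseComplement π) i Fin.< lookup (reverseComplement π) j →
      lookup π (opposite j) Fin.< lookup π (opposite i)
    reverseComplement-<⁻ i j p rewrite lookup-transform opposite opposite π i | lookup-transform opposite opposite π j = opposite-<⁻ p

  𝔖312↭ : ∀ n → 𝔖 n p312 ↭ map complement (𝔖 n p132)
  𝔖312↭ n = 𝔖-involution complement p132 p312
    (transform-involutive id opposite (λ _ → refl) Fin.opposite-involutive)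
    (transform-unique id opposite (λ _ → refl) Fin.opposite-involutive)
    (λ {π} c → let i , j , k , i<j , j<k , a , b = contains312⁻ (complement π) c in
      contains132⁺ π (i , j , k , i<j , j<k , complement-<⁻ π k i b , complement-<⁻ π j k a))
    (λ {π} c → let i , j , k , i<j , j<k , a , b = contains132⁻ (complement π) c in
      contains312⁺ π (i , j , k , i<j , j<k , complement-<⁻ π k j b , complement-<⁻ π i k a))

  𝔖231↭ : ∀ n → 𝔖 n p231 ↭ map reversal (𝔖 n p132)
  𝔖231↭ n = 𝔖-involution reversal p132 p231
    (transform-involutive opposite id Fin.opposite-involutive (λ _ → refl))
    (transform-unique opposite id Fin.opposite-involutive (λ _ → refl))
    (λ {π} c → let i , j , k , i<j , j<k , a , b = contains231⁻ (reversal π) c in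
      contains132⁺ π (opposite k , opposite j , opposite i , opposite-<⁺ j<k , opposite-<⁺ i<j , reversal-<⁻ π k i a , reversal-<⁻ π i j b))
    (λ {π} c → let i , j , k , i<j , j<k , a , b = contains132⁻ (reversal π) c in
      contains231⁺ π (opposite k , opposite j , opposite i , opposite-<⁺ j<k , opposite-<⁺ i<j , reversal-<⁻ π i k a , reversal-<⁻ π k j b))

  𝔖213↭ : ∀ n → 𝔖 n p213 ↭ map reverseComplement (𝔖 n p132)
  𝔖213↭ n = 𝔖-involution reverseComplement p132 p213
    (transform-involutive opposite opposite Fin.opposite-involutive Fin.opposite-involutive)
    (transform-unique opposite opposite Fin.opposite-involutive Fin.opposite-involutive)
    (λ {π} c → let i , j , k , i<j , j<k , a , b = contains213⁻ (reverseComplement π) c in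
      contains132⁺ π (opposite k , opposite j , opposite i , opposite-<⁺ j<k , opposite-<⁺ i<j , reverseComplement-<⁻ π i k b , reverseComplement-<⁻ π j i a))
    (λ {π} c → let i , j , k , i<j , j<k , a , b = contains132⁻ (reverseComplement π) c in
      contains213⁺ π (opposite k , opposite j , opposite i , opposite-<⁺ j<k , opposite-<⁺ i<j , reverseComplement-<⁻ π k j b , reverseComplement-<⁻ π i k a))

  -- Statistics under complement, reversal and reverse-complement

  values-transform : ∀ {n} ρ ν (π : Word n) i → values (transform ρ ν π) i ≡ toℕ (ν (lookup π (ρ i)))
  values-transform ρ ν π i = cong toℕ (lookup-transform ρ ν π i)

  adjΣ-≗ : ∀ {n} p {f g : Fin n → ℕ} → (∀ i → f i ≡ g i) → adjΣ p f ≡ adjΣ p g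
  adjΣ-≗ p {f} {g} eq = adjΣ-cong p p f g λ i j → cong₂ p (eq i) (eq j)

  preΣ-≗ : ∀ {n} r {f g : Fin n → ℕ} → (∀ i → f i ≡ g i) → preΣ r f ≡ preΣ r g
  preΣ-≗ r {f} {g} eq = preΣ-cong r r f g λ i j k → trans (cong₂ (λ a b → r a b _) (eq i) (eq j)) (cong (r _ _) (eq k))

  postΣ-≗ : ∀ {n} r {f g : Fin n → ℕ} → (∀ i → f i ≡ g i) → postΣ r f ≡ postΣ r g
  postΣ-≗ r {f} {g} eq = postΣ-cong r r f g λ i j k → trans (cong₂ (λ a b → r a b _) (eq i) (eq j)) (cong (r _ _) (eq k))

  module _ {n} (π : Word n) where

    open ≡-Reasoning

    private
      v v̄ : Fin n → ℕ
      v   = values π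
      v̄ i = toℕ (opposite (lookup π i))

    down-opposite : ∀ (a b x : Fin n) →
      down (toℕ (opposite a)) (toℕ (opposite b)) (toℕ (opposite x)) ≡ up (toℕ a) (toℕ b) (toℕ x)
    down-opposite a b x = trans (cong₂ _∧_ (opposite-<ᵇ b x) (opposite-<ᵇ x a)) (Bool.∧-comm (toℕ x <ᵇ toℕ b) _)

    up-opposite : ∀ (a b x : Fin n) →
      up (toℕ (opposite a)) (toℕ (opposite b)) (toℕ (opposite x)) ≡ down (toℕ a) (toℕ b) (toℕ x)
    up-opposite a b x = trans (cong₂ _∧_ (opposite-<ᵇ a x) (opposite-<ᵇ x b)) (Bool.∧-comm (toℕ x <ᵇ toℕ a) _)

    des-complement : des (complement π) ≡ adjΣ ascent v
    des-complement = begin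
      des (complement π)              ≡⟨ des≡adjΣ (complement π) ⟩
      adjΣ descent (values (complement π)) ≡⟨ adjΣ-≗ descent (values-transform id opposite π) ⟩
      adjΣ descent v̄                  ≡⟨ adjΣ-cong descent ascent v̄ v (λ i j → opposite-<ᵇ (lookup π j) (lookup π i)) ⟩
      adjΣ ascent v                   ∎

    2-31-complement : ⟨2-31⟩ (complement π) ≡ ⟨2-13⟩ π
    2-31-complement = begin
      ⟨2-31⟩ (complement π)           ≡⟨ 2-31≡preΣ (complement π) ⟩
      preΣ down (values (complement π)) ≡⟨ preΣ-≗ down (values-transform id opposite π) ⟩
      preΣ down v̄                     ≡⟨ preΣ-cong down up v̄ v (λ i j k → down-opposite (lookup π i) (lookup π j) (lookup π k)) ⟩
      preΣ up v                       ≡⟨ 2-13≡preΣ π ⟨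
      ⟨2-13⟩ π                        ∎

    2-13-complement : ⟨2-13⟩ (complement π) ≡ ⟨2-31⟩ π
    2-13-complement = begin
      ⟨2-13⟩ (complement π)           ≡⟨ 2-13≡preΣ (complement π) ⟩
      preΣ up (values (complement π)) ≡⟨ preΣ-≗ up (values-transform id opposite π) ⟩
      preΣ up v̄                       ≡⟨ preΣ-cong up down v̄ v (λ i j k → up-opposite (lookup π i) (lookup π j) (lookup π k)) ⟩
      preΣ down v                     ≡⟨ 2-31≡preΣ π ⟨
      ⟨2-31⟩ π                        ∎

    13-2-reversal : ⟨13-2⟩ (reversal π) ≡ ⟨2-31⟩ π
    13-2-reversal = begin
      ⟨13-2⟩ (reversal π)             ≡⟨ 13-2≡postΣ (reversal π) ⟩
      postΣ up (values (reversal π))  ≡⟨ postΣ-≗ up (values-transform opposite id π) ⟩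
      postΣ up (v ∘ opposite)         ≡⟨ preΣ-opposite down v ⟨
      preΣ down v                     ≡⟨ 2-31≡preΣ π ⟨
      ⟨2-31⟩ π                        ∎

    2-13-reversal : ⟨2-13⟩ (reversal π) ≡ ⟨31-2⟩ π
    2-13-reversal = begin
      ⟨2-13⟩ (reversal π)             ≡⟨ 2-13≡preΣ (reversal π) ⟩
      preΣ up (values (reversal π))   ≡⟨ preΣ-≗ up (values-transform opposite id π) ⟩
      preΣ up (v ∘ opposite)          ≡⟨ postΣ-opposite down v ⟨
      postΣ down v                    ≡⟨ 31-2≡postΣ π ⟨
      ⟨31-2⟩ π                        ∎

    des-reverseComplement : des (reverseComplement π) ≡ des π
    des-reverseComplement = begin
      des (reverseComplement π)       ≡⟨ des≡adjΣ (reverseComplement π) ⟩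
      adjΣ descent (values (reverseComplement π)) ≡⟨ adjΣ-≗ descent (values-transform opposite opposite π) ⟩
      adjΣ descent (v̄ ∘ opposite)     ≡⟨ adjΣ-opposite ascent v̄ ⟨
      adjΣ ascent v̄                   ≡⟨ adjΣ-cong ascent descent v̄ v (λ i j → opposite-<ᵇ (lookup π i) (lookup π j)) ⟩
      adjΣ descent v                  ≡⟨ des≡adjΣ π ⟨
      des π                           ∎

    31-2-reverseComplement : ⟨31-2⟩ (reverseComplement π) ≡ ⟨2-31⟩ π
    31-2-reverseComplement = begin
      ⟨31-2⟩ (reverseComplement π)    ≡⟨ 31-2≡postΣ (reverseComplement π) ⟩
      postΣ down (values (reverseComplement π)) ≡⟨ postΣ-≗ down (values-transform opposite opposite π) ⟩
      postΣ down (v̄ ∘ opposite)       ≡⟨ preΣ-opposite up v̄ ⟨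
      preΣ up v̄                       ≡⟨ preΣ-cong up down v̄ v (λ i j k → up-opposite (lookup π i) (lookup π j) (lookup π k)) ⟩
      preΣ down v                     ≡⟨ 2-31≡preΣ π ⟨
      ⟨2-31⟩ π                        ∎

    13-2-reverseComplement : ⟨13-2⟩ (reverseComplement π) ≡ ⟨2-13⟩ π
    13-2-reverseComplement = begin
      ⟨13-2⟩ (reverseComplement π)    ≡⟨ 13-2≡postΣ (reverseComplement π) ⟩
      postΣ up (values (reverseComplement π)) ≡⟨ postΣ-≗ up (values-transform opposite opposite π) ⟩
      postΣ up (v̄ ∘ opposite)         ≡⟨ preΣ-opposite down v̄ ⟨
      preΣ down v̄                     ≡⟨ preΣ-cong down up v̄ v (λ i j k → down-opposite (lookup π i) (lookup π j) (lookup π k)) ⟩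
      preΣ up v                       ≡⟨ 2-13≡preΣ π ⟨
      ⟨2-13⟩ π                        ∎

  -- Statistics read off the list of letters

  letters : ∀ {n} → Word n → List ℕ
  letters π = List.tabulate (values π)

  des-letters : ∀ {n} (π : Word n) → des π ≡ desᴸ (letters π)
  des-letters π = trans (des≡adjΣ π) (adjΣ≡adj descent (values π))

  2-31-letters : ∀ {n} (π : Word n) → ⟨2-31⟩ π ≡ 2-31ᴸ (letters π)
  2-31-letters π = trans (2-31≡preΣ π) (preΣ≡pre down (values π))

  2-13-letters : ∀ {n} (π : Word n) → ⟨2-13⟩ π ≡ 2-13ᴸ (letters π)
  2-13-letters π = trans (2-13≡preΣ π) (preΣ≡pre up (values π))

  31-2-letters : ∀ {n} (π : Word n) → ⟨31-2⟩ π ≡ 31-2ᴸ (letters π)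
  31-2-letters π = trans (31-2≡postΣ π) (postΣ≡post down (values π))

  asc+des : ∀ x w → Unique (x ∷ w) → adj ascent (x ∷ w) + adj descent (x ∷ w) ≡ length w
  asc+des x []      _                     = refl
  asc+des x (y ∷ w) ((x≢y ∷ _) ∷ u) = trans (interchange ⟦ x <ᵇ y ⟧ _ _ _) (cong₂ _+_ (exactly-one x≢y) (asc+des y w u))
    where
    open CommutativeSemigroupProperties ℕ.+-commutativeSemigroup using (interchange)
    exactly-one : ∀ {x y} → x ≢ y → ⟦ x <ᵇ y ⟧ + ⟦ y <ᵇ x ⟧ ≡ 1
    exactly-one {x} {y} x≢y with ℕ.<-cmp x y
    ... | tri< x<y _ _ rewrite <⇒<ᵇ≡true x<y | ≥⇒<ᵇ≡false (ℕ.<⇒≤ x<y) = refl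
    ... | tri≈ _ x≡y _ = contradiction x≡y x≢y
    ... | tri> _ _ y<x rewrite <⇒<ᵇ≡true y<x | ≥⇒<ᵇ≡false (ℕ.<⇒≤ y<x) = refl

  -- Permutation words as lists

  values-injective : ∀ {n} {π : Word n} → Uniqueⱽ π → ∀ {i j} → values π i ≡ values π j → i ≡ j
  values-injective u eq = VecUnique.lookup-injective u _ _ (Fin.toℕ-injective eq)

  letters-unique : ∀ {n} {π : Word n} → Uniqueⱽ π → Unique (letters π)
  letters-unique u = Unique.tabulate⁺ (values-injective u)

  Avoids132-tabulate⁺ : ∀ {n} (f : Fin n → ℕ) →
    (∀ i j k → toℕ i < toℕ j → toℕ j < toℕ k → ¬ (f i < f k × f k < f j)) → Avoids132 (List.tabulate f)
  Avoids132-tabulate⁺ {zero}  f av = []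
  Avoids132-tabulate⁺ {suc n} f av =
    AllPairs.tabulate⁺-< (λ {j} {k} j<k → av zero (suc j) (suc k) (s≤s z≤n) (s≤s j<k))
    ∷ Avoids132-tabulate⁺ (f ∘ suc) (λ i j k i<j j<k → av (suc i) (suc j) (suc k) (s≤s i<j) (s≤s j<k))

  AllPairs-tabulate⁻ : ∀ {n} {R : ℕ → ℕ → Set} (f : Fin n → ℕ) → AllPairs R (List.tabulate f) →
    ∀ i j → toℕ i < toℕ j → R (f i) (f j)
  AllPairs-tabulate⁻ f (p ∷ _)  zero    (suc j) _         = All.tabulate⁻ p j
  AllPairs-tabulate⁻ f (_ ∷ ps) (suc i) (suc j) (s≤s i<j) = AllPairs-tabulate⁻ (f ∘ suc) ps i j i<j

  Avoids132-tabulate⁻ : ∀ {n} (f : Fin n → ℕ) → Avoids132 (List.tabulate f) →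
    ∀ i j k → toℕ i < toℕ j → toℕ j < toℕ k → ¬ (f i < f k × f k < f j)
  Avoids132-tabulate⁻ f (p ∷ _)  zero    (suc j) (suc k) _         (s≤s j<k) = AllPairs-tabulate⁻ (f ∘ suc) p j k j<k
  Avoids132-tabulate⁻ f (_ ∷ av) (suc i) (suc j) (suc k) (s≤s i<j) (s≤s j<k) = Avoids132-tabulate⁻ (f ∘ suc) av i j k i<j j<k

  letters-perm132 : ∀ {n} {π : Word n} → Uniqueⱽ π → ¬ Contains p132 π → Perm132 n (letters π)
  letters-perm132 {n} {π} u av = perm132
    (List.length-tabulate (values π))
    (All.tabulate⁺ (λ i → Fin.toℕ<n (lookup π i)))
    (letters-unique u)
    (Avoids132-tabulate⁺ (values π) λ i j k i<j j<k (x<y , y<z) →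
      av (contains132⁺ π (i , j , k , i<j , j<k , x<y , y<z)))

  words132 : ℕ → List (List ℕ)
  words132 n = map letters (𝔖 n p132)

  words132-unique : ∀ n → Unique (words132 n)
  words132-unique n = Unique.map⁺ {f = letters {n}} injective {xs = 𝔖 n p132} (𝔖-unique n p132)
    where
    tabulate-injective : ∀ {m} {f g : Fin m → ℕ} → List.tabulate f ≡ List.tabulate g → ∀ i → f i ≡ g i
    tabulate-injective eq zero    = List.∷-injectiveˡ eq
    tabulate-injective eq (suc i) = tabulate-injective (List.∷-injectiveʳ eq) i
    injective : ∀ {π π′ : Word n} → letters π ≡ letters π′ → π ≡ π′
    injective {π} {π′} eq = trans (sym (Vec.tabulate∘lookup π)) (trans
      (Vec.tabulate-cong (λ i → Fin.toℕ-injective (tabulate-injective eq i))) (Vec.tabulate∘lookup π′))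

  words132-sound : ∀ {n w} → w ∈ words132 n → Perm132 n w
  words132-sound {n} w∈ =
    let π , π∈ , eq = ∈.∈-map⁻ letters {xs = 𝔖 n p132} w∈
        u , av      = ∈𝔖⁻ n p132 π∈
    in  subst (Perm132 n) (sym eq) (letters-perm132 u av)

  words132-complete : ∀ {n w} → Perm132 n w → w ∈ words132 n
  words132-complete {n} {w} (perm132 refl w<n u av) =
    subst (_∈ words132 n) letters-π (∈.∈-map⁺ letters {xs = 𝔖 n p132} (∈𝔖⁺ n p132 π-unique π-avoids))
    where
    bound : ∀ i → List.lookup w i < n
    bound i = All.lookup w<n (∈.∈-lookup i)
    π : Word n
    π = Vec.tabulate (λ i → fromℕ< (bound i))
    values-π : ∀ i → values π i ≡ List.lookup w i
    values-π i = trans (cong toℕ (Vec.lookup∘tabulate (λ i → fromℕ< (bound i)) i)) (Fin.toℕ-fromℕ< (bound i))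
    letters-π : letters π ≡ w
    letters-π = trans (List.tabulate-cong values-π) (List.tabulate-lookup w)
    π-unique : Uniqueⱽ π
    π-unique = VecUnique.tabulate⁺ λ {i} {j} eq → lookup-injective u i j
      (trans (sym (Fin.toℕ-fromℕ< (bound i))) (trans (cong toℕ eq) (Fin.toℕ-fromℕ< (bound j))))
      where
      lookup-injective : ∀ {w} → Unique w → ∀ i j → List.lookup w i ≡ List.lookup w j → i ≡ j
      lookup-injective (p ∷ u) zero    zero    _  = refl
      lookup-injective (p ∷ u) zero    (suc j) eq = contradiction eq (All.lookup p (∈.∈-lookup j))
      lookup-injective (p ∷ u) (suc i) zero    eq = contradiction (sym eq) (All.lookup p (∈.∈-lookup i))
      lookup-injective (p ∷ u) (suc i) (suc j) eq = cong suc (lookup-injective u i j eq)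
    π-avoids : ¬ Contains p132 π
    π-avoids c =
      let i , j , k , i<j , j<k , p = contains132⁻ π c
      in  Avoids132-tabulate⁻ (values π) (subst Avoids132 (sym letters-π) av) i j k i<j j<k p

  does-⇔ : ∀ {P : Set} (P? : Dec P) {b} → (P → b ≡ true) → (b ≡ true → P) → does P? ≡ b
  does-⇔ (yes p) f g = sym (f p)
  does-⇔ (no ¬p) {false} f g = refl
  does-⇔ (no ¬p) {true}  f g = contradiction (g refl) ¬p

  -- Foremaxima

  append : ∀ {n} → (Fin n → ℕ) → ℕ → Fin (suc n) → ℕ
  append {zero}  f M zero    = M
  append {suc n} f M zero    = f zero
  append {suc n} f M (suc i) = append (f ∘ suc) M i

  append-inject₁ : ∀ {n} (f : Fin n → ℕ) M i → append f M (inject₁ i) ≡ f i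
  append-inject₁ f M zero    = refl
  append-inject₁ f M (suc i) = append-inject₁ (f ∘ suc) M i

  lookup-extend : ∀ {m n} (v : Vec (Fin m) n) k →
    toℕ (lookup (Vec.map inject₁ v Vec.∷ʳ fromℕ m) k) ≡ append (toℕ ∘ lookup v) m k
  lookup-extend []      zero    = Fin.toℕ-fromℕ _
  lookup-extend (x ∷ v) zero    = Fin.toℕ-inject₁ x
  lookup-extend (x ∷ v) (suc k) = lookup-extend v k

  LeftMax : ∀ {n} → (Fin n → ℕ) → Fin n → Set
  LeftMax f i = ∀ j → toℕ j ≤ toℕ i → f j ≤ f i

  Foremax : ∀ {n} → (Fin n → ℕ) → ℕ → Fin n → Set
  Foremax f M i = f i < append f M (suc i) × LeftMax f i

  module _ {n} (π : Word n) (i : Fin n) where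

    private
      at-i : toℕ (lookup (extend π) (inject₁ i)) ≡ values π i
      at-i = trans (lookup-extend π (inject₁ i)) (append-inject₁ (values π) n i)

    foremaximum⁻ : Foremaximum π i → Foremax (values π) n i
    foremaximum⁻ (asc , max) = subst₂ _<_ at-i (lookup-extend π (suc i)) asc , max

    foremaximum⁺ : Foremax (values π) n i → Foremaximum π i
    foremaximum⁺ (asc , max) = subst₂ _<_ (sym at-i) (sym (lookup-extend π (suc i))) asc , max

  -- `h ≤ f i` supplies the comparison with the letters already read, about which `LeftMax f` says
  -- nothing.
  coderAbove-true : ∀ {n} h (f : Fin n → ℕ) M → coderAbove h (List.tabulate f) ≡ true →
    ∀ i → h ≤ f i → ¬ Foremax f M i
  coderAbove-true {suc zero}    h f M eq zero h≤ _ rewrite ≤⇒≤ᵇ≡true h≤ with () ← eq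
  coderAbove-true {suc (suc n)} h f M eq zero h≤ (asc , _)
    rewrite ≤⇒≤ᵇ≡true h≤ | <⇒<ᵇ≡true asc with () ← eq
  coderAbove-true {suc (suc n)} h f M eq (suc i) h≤ (asc , max) =
    coderAbove-true (h ⊔ f zero) (f ∘ suc) M (Bool.∧-conicalʳ (not _) _ eq) i
      (ℕ.⊔-lub h≤ (max zero z≤n)) (asc , λ j j≤i → max (suc j) (s≤s j≤i))

  -- The bound by M makes the step from the last letter to the conventional value an ascent, so a
  -- failure of the test at the end of the word also yields a foremaximum.
  coderAbove-false : ∀ {n} h (f : Fin n → ℕ) M → (∀ i → f i < M) → coderAbove h (List.tabulate f) ≡ false →
    ∃ λ i → h ≤ f i × Foremax f M i
  coderAbove-false {suc zero} h f M f<M eq with h ℕ.≤? f zero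
  ... | yes h≤ = zero , h≤ , f<M zero , λ { zero _ → ℕ.≤-refl }
  ... | no  h≰ rewrite >⇒≤ᵇ≡false (ℕ.≰⇒> h≰) with () ← eq
  coderAbove-false {suc (suc n)} h f M f<M eq =
    [ now , (λ eq′ → later (coderAbove-false (h ⊔ f zero) (f ∘ suc) M (f<M ∘ suc) eq′)) ]′ (not-∧-false _ eq)
    where
    not-∧-false : ∀ a {b} → not a ∧ b ≡ false → a ≡ true ⊎ b ≡ false
    not-∧-false true  _  = inj₁ refl
    not-∧-false false eq = inj₂ eq
    now : (f zero <ᵇ f (suc zero)) ∧ (h ≤ᵇ f zero) ≡ true → ∃ λ i → h ≤ f i × Foremax f M i
    now eq = zero , ℕ.≤ᵇ⇒≤ h _ (subst T (sym (Bool.∧-conicalʳ (f zero <ᵇ f (suc zero)) _ eq)) _) ,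
      <ᵇ≡true⇒< _ _ (Bool.∧-conicalˡ _ _ eq) , λ { zero _ → ℕ.≤-refl }
    later : (∃ λ i → h ⊔ f zero ≤ f (suc i) × Foremax (f ∘ suc) M i) → ∃ λ i → h ≤ f i × Foremax f M i
    later (i , h⊔≤ , asc , max) = suc i , ℕ.m⊔n≤o⇒m≤o h _ h⊔≤ , asc ,
      λ { zero _ → ℕ.m⊔n≤o⇒n≤o h _ h⊔≤ ; (suc j) (s≤s j≤i) → max j j≤i }

  coderangement-letters : ∀ {n} (π : Word n) → does (coderangement? π) ≡ coderangementᴸ (letters π)
  coderangement-letters {zero}  π = does-⇔ (coderangement? π) (λ _ → refl) (λ { _ (() , _) })
  coderangement-letters {suc n} π = does-⇔ (coderangement? π) to from
    where
    to : Coderangement π → coderangementᴸ (letters π) ≡ true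
    to ¬fm with coderangementᴸ (letters π) in eq
    ... | true  = refl
    ... | false =
      let i , _ , fm = coderAbove-false (values π zero) (values π) (suc n) (λ i → Fin.toℕ<n (lookup π i)) eq
      in  contradiction (i , foremaximum⁺ π i fm) ¬fm
    from : coderangementᴸ (letters π) ≡ true → Coderangement π
    from eq (i , fm) = coderAbove-true (values π zero) (values π) (suc n) eq i
      (proj₂ (foremaximum⁻ π i fm) zero z≤n) (foremaximum⁻ π i fm)

  -- A first letter followed by a larger one is a foremaximum, so π(1) > π(2); a later letter above
  -- π(1) would then complete an occurrence of 213.
  coderangement⇒max : ∀ {n} {π : Word (suc (suc n))} → Uniqueⱽ π → ¬ Contains p213 π → Coderangement π →
    ∀ j → values π j ≤ values π zero
  coderangement⇒max {n} {π} u av ¬fm = below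
    where
    π₁<π₀ : values π (suc zero) < values π zero
    π₁<π₀ = ℕ.≤∧≢⇒<
      (ℕ.≮⇒≥ λ asc → ¬fm (zero , foremaximum⁺ π zero (asc , λ { zero _ → ℕ.≤-refl })))
      (λ eq → Fin.0≢1+n (sym (values-injective u eq)))
    below : ∀ j → values π j ≤ values π zero
    below zero          = ℕ.≤-refl
    below (suc zero)    = ℕ.<⇒≤ π₁<π₀
    below (suc (suc j)) = ℕ.≮⇒≥ λ π₀<πⱼ →
      av (contains213⁺ π (zero , suc zero , suc (suc j) , s≤s z≤n , s≤s (s≤s z≤n) , π₁<π₀ , π₀<πⱼ))

  -- A later foremaximum would have to equal the first letter, and the first letter is followed by a
  -- descent.
  max⇒coderangement : ∀ {n} {π : Word (suc (suc n))} → Uniqueⱽ π → (∀ j → values π j ≤ values π zero) → Coderangement π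
  max⇒coderangement {n} {π} u max (zero , fm) = ℕ.<⇒≱ (proj₁ (foremaximum⁻ π zero fm)) (max (suc zero))
  max⇒coderangement {n} {π} u max (suc i , fm) =
    Fin.0≢1+n (values-injective u (ℕ.≤-antisym (proj₂ (foremaximum⁻ π (suc i) fm) zero z≤n) (max (suc i))))

  endsInZero-tabulate : ∀ {n} (f : Fin (suc n) → ℕ) → endsInZero (List.tabulate f) ≡ (f (fromℕ n) ≡ᵇ 0)
  endsInZero-tabulate {zero}  f = refl
  endsInZero-tabulate {suc n} f = endsInZero-tabulate (f ∘ suc)

  -- For 213-avoiders of length at least 2, being a coderangement means starting with the maximum;
  -- reverse-complement turns a maximum in front into a 0 at the end.
  coderangement-reverseComplement : ∀ {n} {ρ : Word (suc (suc n))} → ρ ∈ 𝔖 (suc (suc n)) p132 →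
    does (coderangement? (reverseComplement ρ)) ≡ endsInZero (letters ρ)
  coderangement-reverseComplement {n} {ρ} ρ∈ = does-⇔ (coderangement? π) to from
    where
    π : Word (suc (suc n))
    π = reverseComplement ρ
    ρ-perm = words132-sound (∈.∈-map⁺ letters {xs = 𝔖 (suc (suc n)) p132} ρ∈)
    π-good = ∈𝔖⁻ (suc (suc n)) p213 (∈-resp-↭ (↭-sym (𝔖213↭ (suc (suc n)))) (∈.∈-map⁺ reverseComplement {xs = 𝔖 (suc (suc n)) p132} ρ∈))
    last : Fin (suc (suc n))
    last = fromℕ (suc n)
    πⱼ≡ : ∀ j → values π j ≡ toℕ (opposite (lookup ρ (opposite j)))
    πⱼ≡ = values-transform opposite opposite ρ
    to : Coderangement π → endsInZero (letters ρ) ≡ true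
    -- ρ takes the value 0 at some position k. Were the last letter of ρ positive, the letter of π
    -- opposite to k would exceed the first letter of π.
    to coder with ∈.∈-tabulate⁻ (Unique⇒covers (length≡ ρ-perm) (bounded ρ-perm) (unique ρ-perm) {0} (s≤s z≤n))
    ... | k , 0≡ρₖ = trans (endsInZero-tabulate (values ρ)) (≡⇒≡ᵇ≡true (ℕ.n≤0⇒n≡0
      (ℕ.≮⇒≥ λ 0<ρ-last → ℕ.<⇒≱ (opposite-<⁺ {i = lookup ρ k} {lookup ρ last} (subst (_< values ρ last) 0≡ρₖ 0<ρ-last))
        (subst₂ _≤_ (trans (πⱼ≡ (opposite k)) (cong (λ i → toℕ (opposite (lookup ρ i))) (Fin.opposite-involutive k))) (πⱼ≡ zero)
          (coderangement⇒max (proj₁ π-good) (proj₂ π-good) coder (opposite k))))))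
    from : endsInZero (letters ρ) ≡ true → Coderangement π
    from eq = max⇒coderangement (proj₁ π-good) λ j → subst₂ _≤_ (sym (πⱼ≡ j)) (sym (πⱼ≡ zero))
      (ℕ.≮⇒≥ λ lt → ℕ.n≮0 (subst (values ρ (opposite j) <_) ρ-last≡0
        (opposite-<⁻ {i = lookup ρ (opposite j)} {lookup ρ last} lt)))
      where
      ρ-last≡0 : values ρ last ≡ 0
      ρ-last≡0 = ≡ᵇ≡true⇒≡ _ _ (trans (sym (endsInZero-tabulate (values ρ))) eq)

  -- Alternating words

  DownUp UpDown : ∀ {n} → (Fin n → ℕ) → Set
  DownUp f = ∀ i i⁺ → i ⋖ i⁺ → (parity (toℕ i) ≡ 0ℙ → f i⁺ < f i) × (parity (toℕ i) ≡ 1ℙ → f i < f i⁺)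
  UpDown f = ∀ i i⁺ → i ⋖ i⁺ → (parity (toℕ i) ≡ 0ℙ → f i < f i⁺) × (parity (toℕ i) ≡ 1ℙ → f i⁺ < f i)

  parity-pred : ∀ {p} n → parity (suc n) ≡ p → parity n ≡ p ℙ.⁻¹
  parity-pred zero          refl = refl
  parity-pred (suc zero)    refl = refl
  parity-pred (suc (suc n)) eq   = parity-pred n eq

  parity-+-even : ∀ a b → parity (a + b) ≡ 0ℙ → parity a ≡ parity b
  parity-+-even zero          b eq = sym eq
  parity-+-even (suc zero)    b eq = sym (parity-pred b eq)
  parity-+-even (suc (suc a)) b eq = parity-+-even a b eq

  -- Dropping the first letter shifts every position by one and so exchanges the two parity
  -- conditions; hence the mutual recursion.
  downUp-tabulate⁻ : ∀ {n} (f : Fin n → ℕ) → downUp (List.tabulate f) ≡ true → DownUp f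
  upDown-tabulate⁻ : ∀ {n} (f : Fin n → ℕ) → upDown (List.tabulate f) ≡ true → UpDown f
  downUp-tabulate⁻ {suc (suc n)} f eq zero    (suc zero) _    = (λ _ → <ᵇ≡true⇒< _ _ (Bool.∧-conicalˡ _ _ eq)) , λ ()
  downUp-tabulate⁻ {suc (suc n)} f eq (suc i) (suc i⁺)   i⋖i⁺ =
    let p , q = upDown-tabulate⁻ (f ∘ suc) (Bool.∧-conicalʳ (f (suc zero) <ᵇ f zero) _ eq) i i⁺ (ℕ.suc-injective i⋖i⁺)
    in  q ∘ parity-pred (toℕ i) , p ∘ parity-pred (toℕ i)
  upDown-tabulate⁻ {suc (suc n)} f eq zero    (suc zero) _    = (λ _ → <ᵇ≡true⇒< _ _ (Bool.∧-conicalˡ _ _ eq)) , λ ()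
  upDown-tabulate⁻ {suc (suc n)} f eq (suc i) (suc i⁺)   i⋖i⁺ =
    let p , q = downUp-tabulate⁻ (f ∘ suc) (Bool.∧-conicalʳ (f zero <ᵇ f (suc zero)) _ eq) i i⁺ (ℕ.suc-injective i⋖i⁺)
    in  q ∘ parity-pred (toℕ i) , p ∘ parity-pred (toℕ i)
  upDown-tabulate⁻ {suc zero} f eq zero zero ()

  parity-suc⁺ : ∀ {p} n → parity n ≡ p → parity (suc n) ≡ p ℙ.⁻¹
  parity-suc⁺ n eq = trans (parity-suc n) (cong ℙ._⁻¹ eq)

  downUp-tabulate⁺ : ∀ {n} (f : Fin n → ℕ) → parity n ≡ 0ℙ → DownUp f → downUp (List.tabulate f) ≡ true
  upDown-tabulate⁺ : ∀ {n} (f : Fin n → ℕ) → parity n ≡ 1ℙ → UpDown f → upDown (List.tabulate f) ≡ true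
  downUp-tabulate⁺ {zero}        f _    _   = refl
  downUp-tabulate⁺ {suc (suc n)} f even alt = cong₂ _∧_
    (<⇒<ᵇ≡true (proj₁ (alt zero (suc zero) refl) refl))
    (upDown-tabulate⁺ (f ∘ suc) (parity-pred (suc n) even) λ i i⁺ i⋖i⁺ →
      let p , q = alt (suc i) (suc i⁺) (cong suc i⋖i⁺) in q ∘ parity-suc⁺ (toℕ i) , p ∘ parity-suc⁺ (toℕ i))
  upDown-tabulate⁺ {suc zero}    f _   _   = refl
  upDown-tabulate⁺ {suc (suc n)} f odd alt = cong₂ _∧_
    (<⇒<ᵇ≡true (proj₁ (alt zero (suc zero) refl) refl))
    (downUp-tabulate⁺ (f ∘ suc) (parity-pred (suc n) odd) λ i i⁺ i⋖i⁺ →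
      let p , q = alt (suc i) (suc i⁺) (cong suc i⋖i⁺) in q ∘ parity-suc⁺ (toℕ i) , p ∘ parity-suc⁺ (toℕ i))

  -- The two positions add up to n - 2. For even n the mirror image of a step therefore starts at
  -- the same parity, and an up-down word is reversed into a down-up word.
  parity-opposite : ∀ {n} {i i⁺ : Fin n} → parity n ≡ 0ℙ → i ⋖ i⁺ → parity (toℕ (opposite i⁺)) ≡ parity (toℕ i)
  parity-opposite {n} {i} {i⁺} even i⋖i⁺ = parity-+-even (toℕ (opposite i⁺)) (suc (suc (toℕ i)))
    (trans (cong parity (trans (cong₂ _+_ (Fin.opposite-prop i⁺) (cong suc i⋖i⁺)) (ℕ.m∸n+n≡m (Fin.toℕ<n i⁺)))) even)

  alternating-reversal : ∀ {n} (ρ : Word n) → parity n ≡ 0ℙ → does (alternating? (reversal ρ)) ≡ downUp (letters ρ)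
  alternating-reversal {n} ρ even = does-⇔ (alternating? (reversal ρ))
    (λ alt → downUp-tabulate⁺ (values ρ) even (to alt)) (from ∘ downUp-tabulate⁻ (values ρ))
    where
    πᵢ≡ : ∀ i → values (reversal ρ) i ≡ values ρ (opposite i)
    πᵢ≡ = values-transform opposite id ρ
    πᵢ≡′ : ∀ i → values (reversal ρ) (opposite i) ≡ values ρ i
    πᵢ≡′ i = trans (πᵢ≡ (opposite i)) (cong (values ρ) (Fin.opposite-involutive i))
    to : Alternating (reversal ρ) → DownUp (values ρ)
    to alt i i⁺ i⋖i⁺ =
      let p , q = alt (opposite i⁺) (opposite i) (opposite-⋖⁺ i⋖i⁺)
          eq    = parity-opposite even i⋖i⁺
      in  (λ par → subst₂ _<_ (πᵢ≡′ i⁺) (πᵢ≡′ i) (p (trans eq par)))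
        , (λ par → subst₂ _<_ (πᵢ≡′ i) (πᵢ≡′ i⁺) (q (trans eq par)))
    from : DownUp (values ρ) → Alternating (reversal ρ)
    from alt i i⁺ i⋖i⁺ =
      let p , q = alt (opposite i⁺) (opposite i) (opposite-⋖⁺ i⋖i⁺)
          eq    = parity-opposite even i⋖i⁺
      in  (λ par → subst₂ _<_ (sym (πᵢ≡ i)) (sym (πᵢ≡ i⁺)) (p (trans eq par)))
        , (λ par → subst₂ _<_ (sym (πᵢ≡ i⁺)) (sym (πᵢ≡ i)) (q (trans eq par)))

open Words

-- Sums over lists in a commutative ring

module Sums {c ℓ} (R : CommutativeRing c ℓ) where

  open CommutativeRing R
  open PowerSeries R
  open CommutativeSemigroupProperties +-commutativeSemigroup using (interchange; x∙yz≈y∙xz)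
  open SetoidReasoning setoid

  sumOver : {A : Set} → List A → (A → Carrier) → Carrier
  sumOver xs f = foldr _+_ 0# (map f xs)

  χ : Bool → Carrier
  χ false = 0#
  χ true  = 1#

  module _ {A : Set} where

    sumOver-cong : ∀ (xs : List A) {f g} → (∀ {x} → x ∈ xs → f x ≈ g x) → sumOver xs f ≈ sumOver xs g
    sumOver-cong []       eq = refl
    sumOver-cong (x ∷ xs) eq = +-cong (eq (here ≡.refl)) (sumOver-cong xs (eq ∘ there))

    sumOver-↭ : ∀ {xs ys : List A} f → xs ↭ ys → sumOver xs f ≈ sumOver ys f
    sumOver-↭ f _↭_.refl           = refl
    sumOver-↭ f (_↭_.prep x p)     = +-congˡ (sumOver-↭ f p)
    sumOver-↭ f (_↭_.swap x y p)   = trans (+-congˡ (+-congˡ (sumOver-↭ f p))) (x∙yz≈y∙xz _ _ _)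
    sumOver-↭ f (_↭_.trans p r)    = trans (sumOver-↭ f p) (sumOver-↭ f r)

    sumOver-map : ∀ {B : Set} (g : B → A) xs f → sumOver (map g xs) f ≡ sumOver xs (f ∘ g)
    sumOver-map g xs f = ≡.cong (foldr _+_ 0#) (≡.sym (List.map-∘ xs))

    sumOver-++ : ∀ (xs : List A) {ys} f → sumOver (xs ++ ys) f ≈ sumOver xs f + sumOver ys f
    sumOver-++ []       f = sym (+-identityˡ _)
    sumOver-++ (x ∷ xs) f = trans (+-congˡ (sumOver-++ xs f)) (sym (+-assoc _ _ _))

    sumOver-*ˡ : ∀ (xs : List A) a f → sumOver xs (λ x → a * f x) ≈ a * sumOver xs f
    sumOver-*ˡ []       a f = sym (zeroʳ a)
    sumOver-*ˡ (x ∷ xs) a f = trans (+-congˡ (sumOver-*ˡ xs a f)) (sym (distribˡ a _ _))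

    sumOver-+ : ∀ (xs : List A) f g → sumOver xs (λ x → f x + g x) ≈ sumOver xs f + sumOver xs g
    sumOver-+ []       f g = sym (+-identityˡ 0#)
    sumOver-+ (x ∷ xs) f g = trans (+-congˡ (sumOver-+ xs f g)) (interchange _ _ _ _)

    sumOver-0 : ∀ (xs : List A) {f} → (∀ {x} → x ∈ xs → f x ≈ 0#) → sumOver xs f ≈ 0#
    sumOver-0 []       eq = refl
    sumOver-0 (x ∷ xs) eq = trans (+-cong (eq (here ≡.refl)) (sumOver-0 xs (eq ∘ there))) (+-identityˡ 0#)

    sumOver-filter : ∀ {P : A → Set} (P? : ∀ x → Dec (P x)) xs f →
      sumOver (filter P? xs) f ≈ sumOver xs (λ x → χ (does (P? x)) * f x)
    sumOver-filter P? []       f = refl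
    sumOver-filter P? (x ∷ xs) f with does (P? x)
    ... | true  = +-cong (sym (*-identityˡ _)) (sumOver-filter P? xs f)
    ... | false = trans (sumOver-filter P? xs f) (sym (trans (+-congʳ (zeroˡ _)) (+-identityˡ _)))

  sumOver-cartesianProduct : ∀ {A B : Set} (xs : List A) (ys : List B) f g →
    sumOver (cartesianProduct xs ys) (λ (x , y) → f x * g y) ≈ sumOver xs f * sumOver ys g
  sumOver-cartesianProduct []       ys f g = sym (zeroˡ _)
  sumOver-cartesianProduct (x ∷ xs) ys f g = begin
    sumOver (map (x ,_) ys ++ cartesianProduct xs ys) h
      ≈⟨ sumOver-++ (map (x ,_) ys) h ⟩
    sumOver (map (x ,_) ys) h + sumOver (cartesianProduct xs ys) h
      ≈⟨ +-cong (trans (reflexive (sumOver-map (x ,_) ys h)) (sumOver-*ˡ ys (f x) g))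
                (sumOver-cartesianProduct xs ys f g) ⟩
    f x * sumOver ys g + sumOver xs f * sumOver ys g
      ≈⟨ distribʳ _ _ _ ⟨
    (f x + sumOver xs f) * sumOver ys g ∎
    where
    h : _ → Carrier
    h (x , y) = f x * g y

  sumOver-convolution : ∀ {A B : Set} (F : ℕ → List A) (G : ℕ → List B) f g n →
    sumOver (convolution F G n) (λ (x , y) → f x * g y) ≈
    ((λ i → sumOver (F i) f) ⊛ (λ j → sumOver (G j) g)) n
  sumOver-convolution F G f g zero    = sumOver-cartesianProduct (F 0) (G 0) f g
  sumOver-convolution F G f g (suc n) = trans
    (sumOver-++ (cartesianProduct (F 0) (G (suc n))) _)
    (+-cong (sumOver-cartesianProduct (F 0) (G (suc n)) f g) (sumOver-convolution (F ∘ suc) G f g n))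

-- Generating functions over an enumeration of the 132-avoiders

module Enumeration
  (W : ℕ → List (List ℕ))
  (W-unique : ∀ n → Unique (W n))
  (W-sound : ∀ {n w} → w ∈ W n → Perm132 n w)
  (W-complete : ∀ {n w} → Perm132 n w → w ∈ W n)
  where

  W-zero : W 0 ↭ [] ∷ []
  W-zero = Unique∧⇔⇒↭ (W-unique 0) ([] ∷ [])
    (λ w∈ → here (empty (length≡ (W-sound w∈))))
    (λ { (here ≡.refl) → W-complete (perm132 ≡.refl [] [] []) })
    where
    empty : ∀ {w : List ℕ} → length w ≡ 0 → w ≡ []
    empty {[]} _ = ≡.refl

  -- The Catalan decomposition: gluing is injective on pairs of total length n, and every
  -- 132-avoider of length n + 1 arises in this way.
  W-suc : ∀ n → W (suc n) ↭ map (uncurry glue) (convolution W W n)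
  W-suc n = Unique∧⇔⇒↭ (W-unique (suc n))
    (Unique-map⁺-local injective
      (convolution-unique W W W-unique W-unique
        (λ p r → ≡.trans (≡.sym (length≡ (W-sound p))) (length≡ (W-sound r))) n))
    to from
    where
    injective : ∀ {x y} → x ∈ convolution W W n → y ∈ convolution W W n →
      uncurry glue x ≡ uncurry glue y → x ≡ y
    injective p r eq =
      let i , j , s , α∈ , β∈     = ∈-convolution⁻ W W n p
          i′ , j′ , s′ , α′∈ , β′∈ = ∈-convolution⁻ W W n r
          α≡α′ , β≡β′ = glue-injective s s′ (W-sound α∈) (W-sound β∈) (W-sound α′∈) (W-sound β′∈) eq
      in ≡.cong₂ _,_ α≡α′ β≡β′
    to : ∀ {w} → w ∈ W (suc n) → w ∈ map (uncurry glue) (convolution W W n)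
    to w∈ with perm132⇒glued (W-sound w∈)
    ... | glued {i} {j} ≡.refl pα pβ ≡.refl =
      ∈.∈-map⁺ (uncurry glue) (∈-convolution⁺ W W i j (W-complete pα) (W-complete pβ))
    from : ∀ {w} → w ∈ map (uncurry glue) (convolution W W n) → w ∈ W (suc n)
    from w∈ with ∈.∈-map⁻ (uncurry glue) w∈
    ... | _ , p , ≡.refl with ∈-convolution⁻ W W n p
    ... | i , j , ≡.refl , α∈ , β∈ = W-complete (glue-perm132 (W-sound α∈) (W-sound β∈))

  module GeneratingFunctions {c ℓ} (R : CommutativeRing c ℓ) where

    open CommutativeRing R
    open PowerSeries R
    open SeriesEquations R
    open Sums R
    open CommutativeSemiringExp commutativeSemiring
    open CommutativeSemigroupProperties *-commutativeSemigroup using (interchange)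
    open SetoidReasoning setoid

    Weight : Set _
    Weight = List ℕ → Carrier

    gf : Weight → Series
    gf f n = sumOver (W n) f

    gf-cong : ∀ {f g} → (∀ {n w} → Perm132 n w → f w ≈ g w) → gf f ≋ gf g
    gf-cong eq n = sumOver-cong (W n) (eq ∘ W-sound)

    gf-zero : ∀ f → gf f 0 ≈ f []
    gf-zero f = trans (sumOver-↭ f W-zero) (+-identityʳ _)

    gf-suc : ∀ f a b → (∀ {i j α β} → Perm132 i α → Perm132 j β → f (glue α β) ≈ a α * b β) →
      ∀ n → gf f (suc n) ≈ (gf a ⊛ gf b) n
    gf-suc f a b eq n = begin
      sumOver (W (suc n)) f                                       ≈⟨ sumOver-↭ f (W-suc n) ⟩
      sumOver (map (uncurry glue) (convolution W W n)) f
        ≡⟨ sumOver-map (uncurry glue) (convolution W W n) f ⟩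
      sumOver (convolution W W n) (f ∘ uncurry glue)              ≈⟨ sumOver-cong (convolution W W n) local ⟩
      sumOver (convolution W W n) (λ (α , β) → a α * b β)         ≈⟨ sumOver-convolution W W a b n ⟩
      (gf a ⊛ gf b) n                                             ∎
      where
      local : ∀ {x} → x ∈ convolution W W n → f (uncurry glue x) ≈ a (proj₁ x) * b (proj₂ x)
      local p = let _ , _ , _ , α∈ , β∈ = ∈-convolution⁻ W W n p in eq (W-sound α∈) (W-sound β∈)

    δ : Weight
    δ w = χ (null w)

    gf-+ : ∀ f g → gf (λ w → f w + g w) ≋ gf f ⊕ gf g
    gf-+ f g n = sumOver-+ (W n) f g

    gf-· : ∀ a f → gf (λ w → a * f w) ≋ a · gf f
    gf-· a f n = sumOver-*ˡ (W n) a f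

    gf-δ : gf δ ≋ 𝟙
    gf-δ zero    = gf-zero δ
    gf-δ (suc n) = sumOver-0 (W (suc n)) λ {w} w∈ → nonzero w (length≡ (W-sound w∈))
      where
      nonzero : ∀ w → length w ≡ suc n → δ w ≈ 0#
      nonzero (_ ∷ _) _ = refl

    gf-dilate : ∀ p f → gf (λ w → p ^ length w * f w) ≋ dilate p (gf f)
    gf-dilate p f n = trans
      (sumOver-cong (W n) (λ w∈ → *-congʳ (^-congʳ p (length≡ (W-sound w∈)))))
      (sumOver-*ˡ (W n) (p ^ n) f)

    gf-product-eq : ∀ {f₀} t p f a b → f [] ≈ f₀ →
      (∀ {i j α β} → Perm132 i α → Perm132 j β → f (glue α β) ≈ t * ((p ^ length α * a α) * b β)) →
      gf f ≋ f₀ ∷ˢ t · (dilate p (gf a) ⊛ gf b)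
    gf-product-eq t p f a b f[] eq zero    = trans (gf-zero f) f[]
    gf-product-eq t p f a b f[] eq (suc n) = begin
      gf f (suc n)                                     ≈⟨ gf-suc f _ b (λ pα pβ → trans (eq pα pβ) (sym (*-assoc _ _ _))) n ⟩
      (gf (λ w → t * (p ^ length w * a w)) ⊛ gf b) n
        ≈⟨ ⊛-cong≤ _ _ (gf b) (gf b) n (λ k _ → trans (gf-· t _ k) (*-congˡ (gf-dilate p a k))) (λ _ _ → refl) ⟩
      ((t · dilate p (gf a)) ⊛ gf b) n                 ≈⟨ ⊛-scale t (dilate p (gf a)) (gf b) n ⟩
      t * (dilate p (gf a) ⊛ gf b) n                   ∎

    -- The term with `δ β` carries the words that end in their maximum, where the descent out of m
    -- is missing and the weight obeys a different rule.
    gf-affine-eq : ∀ t p f d a b → f [] ≈ 0# →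
      (∀ {i j α β} → Perm132 i α → Perm132 j β → f (glue α β) ≈ d α * δ β + t * ((p ^ length α * a α) * b β)) →
      gf f ≋ 0# ∷ˢ gf d ⊕ t · (dilate p (gf a) ⊛ gf b)
    gf-affine-eq t p f d a b f[] eq zero    = trans (gf-zero f) f[]
    gf-affine-eq t p f d a b f[] eq (suc n) = begin
      sumOver (W (suc n)) f                                       ≈⟨ sumOver-↭ f (W-suc n) ⟩
      sumOver (map (uncurry glue) (convolution W W n)) f
        ≡⟨ sumOver-map (uncurry glue) (convolution W W n) f ⟩
      sumOver (convolution W W n) (f ∘ uncurry glue)              ≈⟨ sumOver-cong (convolution W W n) local ⟩
      sumOver (convolution W W n) (λ (α , β) → d α * δ β + t * (p ^ length α * a α) * b β)
        ≈⟨ sumOver-+ (convolution W W n) _ _ ⟩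
      sumOver (convolution W W n) (λ (α , β) → d α * δ β) +
      sumOver (convolution W W n) (λ (α , β) → t * (p ^ length α * a α) * b β)
        ≈⟨ +-cong (sumOver-convolution W W d δ n) (sumOver-convolution W W _ b n) ⟩
      (gf d ⊛ gf δ) n + (gf (λ w → t * (p ^ length w * a w)) ⊛ gf b) n
        ≈⟨ +-cong (⊛-cong≤ (gf d) (gf d) _ _ n (λ _ _ → refl) (λ k _ → gf-δ k))
                  (⊛-cong≤ _ _ (gf b) (gf b) n (λ k _ → trans (gf-· t _ k) (*-congˡ (gf-dilate p a k))) (λ _ _ → refl)) ⟩
      (gf d ⊛ 𝟙) n + ((t · dilate p (gf a)) ⊛ gf b) n
        ≈⟨ +-cong (CommutativeRing.*-identityʳ commutativeRing (gf d) n) (⊛-scale t (dilate p (gf a)) (gf b) n) ⟩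
      gf d n + t * (dilate p (gf a) ⊛ gf b) n                     ∎
      where
      local : ∀ {x} → x ∈ convolution W W n → f (uncurry glue x) ≈
        d (proj₁ x) * δ (proj₂ x) + t * (p ^ length (proj₁ x) * a (proj₁ x)) * b (proj₂ x)
      local r = let _ , _ , _ , α∈ , β∈ = ∈-convolution⁻ W W n r in
        trans (eq (W-sound α∈) (W-sound β∈)) (+-congˡ (sym (*-assoc _ _ _)))

    -- Functional equations of the weighted generating functions

    module Weights (q : Carrier) where

      open RingProperties ring using (-1*x≈-x)
      open SemiringSolver commutativeSemiring using (solve; con; _:=_; _:+_; _:*_)

      des·2-31 des·2-13 des·31-2 des·31-2⁺ : Carrier → Weight
      des·2-31  t w = t ^ desᴸ w * q ^ 2-31ᴸ w
      des·2-13  t w = t ^ desᴸ w * q ^ 2-13ᴸ w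
      des·31-2  t w = t ^ desᴸ w * q ^ 31-2ᴸ w
      des·31-2⁺ t w = t ^ desᴸ w * q ^ 31-2⁺ w

      infixr 7 _⊙_

      _⊙_ : (List ℕ → Bool) → Weight → Weight
      (b ⊙ f) w = χ (b w) * f w

      χ-∧ : ∀ a b → χ (a ∧ b) ≈ χ a * χ b
      χ-∧ false b = sym (zeroˡ _)
      χ-∧ true  b = sym (*-identityˡ _)

      1^n*x≈x : ∀ n x → 1# ^ n * x ≈ x
      1^n*x≈x zero    x = *-identityˡ x
      1^n*x≈x (suc n) x = trans (*-congʳ (*-identityˡ _)) (1^n*x≈x n x)

      dilate-1 : ∀ f → dilate 1# f ≋ f
      dilate-1 f n = 1^n*x≈x n (f n)

      δ+nonempty : ∀ f → f [] ≈ 1# → gf f ≋ 𝟙 ⊕ gf (nonempty ⊙ f)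
      δ+nonempty f f[] n = trans (gf-cong {f} {λ w → δ w + (nonempty ⊙ f) w} (λ {_} {w} _ → split w) n)
        (trans (gf-+ δ (nonempty ⊙ f) n) (+-congʳ (gf-δ n)))
        where
        split : ∀ w → f w ≈ δ w + (nonempty ⊙ f) w
        split []      = trans f[] (sym (trans (+-congˡ (zeroˡ _)) (+-identityʳ _)))
        split (_ ∷ _) = sym (trans (+-identityˡ _) (*-identityˡ _))

      ^-distrib-suc : ∀ x a b → x ^ (a ℕ.+ (b ℕ.+ 1)) ≈ x ^ a * (x ^ b * x)
      ^-distrib-suc x a b = trans (^-homo-* x a (b ℕ.+ 1)) (*-congˡ (trans (^-homo-* x b 1) (*-congˡ (*-identityʳ x))))

      module _ {i j α β} (pα : Perm132 i α) (pβ : Perm132 j β) where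

        q^2-31-glue : nonempty β ≡ true → q ^ 2-31ᴸ (glue α β) ≈ q ^ length α * q ^ 2-31ᴸ α * q ^ 2-31ᴸ β
        q^2-31-glue ne = begin
          q ^ 2-31ᴸ (glue α β)
            ≈⟨ ^-congʳ q (≡.trans (2-31ᴸ-glue pα pβ) (≡.cong (λ b → 2-31ᴸ α ℕ.+ (2-31ᴸ β ℕ.+ length α ℕ.* ⟦ b ⟧)) ne)) ⟩
          q ^ (2-31ᴸ α ℕ.+ (2-31ᴸ β ℕ.+ length α ℕ.* 1))
            ≈⟨ trans (^-homo-* q (2-31ᴸ α) _) (*-congˡ (trans (^-homo-* q (2-31ᴸ β) _) (*-congˡ (^-congʳ q (ℕ.*-identityʳ (length α)))))) ⟩
          q ^ 2-31ᴸ α * (q ^ 2-31ᴸ β * q ^ length α)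
            ≈⟨ solve 3 (λ a b c → a :* (b :* c) := c :* a :* b) refl _ _ _ ⟩
          q ^ length α * q ^ 2-31ᴸ α * q ^ 2-31ᴸ β ∎

        t^des-glue : ∀ t → nonempty β ≡ true → t ^ desᴸ (glue α β) ≈ t ^ desᴸ α * (t ^ desᴸ β * t)
        t^des-glue t ne = trans
          (^-congʳ t (≡.trans (desᴸ-glue pα pβ) (≡.cong (λ b → desᴸ α ℕ.+ (desᴸ β ℕ.+ ⟦ b ⟧)) ne)))
          (^-distrib-suc t (desᴸ α) (desᴸ β))

        des·2-31-glue : ∀ t → nonempty β ≡ true →
          des·2-31 t (glue α β) ≈ t * ((q ^ length α * des·2-31 t α) * des·2-31 t β)
        des·2-31-glue t ne = trans (*-cong (t^des-glue t ne) (q^2-31-glue ne))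
          (solve 6 (λ t a b l c d → (a :* (b :* t)) :* (l :* c :* d) := t :* ((l :* (a :* c)) :* (b :* d))) refl t _ _ _ _ _)

      des·2-31-glue-[] : ∀ {i α} t → Perm132 i α → des·2-31 t (glue α []) ≈ des·2-31 t α
      des·2-31-glue-[] {α = α} t pα = *-cong
        (^-congʳ t (≡.trans (desᴸ-glue pα p[]) (ℕ.+-identityʳ _)))
        (^-congʳ q (≡.trans (2-31ᴸ-glue pα p[]) (≡.trans (≡.cong (2-31ᴸ α ℕ.+_) (ℕ.*-zeroʳ (length α))) (ℕ.+-identityʳ _))))
        where
        p[] : Perm132 0 []
        p[] = perm132 ≡.refl [] [] []

      -- An empty right block leaves the weight of the left block unchanged; a nonempty one adds a
      -- descent, the factor t, and one 2-31 for each letter on the left, the substitution z ↦ qz.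
      des·2-31-eq : ∀ t → let f = gf (nonempty ⊙ des·2-31 t) in
        f ≋ 0# ∷ˢ (𝟙 ⊕ f) ⊕ t · (dilate q (𝟙 ⊕ f) ⊛ f)
      des·2-31-eq t n = trans (eq n) (fold n)
        where
        F f : Series
        F = gf (des·2-31 t)
        f = gf (nonempty ⊙ des·2-31 t)
        F≋𝟙⊕f : F ≋ 𝟙 ⊕ f
        F≋𝟙⊕f = δ+nonempty (des·2-31 t) (*-identityˡ 1#)
        step : ∀ {i j α β} → Perm132 i α → Perm132 j β → (nonempty ⊙ des·2-31 t) (glue α β) ≈
          des·2-31 t α * δ β + t * ((q ^ length α * des·2-31 t α) * (nonempty ⊙ des·2-31 t) β)
        step {α = α} {[]} pα pβ = begin
          χ (nonempty (glue α [])) * des·2-31 t (glue α [])  ≈⟨ *-cong (reflexive (≡.cong χ (nonempty-glue α []))) (des·2-31-glue-[] t pα) ⟩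
          1# * des·2-31 t α
            ≈⟨ solve 4 (λ a l t d → con 1 :* a := a :* con 1 :+ t :* ((l :* a) :* (con 0 :* d))) refl _ (q ^ length α) t (des·2-31 t []) ⟩
          des·2-31 t α * 1# + t * ((q ^ length α * des·2-31 t α) * (0# * des·2-31 t [])) ∎
        step {α = α} {β@(y ∷ _)} pα pβ = begin
          χ (nonempty (glue α β)) * des·2-31 t (glue α β)  ≈⟨ *-cong (reflexive (≡.cong χ (nonempty-glue α β))) (des·2-31-glue pα pβ t ≡.refl) ⟩
          1# * (t * ((q ^ length α * des·2-31 t α) * des·2-31 t β))
            ≈⟨ solve 4 (λ a l t d → con 1 :* (t :* ((l :* a) :* d)) := a :* con 0 :+ t :* ((l :* a) :* (con 1 :* d))) refl (des·2-31 t α) (q ^ length α) t (des·2-31 t β) ⟩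
          des·2-31 t α * 0# + t * ((q ^ length α * des·2-31 t α) * (1# * des·2-31 t β)) ∎
        eq : f ≋ 0# ∷ˢ F ⊕ t · (dilate q F ⊛ f)
        eq = gf-affine-eq t q _ (des·2-31 t) (des·2-31 t) (nonempty ⊙ des·2-31 t) (zeroˡ _) step
        fold : (0# ∷ˢ F ⊕ t · (dilate q F ⊛ f)) ≋ (0# ∷ˢ (𝟙 ⊕ f) ⊕ t · (dilate q (𝟙 ⊕ f) ⊛ f))
        fold zero    = refl
        fold (suc n) = +-cong (F≋𝟙⊕f n)
          (*-congˡ (⊛-cong≤ _ _ f f n (λ k _ → *-congˡ (F≋𝟙⊕f k)) (λ _ _ → refl)))

      -- The block α with m appended contributes (2-31) + des of α to 2-13, so the sign (-1)^des and
      -- the new q^des merge into (-q)^des. A nonempty β brings the sign of the descent out of m.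
      des·2-13-glue : ∀ {i j α β} → Perm132 i α → Perm132 j β →
        des·2-13 (- 1#) (glue α β) ≈ des·2-31 (- q) α * (δ β + - 1# * (nonempty ⊙ des·2-13 (- 1#)) β)
      des·2-13-glue {α = α} {β} pα pβ = begin
        (- 1#) ^ desᴸ (glue α β) * q ^ 2-13ᴸ (glue α β)
          ≈⟨ *-cong (trans (^-congʳ (- 1#) (desᴸ-glue pα pβ)) (^-homo-* (- 1#) (desᴸ α) _))
                    (trans (^-congʳ q (2-13ᴸ-glue pα pβ)) (trans (^-homo-* q (2-31ᴸ α ℕ.+ desᴸ α) _) (*-congʳ (^-homo-* q (2-31ᴸ α) _)))) ⟩
        ((- 1#) ^ desᴸ α * (- 1#) ^ (desᴸ β ℕ.+ ⟦ nonempty β ⟧)) * ((q ^ 2-31ᴸ α * q ^ desᴸ α) * q ^ 2-13ᴸ β)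
          ≈⟨ solve 5 (λ a b c d e → (a :* b) :* ((c :* d) :* e) := ((a :* d) :* c) :* (b :* e)) refl _ _ _ _ _ ⟩
        ((- 1#) ^ desᴸ α * q ^ desᴸ α) * q ^ 2-31ᴸ α * ((- 1#) ^ (desᴸ β ℕ.+ ⟦ nonempty β ⟧) * q ^ 2-13ᴸ β)
          ≈⟨ *-cong (*-congʳ (trans (sym (^-distrib-* (- 1#) q (desᴸ α))) (^-congˡ (desᴸ α) (-1*x≈-x q)))) (tail β) ⟩
        des·2-31 (- q) α * (δ β + - 1# * (nonempty ⊙ des·2-13 (- 1#)) β) ∎
        where
        tail : ∀ β → (- 1#) ^ (desᴸ β ℕ.+ ⟦ nonempty β ⟧) * q ^ 2-13ᴸ β ≈
          δ β + - 1# * (nonempty ⊙ des·2-13 (- 1#)) β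
        tail []      = solve 2 (λ t d → con 1 :* con 1 := con 1 :+ t :* (con 0 :* d)) refl (- 1#) (des·2-13 (- 1#) [])
        tail β@(_ ∷ _) = trans (*-congʳ (trans (^-homo-* (- 1#) (desᴸ β) 1) (*-congˡ (*-identityʳ _))))
          (solve 3 (λ a t b → (a :* t) :* b := con 0 :+ t :* (con 1 :* (a :* b))) refl _ _ _)

      des·2-13-eq : let h = gf (nonempty ⊙ des·2-31 (- q)) ; g = gf (nonempty ⊙ des·2-13 (- 1#)) in
        g ≋ 0# ∷ˢ (𝟙 ⊕ h) ⊛ (𝟙 ⊕ (- 1#) · g)
      des·2-13-eq zero    = trans (gf-zero (nonempty ⊙ des·2-13 (- 1#))) (zeroˡ _)
      des·2-13-eq (suc n) = trans
        (gf-suc (nonempty ⊙ des·2-13 (- 1#)) (des·2-31 (- q)) (λ w → δ w + - 1# * (nonempty ⊙ des·2-13 (- 1#)) w)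
          (λ {_} {_} {α} {β} pα pβ → trans (*-congʳ (reflexive (≡.cong χ (nonempty-glue α β))))
            (trans (*-identityˡ _) (des·2-13-glue pα pβ))) n)
        (⊛-cong≤ _ _ _ _ n
          (λ k _ → δ+nonempty (des·2-31 (- q)) (*-identityˡ 1#) k)
          (λ k _ → trans (gf-+ δ _ k) (+-cong (gf-δ k) (gf-· (- 1#) _ k))))

      -- With an empty right block m would be last and hence a foremaximum; so only nonempty right
      -- blocks remain, on which the coderangement condition imposes nothing.
      coder·2-31-eq : ∀ t → let d = gf (coderangementᴸ ⊙ des·2-31 t) in
        d ≋ 1# ∷ˢ t · (dilate q d ⊛ gf (nonempty ⊙ des·2-31 t))
      coder·2-31-eq t = gf-product-eq t q _ _ _ (solve 0 (con 1 :* (con 1 :* con 1) := con 1) refl) step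
        where
        step : ∀ {i j α β} → Perm132 i α → Perm132 j β → (coderangementᴸ ⊙ des·2-31 t) (glue α β) ≈
          t * ((q ^ length α * (coderangementᴸ ⊙ des·2-31 t) α) * (nonempty ⊙ des·2-31 t) β)
        step {α = α} {[]} pα pβ = trans
          (*-congʳ (trans (reflexive (≡.cong χ (coderangementᴸ-glue pα pβ))) (χ-∧ (coderangementᴸ α) false)))
          (solve 5 (λ a b c t d → (a :* con 0) :* b := t :* (c :* (con 0 :* d))) refl _ _ _ t (des·2-31 t []))
        step {α = α} {β@(_ ∷ _)} pα pβ = trans
          (*-cong (trans (reflexive (≡.cong χ (coderangementᴸ-glue pα pβ))) (χ-∧ (coderangementᴸ α) true)) (des·2-31-glue pα pβ t ≡.refl))
          (solve 5 (λ c t l a b → (c :* con 1) :* (t :* ((l :* a) :* b)) := t :* ((l :* (c :* a)) :* (con 1 :* b))) refl _ t _ _ _)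

      des·31-2-glue : ∀ {i j α β} → Perm132 i α → Perm132 j β → ∀ t → nonempty β ≡ true →
        des·31-2 t (glue α β) ≈ t * (des·31-2 t α * des·31-2⁺ t β)
      des·31-2-glue {α = α} pα pβ t ne = trans
        (*-cong (t^des-glue pα pβ t ne) (trans (^-congʳ q (31-2ᴸ-glue pα pβ)) (^-homo-* q (31-2ᴸ α) _)))
        (solve 5 (λ t a b c d → (a :* (b :* t)) :* (c :* d) := t :* ((a :* c) :* (b :* d))) refl t _ _ _ _)

      -- The left block does not interact with the rest, whence p = 1; the letter m in front of the
      -- right block turns its statistic into `31-2⁺`.
      coder·31-2-eq : ∀ t → let d = gf (coderangementᴸ ⊙ des·31-2 t) in
        d ≋ 1# ∷ˢ t · (dilate 1# d ⊛ gf (nonempty ⊙ des·31-2⁺ t))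
      coder·31-2-eq t = gf-product-eq t 1# _ _ _ (solve 0 (con 1 :* (con 1 :* con 1) := con 1) refl) step
        where
        step : ∀ {i j α β} → Perm132 i α → Perm132 j β → (coderangementᴸ ⊙ des·31-2 t) (glue α β) ≈
          t * ((1# ^ length α * (coderangementᴸ ⊙ des·31-2 t) α) * (nonempty ⊙ des·31-2⁺ t) β)
        step {α = α} {[]} pα pβ = trans
          (*-congʳ (trans (reflexive (≡.cong χ (coderangementᴸ-glue pα pβ))) (χ-∧ (coderangementᴸ α) false)))
          (solve 5 (λ a b c t d → (a :* con 0) :* b := t :* (c :* (con 0 :* d))) refl _ _ _ t (des·31-2⁺ t []))
        step {α = α} {β@(_ ∷ _)} pα pβ = trans
          (*-cong (trans (reflexive (≡.cong χ (coderangementᴸ-glue pα pβ))) (χ-∧ (coderangementᴸ α) true)) (des·31-2-glue pα pβ t ≡.refl))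
          (trans (solve 4 (λ c t a b → (c :* con 1) :* (t :* (a :* b)) := t :* ((c :* a) :* (con 1 :* b))) refl _ t _ _)
            (*-congˡ (*-congʳ (sym (1^n*x≈x (length α) _)))))

      -- A nonempty α gives a factor q, since m lies between the prefixed letter and the first
      -- letter of α; a nonempty β gives -q for the descent out of m. In (1 + qu)(1 - qu) the linear
      -- terms cancel, which is the reason for the weight (-q)^des.
      des·31-2⁺-eq : let u = gf (nonempty ⊙ des·31-2⁺ (- q)) in
        u ≋ 0# ∷ˢ 𝟙 ⊕ (q * - q) · (dilate 1# u ⊛ u)
      des·31-2⁺-eq zero    = trans (gf-zero (nonempty ⊙ des·31-2⁺ (- q))) (zeroˡ _)
      des·31-2⁺-eq (suc n) = begin
        u (suc n)                                       ≈⟨ gf-suc U left right step n ⟩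
        (gf left ⊛ gf right) n
          ≈⟨ ⊛-cong≤ _ _ _ _ n (λ k _ → trans (gf-+ δ _ k) (+-cong (gf-δ k) (gf-· q U k)))
                               (λ k _ → trans (gf-+ δ _ k) (+-cong (gf-δ k) (gf-· (- q) U k))) ⟩
        ((𝟙 ⊕ q · u) ⊛ (𝟙 ⊕ (- q) · u)) n               ≈⟨ expand n ⟩
        𝟙 n + (q * - q) * (u ⊛ u) n
          ≈⟨ +-congˡ (*-congˡ (⊛-cong≤ _ _ u u n (λ k _ → dilate-1 u k) (λ _ _ → refl))) ⟨
        𝟙 n + (q * - q) * (dilate 1# u ⊛ u) n           ∎
        where
        U left right : Weight
        U       = nonempty ⊙ des·31-2⁺ (- q)
        left  w = δ w + q * U w
        right w = δ w + - q * U w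
        u : Series
        u = gf U
        expand : (𝟙 ⊕ q · u) ⊛ (𝟙 ⊕ (- q) · u) ≋ 𝟙 ⊕ (q * - q) · (u ⊛ u)
        expand n = begin
          ((𝟙 ⊕ q · u) ⊛ (𝟙 ⊕ (- q) · u)) n                                 ≈⟨ ⊛-distribʳ (𝟙 ⊕ (- q) · u) 𝟙 (q · u) n ⟩
          (𝟙 ⊛ (𝟙 ⊕ (- q) · u)) n + ((q · u) ⊛ (𝟙 ⊕ (- q) · u)) n
            ≈⟨ +-cong (⊛-identityˡ (𝟙 ⊕ (- q) · u) n)
                 (trans (⊛-scale q u (𝟙 ⊕ (- q) · u) n) (*-congˡ (trans (⊛-comm u (𝟙 ⊕ (- q) · u) n)
                   (trans (⊛-distribʳ u 𝟙 ((- q) · u) n) (+-cong (⊛-identityˡ u n) (⊛-scale (- q) u u n)))))) ⟩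
          (𝟙 n + - q * u n) + q * (u n + - q * (u ⊛ u) n)
            ≈⟨ solve 5 (λ e p q a b → (e :+ p :* a) :+ q :* (a :+ p :* b) := e :+ ((p :+ q) :* a :+ (q :* p) :* b)) refl (𝟙 n) (- q) q (u n) _ ⟩
          𝟙 n + ((- q + q) * u n + (q * - q) * (u ⊛ u) n)
            ≈⟨ +-congˡ (trans (+-congʳ (trans (*-congʳ (-‿inverseˡ q)) (zeroˡ _))) (+-identityˡ _)) ⟩
          𝟙 n + (q * - q) * (u ⊛ u) n ∎
        factor : ∀ x w → x ^ ⟦ nonempty w ⟧ * des·31-2⁺ (- q) w ≈ δ w + x * U w
        factor x []      = solve 2 (λ x d → con 1 :* (con 1 :* con 1) := con 1 :+ x :* (con 0 :* d)) refl x (des·31-2⁺ (- q) [])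
        factor x w@(_ ∷ _) = solve 2 (λ x a → (x :* con 1) :* a := con 0 :+ x :* (con 1 :* a)) refl x (des·31-2⁺ (- q) w)
        step : ∀ {i j α β} → Perm132 i α → Perm132 j β → U (glue α β) ≈ left α * right β
        step {α = α} {β} pα pβ = begin
          χ (nonempty (glue α β)) * ((- q) ^ desᴸ (glue α β) * q ^ 31-2⁺ (glue α β))
            ≈⟨ *-cong (reflexive (≡.cong χ (nonempty-glue α β)))
                 (*-cong (trans (^-congʳ (- q) (desᴸ-glue pα pβ)) (trans (^-homo-* (- q) (desᴸ α) _) (*-congˡ (^-homo-* (- q) (desᴸ β) _))))
                         (trans (^-congʳ q (31-2⁺-glue pα pβ)) (trans (^-homo-* q (31-2⁺ α) _) (*-congˡ (^-homo-* q ⟦ nonempty α ⟧ _))))) ⟩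
          1# * (((- q) ^ desᴸ α * ((- q) ^ desᴸ β * (- q) ^ ⟦ nonempty β ⟧)) * (q ^ 31-2⁺ α * (q ^ ⟦ nonempty α ⟧ * q ^ 31-2⁺ β)))
            ≈⟨ solve 6 (λ a b c d e f → con 1 :* ((a :* (b :* c)) :* (d :* (e :* f))) := (e :* (a :* d)) :* (c :* (b :* f))) refl _ _ _ _ _ _ ⟩
          (q ^ ⟦ nonempty α ⟧ * des·31-2⁺ (- q) α) * ((- q) ^ ⟦ nonempty β ⟧ * des·31-2⁺ (- q) β)
            ≈⟨ *-cong (factor q α) (factor (- q) β) ⟩
          left α * right β ∎

      q^2-31 q^31-2 q^31-2⁺ : Weight
      q^2-31  w = q ^ 2-31ᴸ w
      q^31-2  w = q ^ 31-2ᴸ w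
      q^31-2⁺ w = q ^ 31-2⁺ w

      upDown⇒nonempty : ∀ β → upDown β ≡ true → nonempty β ≡ true
      upDown⇒nonempty (_ ∷ _) _ = ≡.refl

      downUp·2-31-eq : let e = gf (downUp ⊙ q^2-31) in
        e ≋ 1# ∷ˢ 1# · (dilate q e ⊛ gf (upDown ⊙ q^2-31))
      downUp·2-31-eq = gf-product-eq 1# q _ _ _ (*-identityˡ 1#) step
        where
        step : ∀ {i j α β} → Perm132 i α → Perm132 j β → (downUp ⊙ q^2-31) (glue α β) ≈
          1# * ((q ^ length α * (downUp ⊙ q^2-31) α) * (upDown ⊙ q^2-31) β)
        step {α = α} {β} pα pβ with upDown β in eq
        ... | false = trans
          (*-congʳ (trans (reflexive (≡.cong χ (≡.trans (downUp-glue pα pβ) (≡.cong (downUp α ∧_) eq)))) (χ-∧ (downUp α) false)))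
          (solve 4 (λ a b c d → (a :* con 0) :* b := con 1 :* (c :* (con 0 :* d))) refl _ _ _ _)
        ... | true = trans
          (*-cong (trans (reflexive (≡.cong χ (≡.trans (downUp-glue pα pβ) (≡.cong (downUp α ∧_) eq)))) (χ-∧ (downUp α) true))
                  (q^2-31-glue pα pβ (upDown⇒nonempty β eq)))
          (solve 4 (λ c l a b → (c :* con 1) :* (l :* a :* b) := con 1 :* ((l :* (c :* a)) :* (con 1 :* b))) refl _ _ _ _)

      downUp·31-2-eq : let e = gf (downUp ⊙ q^31-2) in
        e ≋ 1# ∷ˢ 1# · (dilate 1# e ⊛ gf (upDown ⊙ q^31-2⁺))
      downUp·31-2-eq = gf-product-eq 1# 1# _ _ _ (*-identityˡ 1#) step
        where
        step : ∀ {i j α β} → Perm132 i α → Perm132 j β → (downUp ⊙ q^31-2) (glue α β) ≈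
          1# * ((1# ^ length α * (downUp ⊙ q^31-2) α) * (upDown ⊙ q^31-2⁺) β)
        step {α = α} {β} pα pβ = begin
          χ (downUp (glue α β)) * q ^ 31-2ᴸ (glue α β)
            ≈⟨ *-cong (trans (reflexive (≡.cong χ (downUp-glue pα pβ))) (χ-∧ (downUp α) (upDown β)))
                      (trans (^-congʳ q (31-2ᴸ-glue pα pβ)) (^-homo-* q (31-2ᴸ α) _)) ⟩
          (χ (downUp α) * χ (upDown β)) * (q ^ 31-2ᴸ α * q ^ 31-2⁺ β)   ≈⟨ interchange _ _ _ _ ⟩
          (downUp ⊙ q^31-2) α * (upDown ⊙ q^31-2⁺) β
            ≈⟨ trans (*-identityˡ _) (*-congʳ (1^n*x≈x (length α) _)) ⟨
          1# * ((1# ^ length α * (downUp ⊙ q^31-2) α) * (upDown ⊙ q^31-2⁺) β) ∎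

      gf-δ-affine-eq : ∀ t p f a b → f [] ≈ 0# →
        (∀ {i j α β} → Perm132 i α → Perm132 j β → f (glue α β) ≈ δ α * δ β + t * ((p ^ length α * a α) * b β)) →
        gf f ≋ 0# ∷ˢ 𝟙 ⊕ t · (dilate p (gf a) ⊛ gf b)
      gf-δ-affine-eq t p f a b f[] eq n = trans (gf-affine-eq t p f δ a b f[] eq n) (fold n)
        where
        fold : (0# ∷ˢ gf δ ⊕ t · (dilate p (gf a) ⊛ gf b)) ≋ (0# ∷ˢ 𝟙 ⊕ t · (dilate p (gf a) ⊛ gf b))
        fold zero    = refl
        fold (suc n) = +-congʳ (gf-δ n)

      -- The summand 𝟙 is the one-letter word. An empty left block with a nonempty right one would
      -- put the maximum at a valley.
      upDown·2-31-eq : let o = gf (upDown ⊙ q^2-31) in o ≋ 0# ∷ˢ 𝟙 ⊕ 1# · (dilate q o ⊛ o)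
      upDown·2-31-eq = gf-δ-affine-eq 1# q _ _ _ (zeroˡ _) step
        where
        step : ∀ {i j α β} → Perm132 i α → Perm132 j β → (upDown ⊙ q^2-31) (glue α β) ≈
          δ α * δ β + 1# * ((q ^ length α * (upDown ⊙ q^2-31) α) * (upDown ⊙ q^2-31) β)
        step {α = []} {[]} pα pβ = solve 0 (con 1 :* con 1 := con 1 :* con 1 :+ con 1 :* ((con 1 :* (con 0 :* con 1)) :* (con 0 :* con 1))) refl
        step {α = []} {β@(_ ∷ _)} pα pβ = trans
          (*-congʳ (reflexive (≡.cong χ (upDown-glue-[] pβ))))
          (solve 2 (λ a b → con 0 :* a := con 1 :* con 0 :+ con 1 :* ((con 1 :* (con 0 :* con 1)) :* b)) refl _ _)
        step {α = α@(_ ∷ _)} {β} pα pβ with upDown β in eq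
        ... | false = trans
          (*-congʳ (trans (reflexive (≡.cong χ (≡.trans (upDown-glue pα pβ) (≡.cong (upDown α ∧_) eq)))) (χ-∧ (upDown α) false)))
          (solve 5 (λ a b c d e → (a :* con 0) :* b := con 0 :* e :+ con 1 :* (c :* (con 0 :* d))) refl _ _ _ _ _)
        ... | true = trans
          (*-cong (trans (reflexive (≡.cong χ (≡.trans (upDown-glue pα pβ) (≡.cong (upDown α ∧_) eq)))) (χ-∧ (upDown α) true))
                  (q^2-31-glue pα pβ (upDown⇒nonempty β eq)))
          (solve 5 (λ c l a b e → (c :* con 1) :* (l :* a :* b) := con 0 :* e :+ con 1 :* ((l :* (c :* a)) :* (con 1 :* b))) refl _ _ _ _ _)

      -- The factor q comes from m between the prefixed letter and the first letter of the left
      -- block, which is nonempty in every word of length at least 2.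
      upDown·31-2⁺-eq : let o = gf (upDown ⊙ q^31-2⁺) in o ≋ 0# ∷ˢ 𝟙 ⊕ q · (dilate 1# o ⊛ o)
      upDown·31-2⁺-eq = gf-δ-affine-eq q 1# _ _ _ (zeroˡ _) step
        where
        step : ∀ {i j α β} → Perm132 i α → Perm132 j β → (upDown ⊙ q^31-2⁺) (glue α β) ≈
          δ α * δ β + q * ((1# ^ length α * (upDown ⊙ q^31-2⁺) α) * (upDown ⊙ q^31-2⁺) β)
        step {α = []} {[]} pα pβ = solve 1 (λ q → con 1 :* con 1 := con 1 :* con 1 :+ q :* ((con 1 :* (con 0 :* con 1)) :* (con 0 :* con 1))) refl q
        step {α = []} {β@(_ ∷ _)} pα pβ = trans
          (*-congʳ (reflexive (≡.cong χ (upDown-glue-[] pβ))))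
          (solve 3 (λ a b q → con 0 :* a := con 1 :* con 0 :+ q :* ((con 1 :* (con 0 :* con 1)) :* b)) refl _ _ q)
        step {α = α@(_ ∷ _)} {β} pα pβ = begin
          χ (upDown (glue α β)) * q ^ 31-2⁺ (glue α β)
            ≈⟨ *-cong (trans (reflexive (≡.cong χ (upDown-glue pα pβ))) (χ-∧ (upDown α) (upDown β)))
                      (trans (^-congʳ q (31-2⁺-glue pα pβ)) (^-homo-* q (31-2⁺ α) (suc (31-2⁺ β)))) ⟩
          (χ (upDown α) * χ (upDown β)) * (q ^ 31-2⁺ α * (q * q ^ 31-2⁺ β))
            ≈⟨ solve 6 (λ a b c q d e → (a :* b) :* (c :* (q :* d)) := con 0 :* e :+ q :* ((a :* c) :* (b :* d))) refl _ _ _ q _ (δ β) ⟩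
          0# * δ β + q * ((upDown ⊙ q^31-2⁺) α * (upDown ⊙ q^31-2⁺) β)
            ≈⟨ +-congˡ (*-congˡ (*-congʳ (1^n*x≈x (length α) _))) ⟨
          0# * δ β + q * ((1# ^ length α * (upDown ⊙ q^31-2⁺) α) * (upDown ⊙ q^31-2⁺) β) ∎

      -- The last letter belongs to the right block, which is not shifted. If that block is empty,
      -- the maximum comes last and is 0 only in the one-letter word.
      endsInZero·2-31-eq : ∀ t → let y = gf (endsInZero ⊙ des·2-31 t) in
        y ≋ 0# ∷ˢ 𝟙 ⊕ t · (dilate q (gf (des·2-31 t)) ⊛ y)
      endsInZero·2-31-eq t = gf-δ-affine-eq t q _ _ _ (zeroˡ _) step
        where
        step : ∀ {i j α β} → Perm132 i α → Perm132 j β → (endsInZero ⊙ des·2-31 t) (glue α β) ≈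
          δ α * δ β + t * ((q ^ length α * des·2-31 t α) * (endsInZero ⊙ des·2-31 t) β)
        step {α = []} {[]} pα pβ = solve 1 (λ t → con 1 :* (con 1 :* con 1) := con 1 :* con 1 :+ t :* ((con 1 :* (con 1 :* con 1)) :* (con 0 :* (con 1 :* con 1)))) refl t
        step {α = α@(_ ∷ _)} {[]} pα pβ = trans
          (*-congʳ (reflexive (≡.cong χ (endsInZero-glue-[] α))))
          (solve 4 (λ a t b c → con 0 :* a := con 0 :* con 1 :+ t :* (b :* (con 0 :* c))) refl _ t _ (des·2-31 t []))
        step {α = α} {β@(y ∷ β′)} pα pβ = trans
          (*-cong (reflexive (≡.cong χ (endsInZero-glue-∷ α y β′))) (des·2-31-glue pα pβ t ≡.refl))
          (solve 5 (λ c t a b e → c :* (t :* (a :* b)) := e :* con 0 :+ t :* (a :* (c :* b))) refl _ t _ _ (δ α))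

      endsInZero·2-13-eq : let y = gf (endsInZero ⊙ des·2-13 (- 1#)) in
        y ≋ 0# ∷ˢ 𝟙 ⊕ (- 1#) · (dilate 1# (gf (des·2-31 (- q))) ⊛ y)
      endsInZero·2-13-eq = gf-δ-affine-eq (- 1#) 1# _ _ _ (zeroˡ _) step
        where
        step : ∀ {i j α β} → Perm132 i α → Perm132 j β → (endsInZero ⊙ des·2-13 (- 1#)) (glue α β) ≈
          δ α * δ β + - 1# * ((1# ^ length α * des·2-31 (- q) α) * (endsInZero ⊙ des·2-13 (- 1#)) β)
        step {α = []} {[]} pα pβ = solve 1 (λ t → con 1 :* (con 1 :* con 1) := con 1 :* con 1 :+ t :* ((con 1 :* (con 1 :* con 1)) :* (con 0 :* (con 1 :* con 1)))) refl (- 1#)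
        step {α = α@(_ ∷ _)} {[]} pα pβ = trans
          (*-congʳ (reflexive (≡.cong χ (endsInZero-glue-[] α))))
          (solve 4 (λ a t b c → con 0 :* a := con 0 :* con 1 :+ t :* (b :* (con 0 :* c))) refl _ (- 1#) _ (des·2-13 (- 1#) []))
        step {α = α} {β@(y ∷ β′)} pα pβ = begin
          χ (endsInZero (glue α β)) * des·2-13 (- 1#) (glue α β)
            ≈⟨ *-cong (reflexive (≡.cong χ (endsInZero-glue-∷ α y β′))) (des·2-13-glue pα pβ) ⟩
          χ (endsInZero β) * (des·2-31 (- q) α * (0# + - 1# * (1# * des·2-13 (- 1#) β)))
            ≈⟨ solve 5 (λ c t a b e → c :* (a :* (con 0 :+ t :* (con 1 :* b))) := e :* con 0 :+ t :* (a :* (c :* b))) refl _ (- 1#) _ _ (δ α) ⟩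
          δ α * 0# + - 1# * (des·2-31 (- q) α * (endsInZero ⊙ des·2-13 (- 1#)) β)
            ≈⟨ +-congˡ (*-congˡ (*-congʳ (1^n*x≈x (length α) _))) ⟨
          δ α * 0# + - 1# * ((1# ^ length α * des·2-31 (- q) α) * (endsInZero ⊙ des·2-13 (- 1#)) β) ∎

      catalan-eqs : ∀ n →
        (gf (des·2-31 (- 1#)) (suc n) ≈ catalanSolution q (suc n)) ×
        (gf (des·2-13 (- 1#)) (suc n) ≈ catalanSolution q (suc n))
      catalan-eqs n =
        trans (δ+nonempty (des·2-31 (- 1#)) (*-identityˡ 1#) (suc n)) (trans (+-identityˡ _)
          (catalanSolution-unique q (signed-descent-eq q (des·2-31-eq (- 1#))) (suc n))) ,
        trans (δ+nonempty (des·2-13 (- 1#)) (*-identityˡ 1#) (suc n)) (trans (+-identityˡ _)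
          (catalanSolution-unique q (ascending-eq q (des·2-31-eq (- q)) des·2-13-eq) (suc n)))

      upDown-supported : ∀ f → OddSupported (gf (upDown ⊙ f))
      upDown-supported f n even = sumOver-0 (W n) λ {w} w∈ → vanish w (length≡ (W-sound w∈))
        where
        vanish : ∀ w → length w ≡ n → (upDown ⊙ f) w ≈ 0#
        vanish w len with upDown w in eq
        ... | false = zeroˡ _
        ... | true with ≡.trans (≡.sym even) (≡.trans (≡.cong parity (≡.sym len)) (upDown⇒odd w eq))
        ... | ()

      downUp-supported : ∀ f n → parity n ≡ 1ℙ → gf (downUp ⊙ f) n ≈ 0#
      downUp-supported f n odd = sumOver-0 (W n) λ {w} w∈ → vanish w (length≡ (W-sound w∈))
        where
        vanish : ∀ w → length w ≡ n → (downUp ⊙ f) w ≈ 0#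
        vanish w len with downUp w in eq
        ... | false = zeroˡ _
        ... | true with ≡.trans (≡.sym odd) (≡.trans (≡.cong parity (≡.sym len)) (downUp⇒even w eq))
        ... | ()

      1∷-1· : ∀ {f g} → f ≋ 1# ∷ˢ 1# · g → f ≋ 1# ∷ˢ g
      1∷-1· eq zero    = eq 0
      1∷-1· eq (suc n) = trans (eq (suc n)) (*-identityˡ _)

      -- Here p = q, a = 1, b = -1: cancellation leaves the signed series with the coefficient -1 =
      -- ab, and coderangements with b.
      coder·2-31-twist : gf (coderangementᴸ ⊙ des·2-31 (- 1#)) ≋ twist (- 1#) (gf (downUp ⊙ q^2-31))
      coder·2-31-twist n = sym (twist-e q 1# (- 1#) (upDown-supported q^2-31) upDown·2-31-eq (1∷-1· downUp·2-31-eq)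
        f-eq (coder·2-31-eq (- 1#)) n)
        where
        f : Series
        f = gf (nonempty ⊙ des·2-31 (- 1#))
        f-eq : f ≋ 0# ∷ˢ 𝟙 ⊕ (1# * - 1#) · (dilate q f ⊛ f)
        f-eq zero    = signed-descent-eq q (des·2-31-eq (- 1#)) 0
        f-eq (suc n) = trans (signed-descent-eq q (des·2-31-eq (- 1#)) (suc n)) (+-congˡ (*-congʳ (sym (*-identityˡ _))))

      -- Here p = 1, a = q, b = -q: the coefficient q(-q) left by (1 + qu)(1 - qu) is ab, with a the
      -- factor of the up-down words.
      coder·31-2-twist : gf (coderangementᴸ ⊙ des·31-2 (- q)) ≋ twist (- q) (gf (downUp ⊙ q^31-2))
      coder·31-2-twist n = sym (twist-e 1# q (- q) (upDown-supported q^31-2⁺) upDown·31-2⁺-eq (1∷-1· downUp·31-2-eq)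
        des·31-2⁺-eq (coder·31-2-eq (- q)) n)

      des·2-13-nonempty : ∀ n → gf (nonempty ⊙ des·2-13 (- 1#)) (suc n) ≈ gf (des·2-13 (- 1#)) (suc n)
      des·2-13-nonempty n = sym (trans (δ+nonempty (des·2-13 (- 1#)) (*-identityˡ 1#) (suc n)) (+-identityˡ _))

      endsInZero·2-13-suc : ∀ n → gf (endsInZero ⊙ des·2-13 (- 1#)) (suc (suc n)) ≈ - 1# * gf (des·2-13 (- 1#)) (suc n)
      endsInZero·2-13-suc n = trans
        (final-min-eq q (des·2-31-eq (- q)) des·2-13-eq y-eq (suc (suc n)))
        (trans (+-identityˡ _) (*-congˡ (des·2-13-nonempty n)))
        where
        y : Series
        y = gf (endsInZero ⊙ des·2-13 (- 1#))
        y-eq : y ≋ 0# ∷ˢ 𝟙 ⊕ (- 1#) · ((𝟙 ⊕ gf (nonempty ⊙ des·2-31 (- q))) ⊛ y)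
        y-eq zero    = endsInZero·2-13-eq 0
        y-eq (suc n) = trans (endsInZero·2-13-eq (suc n)) (+-congˡ (*-congˡ (⊛-cong≤ _ _ y y n
          (λ k _ → trans (dilate-1 (gf (des·2-31 (- q))) k) (δ+nonempty (des·2-31 (- q)) (*-identityˡ 1#) k)) (λ _ _ → refl))))

      -- The series is z w(qz) with w = 1 - g, so the coefficient of z^(n+2) is that of z^(n+1) in
      -- -g(qz); this is where q^(n+1) comes from.
      endsInZero·2-31-suc : ∀ n → gf (endsInZero ⊙ des·2-31 (- q)) (suc (suc n)) ≈
        q ^ suc n * (- 1# * gf (des·2-13 (- 1#)) (suc n))
      endsInZero·2-31-suc n = trans
        (final-min-dilate-eq q (des·2-31-eq (- q)) des·2-13-eq y-eq (suc (suc n)))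
        (*-congˡ (trans (+-identityˡ _) (*-congˡ (des·2-13-nonempty n))))
        where
        y : Series
        y = gf (endsInZero ⊙ des·2-31 (- q))
        y-eq : y ≋ 0# ∷ˢ 𝟙 ⊕ (- q) · (dilate q (𝟙 ⊕ gf (nonempty ⊙ des·2-31 (- q))) ⊛ y)
        y-eq zero    = endsInZero·2-31-eq (- q) 0
        y-eq (suc n) = trans (endsInZero·2-31-eq (- q) (suc n)) (+-congˡ (*-congˡ (⊛-cong≤ _ _ y y n
          (λ k _ → *-congˡ (δ+nonempty (des·2-31 (- q)) (*-identityˡ 1#) k)) (λ _ _ → refl))))

-- Evaluation of the sums over pattern classes

module Evaluation {c ℓ} (R : CommutativeRing c ℓ) (q : CommutativeRing.Carrier R) where

  open CommutativeRing R hiding (zero)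
  open CommutativeSemiringExp commutativeSemiring
  open CommutativeSemigroupProperties *-commutativeSemigroup using (interchange; x∙yz≈y∙xz)
  open RingProperties ring using (-1*x≈-x)
  open SeriesEquations R using (catalanSolution; odd)
  open Sums R
  open Catalan R using (C)
  open Enumeration words132 words132-unique words132-sound words132-complete
  open GeneratingFunctions R
  open Weights q
  open SetoidReasoning setoid

  sum-132 : ∀ n f w → (∀ {π} → π ∈ 𝔖 n p132 → f π ≈ w (letters π)) → sumOver (𝔖 n p132) f ≈ gf w n
  sum-132 n f w eq = trans (sumOver-cong (𝔖 n p132) eq) (reflexive (≡.sym (sumOver-map letters (𝔖 n p132) w)))

  sum-transform : ∀ n τ (φ : Word n → Word n) → 𝔖 n τ ↭ map φ (𝔖 n p132) → ∀ f →
    sumOver (𝔖 n τ) f ≈ sumOver (𝔖 n p132) (f ∘ φ)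
  sum-transform n τ φ p f = trans (sumOver-↭ f p) (reflexive (sumOver-map φ (𝔖 n p132) f))

  ^*^-cong : ∀ t {a b c d} → a ≡ b → c ≡ d → t ^ a * q ^ c ≈ t ^ b * q ^ d
  ^*^-cong t a≡b c≡d = *-cong (^-congʳ t a≡b) (^-congʳ q c≡d)

  𝔖132-2-31 : ∀ n → sumOver (𝔖 (suc n) p132) (λ π → (- 1#) ^ des π * q ^ ⟨2-31⟩ π) ≈ catalanSolution q (suc n)
  𝔖132-2-31 n = trans
    (sum-132 (suc n) _ (des·2-31 (- 1#)) λ {π} _ → ^*^-cong (- 1#) (des-letters π) (2-31-letters π))
    (proj₁ (catalan-eqs n))

  𝔖132-2-13 : ∀ n → sumOver (𝔖 (suc n) p132) (λ π → (- 1#) ^ des π * q ^ ⟨2-13⟩ π) ≈ catalanSolution q (suc n)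
  𝔖132-2-13 n = trans
    (sum-132 (suc n) _ (des·2-13 (- 1#)) λ {π} _ → ^*^-cong (- 1#) (des-letters π) (2-13-letters π))
    (proj₂ (catalan-eqs n))

  𝔖213-31-2 : ∀ n → sumOver (𝔖 (suc n) p213) (λ π → (- 1#) ^ des π * q ^ ⟨31-2⟩ π) ≈ catalanSolution q (suc n)
  𝔖213-31-2 n = trans (sum-transform (suc n) p213 reverseComplement (𝔖213↭ (suc n)) _) (trans
    (sumOver-cong (𝔖 (suc n) p132) λ {π} _ → ^*^-cong (- 1#) (des-reverseComplement π) (31-2-reverseComplement π))
    (𝔖132-2-31 n))

  𝔖213-13-2 : ∀ n → sumOver (𝔖 (suc n) p213) (λ π → (- 1#) ^ des π * q ^ ⟨13-2⟩ π) ≈ catalanSolution q (suc n)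
  𝔖213-13-2 n = trans (sum-transform (suc n) p213 reverseComplement (𝔖213↭ (suc n)) _) (trans
    (sumOver-cong (𝔖 (suc n) p132) λ {π} _ → ^*^-cong (- 1#) (des-reverseComplement π) (13-2-reverseComplement π))
    (𝔖132-2-13 n))

  -1^n*-1^n≈1 : ∀ n → (- 1#) ^ n * (- 1#) ^ n ≈ 1#
  -1^n*-1^n≈1 zero    = *-identityˡ 1#
  -1^n*-1^n≈1 (suc n) = trans (interchange _ _ _ _) (trans (*-cong -1*-1≈1 (-1^n*-1^n≈1 n)) (*-identityˡ 1#))
    where
    open RingProperties ring using (-‿involutive)
    -1*-1≈1 : - 1# * - 1# ≈ 1#
    -1*-1≈1 = trans (-1*x≈-x (- 1#)) (-‿involutive 1#)

  -- The coefficient vanishes unless n is even, and then the sign is 1; so the sign introduced by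
  -- complementation is invisible.
  odd-sign : ∀ a n → (- 1#) ^ n * odd a (suc n) ≈ odd a (suc n)
  odd-sign a zero          = *-identityˡ _
  odd-sign a (suc zero)    = zeroʳ _
  odd-sign a (suc (suc n)) = trans
    (*-congʳ (trans (sym (*-assoc _ _ _)) (trans (*-congʳ (trans (*-cong (sym (*-identityʳ _)) (sym (*-identityʳ _))) (-1^n*-1^n≈1 1))) (*-identityˡ _))))
    (odd-sign (a ∘ suc) n)

  -- Complementation turns descents into ascents, which changes the sign by (-1)ⁿ.
  des-complement-sign : ∀ {n} {π : Word (suc n)} → π ∈ 𝔖 (suc n) p132 →
    (- 1#) ^ des (complement π) ≈ (- 1#) ^ n * (- 1#) ^ des π
  des-complement-sign {n} {π} π∈ = begin
    (- 1#) ^ des (complement π)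
      ≈⟨ ^-congʳ (- 1#) (≡.trans (des-complement π) (adjΣ≡adj ascent (values π))) ⟩
    (- 1#) ^ asc                                         ≈⟨ *-identityʳ _ ⟨
    -- Inserting the square of (-1)^des completes the exponent to asc + des = n and leaves one copy
    -- of (-1)^des over.
    (- 1#) ^ asc * 1#                                    ≈⟨ *-congˡ (-1^n*-1^n≈1 (desᴸ (letters π))) ⟨
    (- 1#) ^ asc * ((- 1#) ^ desᴸ (letters π) * (- 1#) ^ desᴸ (letters π)) ≈⟨ *-assoc _ _ _ ⟨
    (- 1#) ^ asc * (- 1#) ^ desᴸ (letters π) * (- 1#) ^ desᴸ (letters π)
      ≈⟨ *-congʳ (^-homo-* (- 1#) asc (desᴸ (letters π))) ⟨
    (- 1#) ^ (asc ℕ.+ desᴸ (letters π)) * (- 1#) ^ desᴸ (letters π)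
      ≈⟨ *-cong (^-congʳ (- 1#) (≡.trans (asc+des _ _ (letters-unique (proj₁ (∈𝔖⁻ (suc n) p132 π∈)))) (List.length-tabulate (values π ∘ suc))))
                (^-congʳ (- 1#) (≡.sym (des-letters π))) ⟩
    (- 1#) ^ n * (- 1#) ^ des π ∎
    where
    asc : ℕ
    asc = adj ascent (letters π)

  𝔖312-sum : ∀ n (s s′ : Word (suc n) → ℕ) → (∀ π → s (complement π) ≡ s′ π) →
    sumOver (𝔖 (suc n) p132) (λ π → (- 1#) ^ des π * q ^ s′ π) ≈ catalanSolution q (suc n) →
    sumOver (𝔖 (suc n) p312) (λ π → (- 1#) ^ des π * q ^ s π) ≈ catalanSolution q (suc n)
  𝔖312-sum n s s′ s-eq sum-eq = begin
    sumOver (𝔖 (suc n) p312) (λ π → (- 1#) ^ des π * q ^ s π)       ≈⟨ sum-transform (suc n) p312 complement (𝔖312↭ (suc n)) _ ⟩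
    sumOver (𝔖 (suc n) p132) (λ π → (- 1#) ^ des (complement π) * q ^ s (complement π))
      ≈⟨ sumOver-cong (𝔖 (suc n) p132) (λ {π} π∈ → trans (*-cong (des-complement-sign π∈) (^-congʳ q (s-eq π))) (*-assoc _ _ _)) ⟩
    sumOver (𝔖 (suc n) p132) (λ π → (- 1#) ^ n * ((- 1#) ^ des π * q ^ s′ π))
      ≈⟨ sumOver-*ˡ (𝔖 (suc n) p132) ((- 1#) ^ n) _ ⟩
    (- 1#) ^ n * sumOver (𝔖 (suc n) p132) (λ π → (- 1#) ^ des π * q ^ s′ π) ≈⟨ *-congˡ sum-eq ⟩
    (- 1#) ^ n * catalanSolution q (suc n)                          ≈⟨ odd-sign _ n ⟩
    catalanSolution q (suc n)                                       ∎

  𝔇*132-2-31 : ∀ n → sumOver (𝔇* n p132) (λ π → (- 1#) ^ des π * q ^ ⟨2-31⟩ π) ≈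
    (- 1#) ^ ⌊ n /2⌋ * gf (downUp ⊙ q^2-31) n
  𝔇*132-2-31 n = trans (sumOver-filter coderangement? (𝔖 n p132) _) (trans
    (sum-132 n _ (coderangementᴸ ⊙ des·2-31 (- 1#)) λ {π} _ →
      *-cong (reflexive (≡.cong χ (coderangement-letters π))) (^*^-cong (- 1#) (des-letters π) (2-31-letters π)))
    (coder·2-31-twist n))

  𝔇*132-31-2 : ∀ n → sumOver (𝔇* n p132) (λ π → (- q) ^ des π * q ^ ⟨31-2⟩ π) ≈
    (- q) ^ ⌊ n /2⌋ * gf (downUp ⊙ q^31-2) n
  𝔇*132-31-2 n = trans (sumOver-filter coderangement? (𝔖 n p132) _) (trans
    (sum-132 n _ (coderangementᴸ ⊙ des·31-2 (- q)) λ {π} _ →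
      *-cong (reflexive (≡.cong χ (coderangement-letters π))) (^*^-cong (- q) (des-letters π) (31-2-letters π)))
    (coder·31-2-twist n))

  𝔄231-13-2 : ∀ n → parity n ≡ 0ℙ → sumOver (𝔄 n p231) (λ π → q ^ ⟨13-2⟩ π) ≈ gf (downUp ⊙ q^2-31) n
  𝔄231-13-2 n even = trans (sumOver-filter alternating? (𝔖 n p231) _) (trans (sum-transform n p231 reversal (𝔖231↭ n) _)
    (sum-132 n _ (downUp ⊙ q^2-31) λ {π} _ → *-cong (reflexive (≡.cong χ (alternating-reversal π even)))
      (^-congʳ q (≡.trans (13-2-reversal π) (2-31-letters π)))))

  𝔄231-2-13 : ∀ n → parity n ≡ 0ℙ → sumOver (𝔄 n p231) (λ π → q ^ ⟨2-13⟩ π) ≈ gf (downUp ⊙ q^31-2) n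
  𝔄231-2-13 n even = trans (sumOver-filter alternating? (𝔖 n p231) _) (trans (sum-transform n p231 reversal (𝔖231↭ n) _)
    (sum-132 n _ (downUp ⊙ q^31-2) λ {π} _ → *-cong (reflexive (≡.cong χ (alternating-reversal π even)))
      (^-congʳ q (≡.trans (2-13-reversal π) (31-2-letters π)))))

  𝔇*213-13-2 : ∀ n → sumOver (𝔇* (suc (suc n)) p213) (λ π → (- 1#) ^ des π * q ^ ⟨13-2⟩ π) ≈
    - 1# * catalanSolution q (suc n)
  𝔇*213-13-2 n = trans (sumOver-filter coderangement? (𝔖 (suc (suc n)) p213) _) (trans (sum-transform (suc (suc n)) p213 reverseComplement (𝔖213↭ (suc (suc n))) _) (trans
    (sum-132 (suc (suc n)) _ (endsInZero ⊙ des·2-13 (- 1#)) λ {π} π∈ →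
      *-cong (reflexive (≡.cong χ (coderangement-reverseComplement π∈)))
        (^*^-cong (- 1#) (≡.trans (des-reverseComplement π) (des-letters π)) (≡.trans (13-2-reverseComplement π) (2-13-letters π))))
    (trans (endsInZero·2-13-suc n) (*-congˡ (proj₂ (catalan-eqs n))))))

  𝔇*213-31-2 : ∀ n → sumOver (𝔇* (suc (suc n)) p213) (λ π → (- q) ^ des π * q ^ ⟨31-2⟩ π) ≈
    q ^ suc n * (- 1# * catalanSolution q (suc n))
  𝔇*213-31-2 n = trans (sumOver-filter coderangement? (𝔖 (suc (suc n)) p213) _) (trans (sum-transform (suc (suc n)) p213 reverseComplement (𝔖213↭ (suc (suc n))) _) (trans
    (sum-132 (suc (suc n)) _ (endsInZero ⊙ des·2-31 (- q)) λ {π} π∈ →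
      *-cong (reflexive (≡.cong χ (coderangement-reverseComplement π∈)))
        (^*^-cong (- q) (≡.trans (des-reverseComplement π) (des-letters π)) (≡.trans (31-2-reverseComplement π) (2-31-letters π))))
    (trans (endsInZero·2-31-suc n) (*-congˡ (*-congˡ (proj₂ (catalan-eqs n)))))))

  odd-at-even : ∀ n a → parity n ≡ 0ℙ → odd a (suc n) ≡ a ⌊ n /2⌋
  odd-at-even zero          a _    = ≡.refl
  odd-at-even (suc (suc n)) a even = odd-at-even n (a ∘ suc) even

  odd-at-odd : ∀ n a → parity n ≡ 1ℙ → odd a (suc n) ≡ 0#
  odd-at-odd (suc zero)    a _     = ≡.refl
  odd-at-odd (suc (suc n)) a p     = odd-at-odd n (a ∘ suc) p

  module Parts
    (ε-odd ε-even : ℕ → Carrier → Carrier)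
    (ε-odd-0ℙ : ∀ n F → parity n ≡ 0ℙ → ε-odd n F ≡ 0#) (ε-odd-1ℙ : ∀ n F → parity n ≡ 1ℙ → ε-odd n F ≡ F)
    (ε-even-0ℙ : ∀ n F → parity n ≡ 0ℙ → ε-even n F ≡ F) (ε-even-1ℙ : ∀ n F → parity n ≡ 1ℙ → ε-even n F ≡ 0#)
    where

    catalanSolution≈ε : ∀ n → catalanSolution q (suc n) ≈ ε-odd (suc n) ((- q) ^ ⌊ n /2⌋ * C ⌊ n /2⌋ (q ^ 2))
    catalanSolution≈ε n with parity n in eq
    ... | 0ℙ = reflexive (≡.trans (odd-at-even n _ eq) (≡.sym (ε-odd-1ℙ (suc n) _ (≡.trans (parity-suc n) (≡.cong ℙ._⁻¹ eq)))))
    ... | 1ℙ = reflexive (≡.trans (odd-at-odd n _ eq) (≡.sym (ε-odd-0ℙ (suc n) _ (≡.trans (parity-suc n) (≡.cong ℙ._⁻¹ eq)))))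

    part-i : ∀ n →
      sumOver (𝔖 (suc n) p132) (λ π → (- 1#) ^ des π * q ^ ⟨2-31⟩ π) ≈
      sumOver (𝔖 (suc n) p132) (λ π → (- 1#) ^ des π * q ^ ⟨2-13⟩ π) ×
      sumOver (𝔖 (suc n) p132) (λ π → (- 1#) ^ des π * q ^ ⟨2-13⟩ π) ≈
      ε-odd (suc n) ((- q) ^ ⌊ n /2⌋ * C ⌊ n /2⌋ (q ^ 2))
    part-i n = trans (𝔖132-2-31 n) (sym (𝔖132-2-13 n)) , trans (𝔖132-2-13 n) (catalanSolution≈ε n)

    part-ii : ∀ n →
      sumOver (𝔖 (suc n) p213) (λ π → (- 1#) ^ des π * q ^ ⟨31-2⟩ π) ≈
      sumOver (𝔖 (suc n) p213) (λ π → (- 1#) ^ des π * q ^ ⟨13-2⟩ π) ×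
      sumOver (𝔖 (suc n) p213) (λ π → (- 1#) ^ des π * q ^ ⟨13-2⟩ π) ≈
      ε-odd (suc n) ((- q) ^ ⌊ n /2⌋ * C ⌊ n /2⌋ (q ^ 2))
    part-ii n = trans (𝔖213-31-2 n) (sym (𝔖213-13-2 n)) , trans (𝔖213-13-2 n) (catalanSolution≈ε n)

    part-iii : ∀ n →
      sumOver (𝔖 (suc n) p312) (λ π → (- 1#) ^ des π * q ^ ⟨2-31⟩ π) ≈
      sumOver (𝔖 (suc n) p312) (λ π → (- 1#) ^ des π * q ^ ⟨2-13⟩ π) ×
      sumOver (𝔖 (suc n) p312) (λ π → (- 1#) ^ des π * q ^ ⟨2-13⟩ π) ≈
      ε-odd (suc n) ((- q) ^ ⌊ n /2⌋ * C ⌊ n /2⌋ (q ^ 2))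
    part-iii n =
      let 2-31-sum = 𝔖312-sum n ⟨2-31⟩ ⟨2-13⟩ 2-31-complement (𝔖132-2-13 n)
          2-13-sum = 𝔖312-sum n ⟨2-13⟩ ⟨2-31⟩ 2-13-complement (𝔖132-2-31 n)
      in  trans 2-31-sum (sym 2-13-sum) , trans 2-13-sum (catalanSolution≈ε n)

    2*⌊n/2⌋≡n : ∀ n → parity n ≡ 0ℙ → 2 ℕ.* ⌊ n /2⌋ ≡ n
    2*⌊n/2⌋≡n zero          _    = ≡.refl
    2*⌊n/2⌋≡n (suc (suc n)) even = ≡.trans (ℕ.*-suc 2 ⌊ n /2⌋) (≡.cong (2 ℕ.+_) (2*⌊n/2⌋≡n n even))

    part-iv : ∀ n → sumOver (𝔇* n p132) (λ π → (- 1#) ^ des π * q ^ ⟨2-31⟩ π) ≈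
      ε-even n ((- 1#) ^ ⌊ n /2⌋ * sumOver (𝔄 (2 ℕ.* ⌊ n /2⌋) p231) (λ π → q ^ ⟨13-2⟩ π))
    part-iv n = trans (𝔇*132-2-31 n) restrict
      where
      restrict : (- 1#) ^ ⌊ n /2⌋ * gf (downUp ⊙ q^2-31) n ≈
        ε-even n ((- 1#) ^ ⌊ n /2⌋ * sumOver (𝔄 (2 ℕ.* ⌊ n /2⌋) p231) (λ π → q ^ ⟨13-2⟩ π))
      restrict with parity n in eq
      ... | 0ℙ = trans (*-congˡ (trans (sym (𝔄231-13-2 n eq))
          (reflexive (≡.cong (λ m → sumOver (𝔄 m p231) (λ π → q ^ ⟨13-2⟩ π)) (≡.sym (2*⌊n/2⌋≡n n eq))))))
        (reflexive (≡.sym (ε-even-0ℙ n _ eq)))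
      ... | 1ℙ = trans (*-congˡ (downUp-supported q^2-31 n eq)) (trans (zeroʳ _) (reflexive (≡.sym (ε-even-1ℙ n _ eq))))

    part-v : ∀ n → sumOver (𝔇* n p132) (λ π → (- q) ^ des π * q ^ ⟨31-2⟩ π) ≈
      ε-even n ((- q) ^ ⌊ n /2⌋ * sumOver (𝔄 (2 ℕ.* ⌊ n /2⌋) p231) (λ π → q ^ ⟨2-13⟩ π))
    part-v n = trans (𝔇*132-31-2 n) restrict
      where
      restrict : (- q) ^ ⌊ n /2⌋ * gf (downUp ⊙ q^31-2) n ≈
        ε-even n ((- q) ^ ⌊ n /2⌋ * sumOver (𝔄 (2 ℕ.* ⌊ n /2⌋) p231) (λ π → q ^ ⟨2-13⟩ π))
      restrict with parity n in eq
      ... | 0ℙ = trans (*-congˡ (trans (sym (𝔄231-2-13 n eq))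
          (reflexive (≡.cong (λ m → sumOver (𝔄 m p231) (λ π → q ^ ⟨2-13⟩ π)) (≡.sym (2*⌊n/2⌋≡n n eq))))))
        (reflexive (≡.sym (ε-even-0ℙ n _ eq)))
      ... | 1ℙ = trans (*-congˡ (downUp-supported q^31-2 n eq)) (trans (zeroʳ _) (reflexive (≡.sym (ε-even-1ℙ n _ eq))))

    -1^suc*q^ : ∀ k → - 1# * (- q) ^ k ≈ (- 1#) ^ suc k * q ^ k
    -1^suc*q^ k = trans (*-congˡ (trans (^-congˡ k (sym (-1*x≈-x q))) (^-distrib-* (- 1#) q k))) (sym (*-assoc _ _ _))

    part-vi : ∀ n → sumOver (𝔇* (suc n) p213) (λ π → (- 1#) ^ des π * q ^ ⟨13-2⟩ π) ≈
      ε-even (suc n) ((- 1#) ^ ⌊ suc n /2⌋ * q ^ ⌊ suc n ∸ 2 /2⌋ * C ⌊ suc n ∸ 2 /2⌋ (q ^ 2))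
    -- The only permutation of length 1 has a foremaximum by the convention on π(n+1), so the sum is
    -- empty.
    part-vi zero    = reflexive (≡.sym (ε-even-1ℙ 1 _ ≡.refl))
    part-vi (suc n) = trans (𝔇*213-13-2 n) restrict
      where
      restrict : - 1# * catalanSolution q (suc n) ≈
        ε-even (suc (suc n)) ((- 1#) ^ suc ⌊ n /2⌋ * q ^ ⌊ n /2⌋ * C ⌊ n /2⌋ (q ^ 2))
      restrict with parity n in eq
      ... | 0ℙ = trans (*-congˡ (reflexive (odd-at-even n _ eq)))
        (trans (trans (sym (*-assoc _ _ _)) (*-congʳ (-1^suc*q^ ⌊ n /2⌋))) (reflexive (≡.sym (ε-even-0ℙ (suc (suc n)) _ eq))))
      ... | 1ℙ = trans (*-congˡ (reflexive (odd-at-odd n _ eq))) (trans (zeroʳ _) (reflexive (≡.sym (ε-even-1ℙ (suc (suc n)) _ eq))))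

    -- The two summands are the exponents that actually arise: n + 1 from the substitution z ↦ qz in
    -- `endsInZero·2-31-suc`, and n/2 from the factor (-q)^(n/2) of the Catalan term.
    ⌊[3n-4]/2⌋ : ∀ n → parity n ≡ 0ℙ → ⌊ 3 ℕ.* (2 ℕ.+ n) ∸ 4 /2⌋ ≡ suc n ℕ.+ ⌊ n /2⌋
    ⌊[3n-4]/2⌋ n even = ≡.trans (≡.cong (λ k → ⌊ k ∸ 4 /2⌋) (expand n)) (halve n even)
      where
      open +-*-Solver using (solve; con; _:=_; _:+_)
      expand : ∀ n → 3 ℕ.* (2 ℕ.+ n) ≡ 6 ℕ.+ 3 ℕ.* n
      expand n = ℕ.*-distribˡ-+ 3 2 n
      halve : ∀ n → parity n ≡ 0ℙ → ⌊ 2 ℕ.+ 3 ℕ.* n /2⌋ ≡ suc n ℕ.+ ⌊ n /2⌋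
      halve zero          _    = ≡.refl
      halve (suc (suc n)) even = ≡.trans (≡.cong (λ k → ⌊ 2 ℕ.+ k /2⌋) (expand n))
        (≡.trans (≡.cong (3 ℕ.+_) (halve n even))
          (solve 2 (λ n k → con 3 :+ (con 1 :+ n :+ k) := con 3 :+ n :+ (con 1 :+ k)) ≡.refl n ⌊ n /2⌋))

    part-vii : ∀ n → sumOver (𝔇* (suc n) p213) (λ π → (- q) ^ des π * q ^ ⟨31-2⟩ π) ≈
      ε-even (suc n) ((- 1#) ^ ⌊ suc n /2⌋ * q ^ ⌊ 3 ℕ.* suc n ∸ 4 /2⌋ * C ⌊ suc n ∸ 2 /2⌋ (q ^ 2))
    part-vii zero    = reflexive (≡.sym (ε-even-1ℙ 1 _ ≡.refl))
    part-vii (suc n) = trans (𝔇*213-31-2 n) restrict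
      where
      restrict : q ^ suc n * (- 1# * catalanSolution q (suc n)) ≈
        ε-even (suc (suc n)) ((- 1#) ^ suc ⌊ n /2⌋ * q ^ ⌊ 3 ℕ.* (2 ℕ.+ n) ∸ 4 /2⌋ * C ⌊ n /2⌋ (q ^ 2))
      restrict with parity n in eq
      ... | 0ℙ = begin
        q ^ suc n * (- 1# * catalanSolution q (suc n))
          ≈⟨ *-congˡ (*-congˡ (reflexive (odd-at-even n _ eq))) ⟩
        q ^ suc n * (- 1# * ((- q) ^ k * C k (q ^ 2)))          ≈⟨ *-congˡ (*-assoc _ _ _) ⟨
        q ^ suc n * (- 1# * (- q) ^ k * C k (q ^ 2))            ≈⟨ *-congˡ (*-congʳ (-1^suc*q^ k)) ⟩
        q ^ suc n * ((- 1#) ^ suc k * q ^ k * C k (q ^ 2))      ≈⟨ *-assoc _ _ _ ⟨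
        q ^ suc n * ((- 1#) ^ suc k * q ^ k) * C k (q ^ 2)      ≈⟨ *-congʳ (x∙yz≈y∙xz _ _ _) ⟩
        (- 1#) ^ suc k * (q ^ suc n * q ^ k) * C k (q ^ 2)
          ≈⟨ *-congʳ (*-congˡ (trans (sym (^-homo-* q (suc n) k)) (^-congʳ q (≡.sym (⌊[3n-4]/2⌋ n eq))))) ⟩
        (- 1#) ^ suc k * q ^ ⌊ 3 ℕ.* (2 ℕ.+ n) ∸ 4 /2⌋ * C k (q ^ 2) ≡⟨ ε-even-0ℙ (suc (suc n)) _ eq ⟨
        ε-even (suc (suc n)) ((- 1#) ^ suc k * q ^ ⌊ 3 ℕ.* (2 ℕ.+ n) ∸ 4 /2⌋ * C k (q ^ 2)) ∎
        where
        k : ℕ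
        k = ⌊ n /2⌋
      ... | 1ℙ = trans (*-congˡ (trans (*-congˡ (reflexive (odd-at-odd n _ eq))) (zeroʳ _)))
        (trans (zeroʳ _) (reflexive (≡.sym (ε-even-1ℙ (suc (suc n)) _ eq))))

-- Specialisation to integer polynomials in q

open import Defs

ε-odd-0ℙ : ∀ n F → parity n ≡ 0ℙ → ε-odd n F ≡ 0#
ε-odd-0ℙ n F eq rewrite eq = ≡.refl

ε-odd-1ℙ : ∀ n F → parity n ≡ 1ℙ → ε-odd n F ≡ F
ε-odd-1ℙ n F eq rewrite eq = ≡.refl

ε-even-0ℙ : ∀ n F → parity n ≡ 0ℙ → ε-even n F ≡ F
ε-even-0ℙ n F eq rewrite eq = ≡.refl

ε-even-1ℙ : ∀ n F → parity n ≡ 1ℙ → ε-even n F ≡ 0#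
ε-even-1ℙ n F eq rewrite eq = ≡.refl

theorem5p6 : (n : ℕ) → 1 ℕ.≤ n →
  -- (i)
    ((∑[ π ∈ 𝔖 n p132 ] (- 1#) ^ des π * q ^ ⟨2-31⟩ π) ≈ (∑[ π ∈ 𝔖 n p132 ] (- 1#) ^ des π * q ^ ⟨2-13⟩ π)
  × (∑[ π ∈ 𝔖 n p132 ] (- 1#) ^ des π * q ^ ⟨2-13⟩ π) ≈ ε-odd n ((- q) ^ ⌊ n ℕ.∸ 1 /2⌋ * C ⌊ n ℕ.∸ 1 /2⌋ (q ^ 2)))
  -- (ii)
  × ((∑[ π ∈ 𝔖 n p213 ] (- 1#) ^ des π * q ^ ⟨31-2⟩ π) ≈ (∑[ π ∈ 𝔖 n p213 ] (- 1#) ^ des π * q ^ ⟨13-2⟩ π)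
  × (∑[ π ∈ 𝔖 n p213 ] (- 1#) ^ des π * q ^ ⟨13-2⟩ π) ≈ ε-odd n ((- q) ^ ⌊ n ℕ.∸ 1 /2⌋ * C ⌊ n ℕ.∸ 1 /2⌋ (q ^ 2)))
  -- (iii)
  × ((∑[ π ∈ 𝔖 n p312 ] (- 1#) ^ des π * q ^ ⟨2-31⟩ π) ≈ (∑[ π ∈ 𝔖 n p312 ] (- 1#) ^ des π * q ^ ⟨2-13⟩ π)
  × (∑[ π ∈ 𝔖 n p312 ] (- 1#) ^ des π * q ^ ⟨2-13⟩ π) ≈ ε-odd n ((- q) ^ ⌊ n ℕ.∸ 1 /2⌋ * C ⌊ n ℕ.∸ 1 /2⌋ (q ^ 2)))
  -- (iv)
  × (∑[ π ∈ 𝔇* n p132 ] (- 1#) ^ des π * q ^ ⟨2-31⟩ π) ≈ ε-even n ((- 1#) ^ ⌊ n /2⌋ * Ĉ ⌊ n /2⌋)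
  -- (v)
  × (∑[ π ∈ 𝔇* n p132 ] (- q) ^ des π * q ^ ⟨31-2⟩ π) ≈ ε-even n ((- q) ^ ⌊ n /2⌋ * C̄ ⌊ n /2⌋)
  -- (vi)
  × (∑[ π ∈ 𝔇* n p213 ] (- 1#) ^ des π * q ^ ⟨13-2⟩ π)
      ≈ ε-even n ((- 1#) ^ ⌊ n /2⌋ * q ^ ⌊ n ℕ.∸ 2 /2⌋ * C ⌊ n ℕ.∸ 2 /2⌋ (q ^ 2))
  -- (vii)
  × (∑[ π ∈ 𝔇* n p213 ] (- q) ^ des π * q ^ ⟨31-2⟩ π)
      ≈ ε-even n ((- 1#) ^ ⌊ n /2⌋ * q ^ ⌊ 3 ℕ.* n ℕ.∸ 4 /2⌋ * C ⌊ n ℕ.∸ 2 /2⌋ (q ^ 2))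
theorem5p6 (suc n) _ =
  part-i n , part-ii n , part-iii n , part-iv (suc n) , part-v (suc n) , part-vi n , part-vii n
  where open Evaluation.Parts ℤ[q] q ε-odd ε-even ε-odd-0ℙ ε-odd-1ℙ ε-even-0ℙ ε-even-1ℙ
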